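{- Let $\mathcal{B}$ be a finite normal $\sqrt{\mathfrak{gl}_n}$-crystal. Then $$\mathsf{ch}(\mathcal{B})=\sum_{b\in\mathsf{HW}(\mathcal{B})} G_{\mathrm{wt}(b)}(x_1,x_2,\dots,x_n),$$ where, for each $b\in\mathsf{HW}(\mathcal{B})$, $\mathrm{wt}(b)$ is a partition with at most $n$ parts.
   Context: Fix a positive integer $n$; $[n]=\{1,\dots,n\}$ and $\mathbf{e}_1,\dots,\mathbf{e}_n$ is the standard basis of $\mathbb{Z}^n$. A $\sqrt{\mathfrak{gl}_n}$-crystal is a set $\mathcal{B}$ with maps $\mathrm{wt}:\mathcal{B}\to\mathbb{Z}^n$ and $e_i,f_i:\mathcal{B}\to\mathcal{B}\sqcup\{0\}$ for $i\in[n-1]$ (with $0\notin\mathcal{B}$, and $e_i(0)=f_i(0)=0$) such that, setting $\varepsilon_i(b)=\sup\{k\ge0:e_i^k(b)\ne0\}$ and $\varphi_i(b)=\sup\{k\ge0:f_i^k(b)\ne0\}$, for all $i$ and $b,c\in\mathcal{B}$: (a) $\varepsilon_i(b),\varphi_i(b)$ are finite and $\frac{\varphi_i(b)-\varepsilon_i(b)}{2}=\mathrm{wt}(b)_i-\mathrm{wt}(b)_{i+1}$; (b) $e_i(b)=c$ iff $f_i(c)=b$, in which case $\mathrm{wt}(c)-\mathrm{wt}(b)=\mathbf{e}_i$ if $\varepsilon_i(b)$ is even and $=-\mathbf{e}_{i+1}$ if $\varepsilon_i(b)$ is odd. The crystal graph has an edge $b\xrightarrow{i}c$ when $f_i(b)=c\ne0$;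 a full subcrystal is the vertex set of a weakly connected component of this graph, with the restricted structure; an isomorphism is a weight-preserving bijection commuting with all $e_i,f_i$. An element $b$ is highest weight if $e_i(b)=0$ for all $i$; $\mathsf{HW}(\mathcal{B})$ is the set of these. The tensor product $\mathcal{B}\otimes\mathcal{C}$ of two such crystals is the set of symbols $b\otimes c$ with $\mathrm{wt}(b\otimes c)=\mathrm{wt}(b)+\mathrm{wt}(c)$, $e_i(b\otimes c)=b\otimes e_i(c)$ if $\varepsilon_i(b)\le\varphi_i(c)$ and $=e_i(b)\otimes c$ otherwise, $f_i(b\otimes c)=b\otimes f_i(c)$ if $\varepsilon_i(b)<\varphi_i(c)$ and $=f_i(b)\otimes c$ otherwise, with $b\otimes0=0\otimes c=0$ (this is associative). The trivial crystal $\mathbb{1}_n=\{\emptyset\}$ has one element of weight $0$ with all $e_i,f_i$ zero. The standard crystal $\mathsf{SS}_n$ is the set of nonempty subsets $S\subseteq[n]$ with $\mathrm{wt}(S)=\sum_{j\in S}\mathbf{e}_j$; $e_i(S)=S\cup\{i\}$ if $S\cap\{i,i+1\}=\{i+1\}$, $e_i(S)=S\setminus\{i+1\}$ if $S\cap\{i,i+1\}=\{i,i+1\}$, $e_i(S)=0$ otherwise; $f_i(S)=S\cup\{i+1\}$ if $S\cap\{i,i+1\}=\{i\}$, $f_i(S)=S\setminus\{i\}$ if $S\cap\{i,i+1\}=\{i,i+1\}$, $f_i(S)=0$ otherwise. A $\sqrt{\mathfrak{gl}_n}$-crystal is normal if each full subcrystal is isomorphic to a full subcrystal of $\mathsf{SS}_n^{\otimes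 m}$ for some $m\ge0$ (with $\mathsf{SS}_n^{\otimes0}=\mathbb{1}_n$). For finite $\mathcal{B}$, $\mathsf{ch}(\mathcal{B})=\sum_{b\in\mathcal{B}}x^{\mathrm{wt}(b)}$ where $x^{\alpha}=x_1^{\alpha_1}\cdots x_n^{\alpha_n}$. For a partition $\lambda$ with at most $n$ parts, with Young diagram $\{(i,j):1\le j\le\lambda_i\}$ (matrix coordinates), a semistandard set-valued tableau of shape $\lambda$ fills each box with a nonempty subset of $[n]$ such that every choice of one element from each box gives weakly increasing rows and strictly increasing columns; its weight is $\sum_{\text{boxes}}\sum_{k\in\text{entry}}\mathbf{e}_k$. The symmetric Grothendieck polynomial $G_\lambda(x_1,\dots,x_n)$ is the sum of $x^{\mathrm{wt}(T)}$ over all such tableaux $T$. -}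

module Defs where

open import Data.Nat as ℕ using (ℕ; zero; suc; _^_; _≤ᵇ_; _<ᵇ_)
import Data.Nat.Properties as ℕP
open import Data.Integer as ℤ using (ℤ; +_; ∣_∣)
open import Data.Bool using (Bool; true; false; if_then_else_; T; _∨_)
open import Data.Maybe using (Maybe; just; nothing) renaming (map to mapMaybe)
open import Data.Fin using (Fin; zero; suc; inject₁; toℕ)
import Data.Fin.Properties as FinP
open import Data.Fin.Subset using (Subset; _∈_)
open import Data.Fin.Subset.Properties using (_∈?_)
open import Data.Vec using (Vec; []; _∷_; lookup; _[_]≔_; replicate; zipWith)
import Data.Vec as Vec
open import Data.List using (List; []; _∷_; map; concatMap; length; upTo; allFin; filter)
import Data.List as List
open import Data.Product using (Σ; _×_; _,_; proj₁; proj₂; ∃; ∃-syntax)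
open import Data.Unit using (⊤; tt)
open import Relation.Nullary using (Dec; yes; no; ¬_)
open import Relation.Nullary.Decidable using (_×-dec_; _→-dec_; T?)
open import Relation.Binary.PropositionalEquality using (_≡_; _≢_; refl)
open import Relation.Binary.Construct.Closure.Equivalence using (EqClosure)
open import Function.Bundles using (_↔_; Inverse)

-- Conventions.  We fix n = suc k (n positive).  Coordinates of weights
-- are Fin (suc k) (0-based: paper's j is our j-1).  Crystal operators are
-- indexed by i : Fin k (paper's i ∈ [n-1] is our i, 0-based), acting on
-- the coordinates  lo i  (paper's i) and  hi i  (paper's i+1).

Wt : ℕ → Set
Wt k = Vec ℤ (suc k)

lo hi : ∀ {k} → Fin k → Fin (suc k)
lo i = inject₁ i
hi i = suc i

unit : ∀ {k} → Fin (suc k) → Wt k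
unit j = replicate _ (+ 0) [ j ]≔ (+ 1)

_⊕_ : ∀ {k} → Wt k → Wt k → Wt k
_⊕_ = zipWith ℤ._+_

zeroWt : ∀ {k} → Wt k
zeroWt = replicate _ (+ 0)

-- iteration of a partial map (0 is modelled by nothing); iter g j b = g^j(b)
iter : {A : Set} → (A → Maybe A) → ℕ → A → Maybe A
iter g zero b = just b
iter g (suc j) b with iter g j b
... | nothing = nothing
... | just c = g c

evenᵇ : ℕ → Bool
evenᵇ zero = true
evenᵇ (suc zero) = false
evenᵇ (suc (suc j)) = evenᵇ j

record RawCrystal (k : ℕ) : Set₁ where
  field
    Carrier : Set
    wt : Carrier → Wt k
    e f : Fin k → Carrier → Maybe Carrier

open RawCrystal public

module _ {k : ℕ} (B : RawCrystal k) where

  -- "ε_i(b) = j": sup{ m : e_i^m b ≠ 0 } = j  (finite)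
  IsEps : Fin k → Carrier B → ℕ → Set
  IsEps i b j = (iter (e B i) j b ≢ nothing) × (iter (e B i) (suc j) b ≡ nothing)

  IsPhi : Fin k → Carrier B → ℕ → Set
  IsPhi i b j = (iter (f B i) j b ≢ nothing) × (iter (f B i) (suc j) b ≡ nothing)

  shift : Fin k → ℕ → Wt k
  shift i j = if evenᵇ j then unit (lo i) else Vec.map ℤ.-_ (unit (hi i))

  record IsCrystal : Set where
    field
      axiom-a : ∀ i b → ∃[ ε ] ∃[ φ ] IsEps i b ε × IsPhi i b φ ×
                  ((+ φ) ℤ.- (+ ε) ≡ (+ 2) ℤ.* (lookup (wt B b) (lo i) ℤ.- lookup (wt B b) (hi i)))
      axiom-b-to : ∀ i b c → e B i b ≡ just c → f B i c ≡ just b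
      axiom-b-from : ∀ i b c → f B i c ≡ just b → e B i b ≡ just c
      axiom-b-wt : ∀ i b c ε → e B i b ≡ just c → IsEps i b ε →
                     wt B c ≡ wt B b ⊕ shift i ε

  Edge : Carrier B → Carrier B → Set
  Edge b c = ∃[ i ] f B i b ≡ just c

  -- b and c lie in the same weakly connected component (full subcrystal)
  Conn : Carrier B → Carrier B → Set
  Conn = EqClosure Edge

  IsHW : Carrier B → Set
  IsHW b = ∀ i → e B i b ≡ nothing

record ComponentIso {k} (B : RawCrystal k) (b : Carrier B)
                        (C : RawCrystal k) (c : Carrier C) : Set₁ where
  field
    to : Carrier B → Carrier C
    from : Carrier C → Carrier B
    to-conn : ∀ x → Conn B b x → Conn C c (to x)
    from-conn : ∀ y → Conn C c y → Conn B b (from y)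
    from-to : ∀ x → Conn B b x → from (to x) ≡ x
    to-from : ∀ y → Conn C c y → to (from y) ≡ y
    to-wt : ∀ x → Conn B b x → wt C (to x) ≡ wt B x
    to-e : ∀ i x → Conn B b x → e C i (to x) ≡ mapMaybe to (e B i x)
    to-f : ∀ i x → Conn B b x → f C i (to x) ≡ mapMaybe to (f B i x)

nonemptyᵇ : ∀ {n} → Subset n → Bool
nonemptyᵇ [] = false
nonemptyᵇ (x ∷ S) = x ∨ nonemptyᵇ S

SSel : ℕ → Set
SSel n = Σ (Subset n) (λ S → T (nonemptyᵇ S))

-- smart constructor (the check never fails where it is used below)
mkSS : ∀ {n} → Subset n → Maybe (SSel n)
mkSS S with T? (nonemptyᵇ S)
... | yes p = just (S , p)
... | no _ = nothing

indicator : ∀ {k} → Subset (suc k) → Wt k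
indicator = Vec.map (λ b → if b then + 1 else + 0)

wtSS : ∀ {k} → SSel (suc k) → Wt k
wtSS (S , _) = indicator S

eSS : ∀ {k} → Fin k → SSel (suc k) → Maybe (SSel (suc k))
eSS i (S , _) with lookup S (lo i) | lookup S (hi i)
... | false | true = mkSS (S [ lo i ]≔ true)
... | true  | true = mkSS (S [ hi i ]≔ false)
... | _     | _    = nothing

fSS : ∀ {k} → Fin k → SSel (suc k) → Maybe (SSel (suc k))
fSS i (S , _) with lookup S (lo i) | lookup S (hi i)
... | true | false = mkSS (S [ hi i ]≔ true)
... | true | true  = mkSS (S [ lo i ]≔ false)
... | _    | _     = nothing

count : {A : Set} → (A → Maybe A) → ℕ → A → ℕ
count g zero a = 0
count g (suc F) a with g a
... | nothing = 0
... | just a' = suc (count g F a')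

-- fuel bound: (2^n)^m ≥ |SS_n^{⊗m}|, so any finite e_i- or f_i-string in
-- SS_n^{⊗m} (whose elements are pairwise distinct) is shorter than it
fuel : ℕ → ℕ → ℕ
fuel k m = (2 ^ suc k) ^ m

εSS φSS : ∀ {k} → Fin k → SSel (suc k) → ℕ
εSS {k} i S = count (eSS i) (fuel k 1) S
φSS {k} i S = count (fSS i) (fuel k 1) S

-- SS^{⊗0} = 𝟙 (the single empty word), SS^{⊗(m+1)} = SS ⊗ SS^{⊗m};
-- the word  S ∷ w  stands for  S ⊗ w
mutual
  eT : ∀ {k} m → Fin k → Vec (SSel (suc k)) m → Maybe (Vec (SSel (suc k)) m)
  eT zero i [] = nothing
  eT (suc m) i (S ∷ w) =
    if εSS i S ≤ᵇ φT m i w then mapMaybe (S ∷_) (eT m i w)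
                           else mapMaybe (_∷ w) (eSS i S)

  fT : ∀ {k} m → Fin k → Vec (SSel (suc k)) m → Maybe (Vec (SSel (suc k)) m)
  fT zero i [] = nothing
  fT (suc m) i (S ∷ w) =
    if εSS i S <ᵇ φT m i w then mapMaybe (S ∷_) (fT m i w)
                           else mapMaybe (_∷ w) (fSS i S)

  φT : ∀ {k} m → Fin k → Vec (SSel (suc k)) m → ℕ
  φT {k} m i w = count (fT m i) (fuel k m) w

wtT : ∀ {k} m → Vec (SSel (suc k)) m → Wt k
wtT zero [] = zeroWt
wtT (suc m) (S ∷ w) = wtSS S ⊕ wtT m w

SSpow : (k m : ℕ) → RawCrystal k
SSpow k m = record
  { Carrier = Vec (SSel (suc k)) m
  ; wt = wtT m
  ; e = eT m
  ; f = fT m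
  }

IsNormal : ∀ {k} → RawCrystal k → Set₁
IsNormal {k} B = ∀ b → ∃[ m ] ∃[ s ] ComponentIso B b (SSpow k m) s

Finite : Set → Set
Finite A = Σ ℕ (λ N → Fin N ↔ A)

elements : {A : Set} → Finite A → List A
elements (N , bij) = map (Inverse.to bij) (allFin N)

-- ch(B) as the multiset (list up to permutation) of monomials x^{wt b}
ch : ∀ {k} (B : RawCrystal k) → Finite (Carrier B) → List (Wt k)
ch B fin = map (wt B) (elements fin)

isNothing? : {A : Set} (x : Maybe A) → Dec (x ≡ nothing)
isNothing? nothing = yes refl
isNothing? (just _) = no (λ ())

IsHW? : ∀ {k} (B : RawCrystal k) b → Dec (IsHW B b)
IsHW? B b = FinP.all? (λ i → isNothing? (e B i b))

HWlist : ∀ {k} (B : RawCrystal k) → Finite (Carrier B) → List (Carrier B)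
HWlist B fin = filter (IsHW? B) (elements fin)

IsPartition : ∀ {k} → Wt k → Set
IsPartition {k} α = (∀ j → + 0 ℤ.≤ lookup α j) ×
                    (∀ (i : Fin k) → lookup α (hi i) ℤ.≤ lookup α (lo i))

boxes : ∀ {k} → Vec ℕ (suc k) → List (ℕ × ℕ)
boxes {k} λ′ = concatMap (λ r → map (λ c → (toℕ r , c)) (upTo (lookup λ′ r))) (allFin (suc k))

Filling : ∀ {k} → Vec ℕ (suc k) → Set
Filling {k} λ′ = Vec (Subset (suc k)) (length (boxes λ′))

module _ {k : ℕ} (λ′ : Vec ℕ (suc k)) (F : Filling λ′) where
  private
    box = List.lookup (boxes λ′)

  -- every entry nonempty; every choice of one element per box gives weakly
  -- increasing rows and strictly increasing columns
  IsSVT : Set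
  IsSVT = (∀ p → T (nonemptyᵇ (lookup F p))) ×
          (∀ p q → proj₁ (box p) ≡ proj₁ (box q) → proj₂ (box p) ℕ.< proj₂ (box q) →
             ∀ a b → a ∈ lookup F p → b ∈ lookup F q → a Data.Fin.≤ b) ×
          (∀ p q → proj₂ (box p) ≡ proj₂ (box q) → proj₁ (box p) ℕ.< proj₁ (box q) →
             ∀ a b → a ∈ lookup F p → b ∈ lookup F q → a Data.Fin.< b)

  IsSVT? : Dec IsSVT
  IsSVT? =
    FinP.all? (λ p → T? (nonemptyᵇ (lookup F p))) ×-dec
    (FinP.all? λ p → FinP.all? λ q →
      (proj₁ (box p) ℕP.≟ proj₁ (box q)) →-dec ((proj₂ (box p) ℕP.<? proj₂ (box q)) →-dec
      FinP.all? λ a → FinP.all? λ b →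
        (a ∈? lookup F p) →-dec ((b ∈? lookup F q) →-dec (a FinP.≤? b)))) ×-dec
    (FinP.all? λ p → FinP.all? λ q →
      (proj₂ (box p) ℕP.≟ proj₂ (box q)) →-dec ((proj₁ (box p) ℕP.<? proj₁ (box q)) →-dec
      FinP.all? λ a → FinP.all? λ b →
        (a ∈? lookup F p) →-dec ((b ∈? lookup F q) →-dec (a FinP.<? b))))

allVecs : {A : Set} → List A → (L : ℕ) → List (Vec A L)
allVecs xs zero = [] ∷ []
allVecs xs (suc L) = concatMap (λ x → map (x ∷_) (allVecs xs L)) xs

allSubsets : (n : ℕ) → List (Subset n)
allSubsets n = allVecs (true ∷ false ∷ []) n

wtFilling : ∀ {k} {L} → Vec (Subset (suc k)) L → Wt k
wtFilling [] = zeroWt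
wtFilling (S ∷ F) = indicator S ⊕ wtFilling F

SVTs : ∀ {k} (λ′ : Vec ℕ (suc k)) → List (Filling λ′)
SVTs {k} λ′ = filter (IsSVT? λ′) (allVecs (allSubsets (suc k)) (length (boxes λ′)))

-- G_λ(x_1..x_n) as the multiset of monomials x^{wt T}
G : ∀ {k} → Vec ℕ (suc k) → List (Wt k)
G λ′ = map wtFilling (SVTs λ′)

-- a weight vector read as a shape (used only for partitions)
shapeOf : ∀ {k} → Wt k → Vec ℕ (suc k)
shapeOf = Vec.map ∣_∣

-- Write T_j for the shift of the j-th coordinate by one, j = 0, 1, 2, …, and for an antisymmetric
-- function g on weights put κ(α) = (∏_j (1 + T_j⁻¹)^j g)(α), which is  K 0 α g  below.  The pairings
-- Σ κ(α) over its monomials x^α determine a symmetric polynomial: for g supported on the rearrangements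
-- of λ − (0, 1, 2, …) they are triangular.  Along an i-string, the weights below the top come in pairs
-- β, β − e_i, and κ(β) + κ(β − e_i) changes sign when the coordinates i and i+1 are exchanged; since
-- strings have symmetric weights, the sum of κ over a string without its top vanishes.  In a tensor
-- power of SS the elements that are not highest weight split into such truncated strings: in
-- v ⊗ S ⊗ c with c highest weight and S ⊗ c not, follow the largest i with ε_i(S) > φ_i(c).  Hence
-- ch(B) has pairing Σ κ(wt b), over highest weight b.  The column reading words of the set-valued
-- tableaux of shape λ are closed under all e_i and f_i, and the only highest weight one among them has
-- row r filled with {r}; so the same argument shows that G_λ has pairing κ(λ).

module Submission where

open import Defs
open import Data.Bool using (Bool; true; false; not; if_then_else_; T)
import Data.Bool.Properties as BoolP
open import Data.Empty using (⊥; ⊥-elim)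
open import Data.Fin as Fin using (Fin; zero; suc; toℕ; fromℕ<)
import Data.Fin.Properties as FinP
open import Data.Fin.Subset using (Subset)
open import Data.Integer as ℤ using (ℤ; +_; -[1+_]; 0ℤ; 1ℤ; ∣_∣)
import Data.Integer.Properties as ℤP
open import Data.Integer.Tactic.RingSolver using (solve-∀)
open import Data.List as List using (List; []; _∷_; _++_; map; concatMap; allFin; upTo; filter; length)
import Data.List.Properties as ListP
import Data.List.Membership.DecPropositional as DecMembership
open import Data.List.Membership.Propositional using (_∈_; _∉_; find; lose)
open import Data.List.Membership.Propositional.Properties
  using (∈-∃++; ∈-++⁻; ∈-++⁺ˡ; ∈-++⁺ʳ; ∈-map⁻; ∈-map⁺; ∈-filter⁺; ∈-filter⁻;
         ∈-concatMap⁺; ∈-concatMap⁻; ∈-upTo⁺; ∈-upTo⁻; ∈-allFin; ∈-lookup)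
open import Data.List.Membership.Propositional.Properties.WithK using (unique∧set⇒bag)
open import Data.List.Relation.Binary.BagAndSetEquality using (∼bag⇒↭)
open import Data.List.Relation.Binary.Permutation.Propositional as Perm
  using (_↭_; ↭-refl; ↭-sym; ↭-trans; ↭-reflexive; ↭⇒↭ₛ)
open import Data.List.Relation.Binary.Permutation.Propositional.Properties
  using (map⁺; ++⁺; ∈-resp-↭) renaming (shift to ↭-shift)
import Data.List.Relation.Binary.Permutation.Setoid.Properties as PermS
open import Data.List.Relation.Unary.All as All using (All; []; _∷_)
import Data.List.Relation.Unary.All.Properties as AllP
open import Data.List.Relation.Unary.AllPairs as AllPairs using (AllPairs; []; _∷_)
import Data.List.Relation.Unary.AllPairs.Properties as AllPairsP
open import Data.List.Relation.Unary.Any as Any using (here; there)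
import Data.List.Relation.Unary.Any.Properties as AnyP
open import Data.List.Relation.Unary.Linked.Properties using (Linked⇒AllPairs)
open import Data.List.Relation.Unary.Unique.Propositional using (Unique)
import Data.List.Relation.Unary.Unique.Propositional.Properties as UniqueP
import Data.List.Sort
open import Data.Maybe using (Maybe; just; nothing; fromMaybe) renaming (map to mapMaybe)
open import Data.Maybe.Properties using (just-injective)
open import Data.Nat as ℕ using (ℕ; zero; suc)
import Data.Nat.Properties as ℕP
open import Data.Product using (_×_; _,_; proj₁; proj₂; ∃)
open import Data.Product.Relation.Binary.Lex.NonStrict using (×-decTotalOrder)
open import Data.Sum using (_⊎_; inj₁; inj₂)
open import Data.Unit using (⊤; tt)
open import Data.Vec as Vec using (Vec; []; _∷_; lookup; replicate; _[_]≔_)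
import Data.Vec.Properties as VecP
open import Function.Bundles using (Inverse; Equivalence; mk⇔)
open import Relation.Binary.Bundles using (DecTotalOrder)
import Relation.Binary.Construct.Closure.Equivalence as EqC
open import Relation.Binary.Construct.Closure.ReflexiveTransitive using (_◅_; _◅◅_) renaming (ε to done)
open import Relation.Binary.Construct.Closure.Symmetric using (bwd)
import Relation.Binary.Construct.Flip.EqAndOrd as Flip
import Relation.Binary.Construct.On as On
open import Relation.Binary.Definitions using (tri<; tri≈; tri>)
open import Relation.Binary.PropositionalEquality
  using (_≡_; _≢_; refl; sym; trans; cong; cong₂; subst; subst₂; setoid; module ≡-Reasoning)
open import Relation.Nullary using (Dec; yes; no; ¬_; ¬?)
open import Relation.Nullary.Decidable using (T?; map′)
open import Relation.Unary using (Decidable)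

-- Sums over lists

-- Summed over the monomials of f, `K 0 α g` is the coefficient pairing of f · ∏_j (1 + x_j⁻¹)^j
-- with g. For symmetric f and antisymmetric g the product may be antisymmetrised, at the cost of a
-- factor n!, and becomes the Vandermonde product ∏_{i<j} (x_j⁻¹ - x_i⁻¹). So the pairings see f
-- times a Vandermonde product, and nothing is ever divided by it. Any other constant in place of
-- the 1 in 1 + x_j⁻¹ would give the same values on symmetric f; the constant 1 is what lets the
-- pairs β, β - e_i of a string cancel.
--
-- The top of a string belongs to no pair, so an element can be cancelled only along a string of
-- which it is not the top, and all of the truncated string must agree on that choice. In a tensor
-- power the choice can be read off the word. Normality gives embeddings of single components only,
-- so the choice is pulled back along maps fixed component by component. No component is compared
-- with a crystal of tableaux: the two sides meet only in their sums over highest weight elements.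

module _ {A : Set} where

  ∑ : (A → ℤ) → List A → ℤ
  ∑ h [] = + 0
  ∑ h (x ∷ xs) = h x ℤ.+ ∑ h xs

  ∑-cong : ∀ {h h′} xs → (∀ {x} → x ∈ xs → h x ≡ h′ x) → ∑ h xs ≡ ∑ h′ xs
  ∑-cong [] eq = refl
  ∑-cong (x ∷ xs) eq = cong₂ ℤ._+_ (eq (here refl)) (∑-cong xs (λ m → eq (there m)))

  ∑-++ : ∀ h xs ys → ∑ h (xs ++ ys) ≡ ∑ h xs ℤ.+ ∑ h ys
  ∑-++ h [] ys = sym (ℤP.+-identityˡ _)
  ∑-++ h (x ∷ xs) ys = trans (cong (ℤ._+_ (h x)) (∑-++ h xs ys)) (sym (ℤP.+-assoc (h x) _ _))

  ∑-+ : ∀ h h′ xs → ∑ (λ x → h x ℤ.+ h′ x) xs ≡ ∑ h xs ℤ.+ ∑ h′ xs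
  ∑-+ h h′ [] = refl
  ∑-+ h h′ (x ∷ xs) rewrite ∑-+ h h′ xs = lem (h x) (h′ x) _ _
    where
    lem : ∀ a b c d → a ℤ.+ b ℤ.+ (c ℤ.+ d) ≡ a ℤ.+ c ℤ.+ (b ℤ.+ d)
    lem = solve-∀

  ∑-neg : ∀ h xs → ∑ (λ x → ℤ.- h x) xs ≡ ℤ.- ∑ h xs
  ∑-neg h [] = refl
  ∑-neg h (x ∷ xs) rewrite ∑-neg h xs = sym (ℤP.neg-distrib-+ (h x) _)

  ∑-↭ : ∀ h {xs ys} → xs ↭ ys → ∑ h xs ≡ ∑ h ys
  ∑-↭ h Perm.refl = refl
  ∑-↭ h (Perm.prep x p) = cong (ℤ._+_ (h x)) (∑-↭ h p)
  ∑-↭ h (Perm.swap {xs} {ys} x y p) = trans (cong (λ z → h x ℤ.+ (h y ℤ.+ z)) (∑-↭ h p)) (lem (h x) (h y) _)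
    where
    lem : ∀ a b c → a ℤ.+ (b ℤ.+ c) ≡ b ℤ.+ (a ℤ.+ c)
    lem = solve-∀
  ∑-↭ h (Perm.trans p q) = trans (∑-↭ h p) (∑-↭ h q)

  ∑-filter : ∀ {P : A → Set} (P? : Decidable P) (Q? : Decidable (λ x → ¬ P x)) h xs →
             ∑ h xs ≡ ∑ h (filter P? xs) ℤ.+ ∑ h (filter Q? xs)
  ∑-filter P? Q? h [] = refl
  ∑-filter P? Q? h (x ∷ xs) with P? x | Q? x
  ... | yes p | yes q = ⊥-elim (q p)
  ... | no p | no q = ⊥-elim (q p)
  ... | yes p | no q = trans (cong (ℤ._+_ (h x)) (∑-filter P? Q? h xs)) (sym (ℤP.+-assoc (h x) _ _))
  ... | no p | yes q = trans (cong (ℤ._+_ (h x)) (∑-filter P? Q? h xs)) (lem (h x) (∑ h (filter P? xs)) _)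
    where
    lem : ∀ a b c → a ℤ.+ (b ℤ.+ c) ≡ b ℤ.+ (a ℤ.+ c)
    lem = solve-∀

  unique-↭ : ∀ {xs ys : List A} → Unique xs → Unique ys →
             (∀ {z} → z ∈ xs → z ∈ ys) → (∀ {z} → z ∈ ys → z ∈ xs) → xs ↭ ys
  unique-↭ ux uy to from = ∼bag⇒↭ (unique∧set⇒bag ux uy (mk⇔ to from))

∑-map : ∀ {A B : Set} (h : B → ℤ) (g : A → B) xs → ∑ h (map g xs) ≡ ∑ (λ x → h (g x)) xs
∑-map h g [] = refl
∑-map h g (x ∷ xs) = cong (ℤ._+_ (h (g x))) (∑-map h g xs)

∑-concatMap : ∀ {A B : Set} (h : B → ℤ) (g : A → List B) xs → ∑ h (concatMap g xs) ≡ ∑ (λ x → ∑ h (g x)) xs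
∑-concatMap h g [] = refl
∑-concatMap h g (x ∷ xs) = trans (∑-++ h (g x) (concatMap g xs)) (cong (ℤ._+_ (∑ h (g x))) (∑-concatMap h g xs))

module _ {A B : Set} (f : A → B) (g : B → A) where

  unique-map : ∀ {xs} → Unique xs → (∀ {x} → x ∈ xs → g (f x) ≡ x) → Unique (map f xs)
  unique-map {[]} u inv = []
  unique-map {x ∷ xs} (x∉ ∷ u) inv =
    All.tabulate fresh ∷ unique-map u (λ m → inv (there m))
    where
    fresh : ∀ {y} → y ∈ map f xs → f x ≢ y
    fresh y∈ eq with ∈-map⁻ f y∈
    ... | x′ , x′∈ , refl = All.lookup x∉ x′∈
      (trans (sym (inv (here refl))) (trans (cong g eq) (inv (there x′∈))))

  bijection-↭ : ∀ {xs ys} → Unique xs → Unique ys →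
                (∀ {x} → x ∈ xs → f x ∈ ys × g (f x) ≡ x) →
                (∀ {y} → y ∈ ys → g y ∈ xs × f (g y) ≡ y) → map f xs ↭ ys
  bijection-↭ {xs} {ys} ux uy to from = unique-↭ (unique-map ux (λ m → proj₂ (to m))) uy
    (λ z∈ → t z∈) (λ z∈ → subst (_∈ map f xs) (proj₂ (from z∈)) (∈-map⁺ f (proj₁ (from z∈))))
    where
    t : ∀ {z} → z ∈ map f xs → z ∈ ys
    t z∈ with ∈-map⁻ f z∈
    ... | x , x∈ , refl = proj₁ (to x∈)

self-negative⇒0 : ∀ (x : ℤ) → x ≡ ℤ.- x → x ≡ + 0
self-negative⇒0 (+ zero) eq = refl
self-negative⇒0 (+ suc n) ()
self-negative⇒0 -[1+ n ] ()

-- Pairings of symmetric polynomials with alternants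

module Alternants where

  open import Data.Integer using (_+_; _-_; _*_; -_; _≤_; _<_; _≤?_; _≟_; +≤+; +<+; ≢-nonZero)
  open import Data.Integer.Properties

  +-cancelʳ : ∀ a b c → a + c ≡ b + c → a ≡ b
  +-cancelʳ a b c eq = trans (sym (lem a c)) (trans (cong (_- c) eq) (lem b c))
    where
    lem : ∀ a c → a + c - c ≡ a
    lem = solve-∀

  swapAt : ∀ {A : Set} {k} → Fin k → Vec A (suc k) → Vec A (suc k)
  swapAt zero (x ∷ y ∷ v) = y ∷ x ∷ v
  swapAt (suc i) (x ∷ v) = x ∷ swapAt i v

  swapAt-involutive : ∀ {A : Set} {k} (i : Fin k) (v : Vec A (suc k)) → swapAt i (swapAt i v) ≡ v
  swapAt-involutive zero (x ∷ y ∷ v) = refl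
  swapAt-involutive (suc i) (x ∷ v) = cong (x ∷_) (swapAt-involutive i v)

  decAt : ∀ {k} → Fin k → Vec ℤ (suc k) → Vec ℤ (suc k)
  decAt zero (x ∷ v) = x - 1ℤ ∷ v
  decAt (suc i) (x ∷ v) = x ∷ decAt i v

  Antisym : ∀ {k} → (Vec ℤ (suc k) → ℤ) → Set
  Antisym {k} g = ∀ (i : Fin k) v → g (swapAt i v) ≡ - g v

  -- The operator (1 + T⁻¹)ʲ, where T⁻¹ shifts the argument by −1.
  pw : ℕ → (ℤ → ℤ) → ℤ → ℤ
  pw zero h x = h x
  pw (suc j) h x = pw j h x + pw j h (x - 1ℤ)

  -- ∏ᵢ (1 + Tᵢ⁻¹)^{j+i} applied to g.
  K : ∀ {n} → ℕ → Vec ℤ n → (Vec ℤ n → ℤ) → ℤ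
  K j [] g = g []
  K j (x ∷ xs) g = pw j (λ y → K (suc j) xs (λ ys → g (y ∷ ys))) x

  pw-cong : ∀ j {h h′} → (∀ y → h y ≡ h′ y) → ∀ x → pw j h x ≡ pw j h′ x
  pw-cong zero eq x = eq x
  pw-cong (suc j) eq x = cong₂ _+_ (pw-cong j eq x) (pw-cong j eq (x - 1ℤ))

  +-interchange : ∀ a b c d → a + b + (c + d) ≡ a + c + (b + d)
  +-interchange = solve-∀

  pw-+ : ∀ j h h′ x → pw j (λ y → h y + h′ y) x ≡ pw j h x + pw j h′ x
  pw-+ zero h h′ x = refl
  pw-+ (suc j) h h′ x = trans (cong₂ _+_ (pw-+ j h h′ x) (pw-+ j h h′ (x - 1ℤ)))
    (+-interchange (pw j h x) (pw j h′ x) (pw j h (x - 1ℤ)) (pw j h′ (x - 1ℤ)))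

  pw-neg : ∀ j h x → pw j (λ y → - h y) x ≡ - pw j h x
  pw-neg zero h x = refl
  pw-neg (suc j) h x = trans (cong₂ _+_ (pw-neg j h x) (pw-neg j h (x - 1ℤ)))
    (sym (neg-distrib-+ (pw j h x) (pw j h (x - 1ℤ))))

  pw-comm : ∀ a b (h : ℤ → ℤ → ℤ) x y →
            pw a (λ x′ → pw b (h x′) y) x ≡ pw b (λ y′ → pw a (λ x′ → h x′ y′) x) y
  pw-comm zero b h x y = refl
  pw-comm (suc a) b h x y = trans (cong₂ _+_ (pw-comm a b h x y) (pw-comm a b h (x - 1ℤ) y))
    (sym (pw-+ b (λ y′ → pw a (λ x′ → h x′ y′) x) (λ y′ → pw a (λ x′ → h x′ y′) (x - 1ℤ)) y))

  K-cong : ∀ {n} j (xs : Vec ℤ n) {g g′} → (∀ v → g v ≡ g′ v) → K j xs g ≡ K j xs g′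
  K-cong j [] eq = eq []
  K-cong j (x ∷ xs) eq = pw-cong j (λ y → K-cong (suc j) xs (λ v → eq (y ∷ v))) x

  K-neg : ∀ {n} j (xs : Vec ℤ n) g → K j xs (λ v → - g v) ≡ - K j xs g
  K-neg j [] g = refl
  K-neg j (x ∷ xs) g = trans (pw-cong j (λ y → K-neg (suc j) xs (λ v → g (y ∷ v))) x)
    (pw-neg j (λ y → K (suc j) xs (λ v → g (y ∷ v))) x)

  -- Adding the shifted copy raises the exponent at position i to that at position i+1,
  -- so the operator commutes with the exchange of the two coordinates.
  K-pair-antisym : ∀ {k} j {g : Vec ℤ (suc k) → ℤ} → Antisym g → ∀ i v →
    K j (swapAt i v) g + K j (decAt i (swapAt i v)) g ≡ - (K j v g + K j (decAt i v) g)
  K-pair-antisym j {g} as zero (x ∷ y ∷ zs) = begin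
    pw (suc j) (λ a → pw (suc j) (h a) x) y                ≡⟨ pw-comm (suc j) (suc j) h y x ⟩
    pw (suc j) (λ b → pw (suc j) (λ a → h a b) y) x        ≡⟨ pw-cong (suc j) (λ b → pw-cong (suc j) (λ a → anti a b) y) x ⟩
    pw (suc j) (λ b → pw (suc j) (λ a → - h b a) y) x      ≡⟨ pw-cong (suc j) (λ b → pw-neg (suc j) (h b) y) x ⟩
    pw (suc j) (λ b → - pw (suc j) (h b) y) x              ≡⟨ pw-neg (suc j) (λ b → pw (suc j) (h b) y) x ⟩
    - pw (suc j) (λ b → pw (suc j) (h b) y) x ∎
    where
    open ≡-Reasoning
    h : ℤ → ℤ → ℤ
    h a b = K (suc (suc j)) zs (λ v → g (a ∷ b ∷ v))
    anti : ∀ a b → h a b ≡ - h b a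
    anti a b = trans (K-cong (suc (suc j)) zs (λ v → as zero (b ∷ a ∷ v))) (K-neg (suc (suc j)) zs (λ v → g (b ∷ a ∷ v)))
  K-pair-antisym j {g} as (suc i) (x ∷ v) = begin
    pw j (F (swapAt i v)) x + pw j (F (decAt i (swapAt i v))) x
      ≡⟨ sym (pw-+ j (F (swapAt i v)) (F (decAt i (swapAt i v))) x) ⟩
    pw j (λ y → F (swapAt i v) y + F (decAt i (swapAt i v)) y) x
      ≡⟨ pw-cong j (λ y → K-pair-antisym (suc j) (λ i′ v′ → as (suc i′) (y ∷ v′)) i v) x ⟩
    pw j (λ y → - (F v y + F (decAt i v) y)) x
      ≡⟨ pw-neg j (λ y → F v y + F (decAt i v) y) x ⟩
    - pw j (λ y → F v y + F (decAt i v) y) x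
      ≡⟨ cong -_ (pw-+ j (F v) (F (decAt i v)) x) ⟩
    - (pw j (F v) x + pw j (F (decAt i v)) x) ∎
    where
    open ≡-Reasoning
    F : Vec ℤ _ → ℤ → ℤ
    F u y = K (suc j) u (λ ys → g (y ∷ ys))

  -- Lowest terms of the pairing

  deg : ∀ {n} → Vec ℤ n → ℤ
  deg [] = 0ℤ
  deg (x ∷ xs) = x + deg xs

  stair : ∀ {n} → ℕ → Vec ℤ n → Vec ℤ n
  stair j [] = []
  stair j (x ∷ xs) = x - + j ∷ stair (suc j) xs

  step-suc : ∀ (x : ℤ) j → x - 1ℤ - + j ≡ x - + suc j
  step-suc x j = lem x (+ j)
    where
    lem : ∀ a b → a - 1ℤ - b ≡ a - (1ℤ + b)
    lem = solve-∀

  -- The arguments at which `pw j h x` evaluates `h` are x, x - 1, ..., x - j. Only the last, which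
  -- occurs with coefficient one, escapes the vanishing hypothesis.
  pw-lowest : ∀ j h x → (∀ y → x - + j < y → h y ≡ 0ℤ) → pw j h x ≡ h (x - + j)
  pw-lowest zero h x z = cong h (sym (+-identityʳ x))
  pw-lowest (suc j) h x z = begin
    pw j h x + pw j h (x - 1ℤ)             ≡⟨ cong₂ _+_ (pw-lowest j h x z₁) (pw-lowest j h (x - 1ℤ) z₂) ⟩
    h (x - + j) + h (x - 1ℤ - + j)         ≡⟨ cong₂ _+_ (z (x - + j) lt) (cong h (step-suc x j)) ⟩
    0ℤ + h (x - + suc j)                  ≡⟨ +-identityˡ _ ⟩
    h (x - + suc j) ∎
    where
    open ≡-Reasoning
    lt : x - + suc j < x - + j
    lt = +-monoʳ-< x (neg-mono-< (+<+ (ℕP.n<1+n j)))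
    z₁ : ∀ y → x - + j < y → h y ≡ 0ℤ
    z₁ y l = z y (<-trans lt l)
    z₂ : ∀ y → x - 1ℤ - + j < y → h y ≡ 0ℤ
    z₂ y l = z y (subst (_< y) (step-suc x j) l)

  -- Expanding all factors evaluates `g` at `xs` lowered by at most j, j + 1, ... in its successive
  -- coordinates. Every such vector other than the fully lowered one has larger degree than
  -- `stair j xs`.
  K-lowest : ∀ {n} j (xs : Vec ℤ n) g → (∀ v → deg (stair j xs) < deg v → g v ≡ 0ℤ) →
             K j xs g ≡ g (stair j xs)
  K-lowest j [] g z = refl
  K-lowest j (x ∷ xs) g z = trans (pw-lowest j h x vanish) (at (x - + j) ≤-refl)
    where
    h : ℤ → ℤ
    h y = K (suc j) xs (λ ys → g (y ∷ ys))
    at : ∀ y → x - + j ≤ y → h y ≡ g (y ∷ stair (suc j) xs)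
    at y l = K-lowest (suc j) xs (λ ys → g (y ∷ ys)) (λ v d → z (y ∷ v) (+-mono-≤-< l d))
    vanish : ∀ y → x - + j < y → h y ≡ 0ℤ
    vanish y l = trans (at y (<⇒≤ l)) (z _ (+-monoˡ-< (deg (stair (suc j) xs)) l))

  -- Vandermonde products and sorting

  diffs : ∀ {n} → ℤ → Vec ℤ n → ℤ
  diffs x [] = 1ℤ
  diffs x (y ∷ ys) = (x - y) * diffs x ys

  vandermonde : ∀ {n} → Vec ℤ n → ℤ
  vandermonde [] = 1ℤ
  vandermonde (x ∷ xs) = diffs x xs * vandermonde xs

  diffs-swapAt : ∀ {k} x (i : Fin k) v → diffs x (swapAt i v) ≡ diffs x v
  diffs-swapAt x zero (y ∷ z ∷ v) = lem (x - z) (x - y) (diffs x v)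
    where
    lem : ∀ a b c → a * (b * c) ≡ b * (a * c)
    lem = solve-∀
  diffs-swapAt x (suc i) (y ∷ v) = cong ((x - y) *_) (diffs-swapAt x i v)

  vandermonde-swapAt : ∀ {k} (i : Fin k) v → vandermonde (swapAt i v) ≡ - vandermonde v
  vandermonde-swapAt zero (x ∷ y ∷ v) = lem x y (diffs x v) (diffs y v) (vandermonde v)
    where
    lem : ∀ x y a b c → (y - x) * b * (a * c) ≡ - ((x - y) * a * (b * c))
    lem = solve-∀
  vandermonde-swapAt (suc i) (x ∷ v) = begin
    diffs x (swapAt i v) * vandermonde (swapAt i v) ≡⟨ cong₂ _*_ (diffs-swapAt x i v) (vandermonde-swapAt i v) ⟩
    diffs x v * - vandermonde v                     ≡⟨ sym (neg-distribʳ-* (diffs x v) (vandermonde v)) ⟩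
    - (diffs x v * vandermonde v) ∎
    where open ≡-Reasoning

  insert : ∀ {n} → ℤ → Vec ℤ n → Vec ℤ (suc n)
  insert x [] = x ∷ []
  insert x (y ∷ ys) with x ≤? y
  ... | yes _ = y ∷ insert x ys
  ... | no _ = x ∷ y ∷ ys

  -- Decreasing order, so that partitions are sorted and their `stair` is strictly decreasing.
  sort : ∀ {n} → Vec ℤ n → Vec ℤ n
  sort [] = []
  sort (x ∷ xs) = insert x (sort xs)

  insert-≤ : ∀ {n} x y (ys : Vec ℤ n) → x ≤ y → insert x (y ∷ ys) ≡ y ∷ insert x ys
  insert-≤ x y ys l with x ≤? y
  ... | yes _ = refl
  ... | no ¬l = ⊥-elim (¬l l)

  insert-> : ∀ {n} x y (ys : Vec ℤ n) → y < x → insert x (y ∷ ys) ≡ x ∷ y ∷ ys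
  insert-> x y ys l with x ≤? y
  ... | yes l′ = ⊥-elim (<⇒≱ l l′)
  ... | no _ = refl

  insert-comm-< : ∀ {n} x y (u : Vec ℤ n) → x < y → insert x (insert y u) ≡ insert y (insert x u)
  insert-comm-< x y [] l = trans (insert-≤ x y [] (<⇒≤ l)) (sym (insert-> y x [] l))
  insert-comm-< x y (z ∷ zs) l with x ≤? z | y ≤? z
  ... | yes p | yes q = trans (insert-≤ x z (insert y zs) p)
    (trans (cong (z ∷_) (insert-comm-< x y zs l)) (sym (insert-≤ y z (insert x zs) q)))
  ... | yes p | no q = trans (insert-≤ x y (z ∷ zs) (<⇒≤ l))
    (trans (cong (y ∷_) (insert-≤ x z zs p)) (sym (insert-> y z (insert x zs) (≰⇒> q))))
  ... | no p | yes q = ⊥-elim (p (≤-trans (<⇒≤ l) q))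
  ... | no p | no q = trans (insert-≤ x y (z ∷ zs) (<⇒≤ l))
    (trans (cong (y ∷_) (insert-> x z zs (≰⇒> p))) (sym (insert-> y x (z ∷ zs) l)))

  insert-comm : ∀ {n} x y (u : Vec ℤ n) → insert x (insert y u) ≡ insert y (insert x u)
  insert-comm x y u with <-cmp x y
  ... | tri< l _ _ = insert-comm-< x y u l
  ... | tri≈ _ refl _ = refl
  ... | tri> _ _ l = sym (insert-comm-< y x u l)

  sort-swapAt : ∀ {k} (i : Fin k) v → sort (swapAt i v) ≡ sort v
  sort-swapAt zero (x ∷ y ∷ v) = insert-comm y x (sort v)
  sort-swapAt (suc i) (x ∷ v) = cong (insert x) (sort-swapAt i v)

  insert-induction : ∀ {n} (P : Vec ℤ (suc n) → Set) → (∀ (i : Fin n) v → P (swapAt i v) → P v) →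
                     ∀ x (u : Vec ℤ n) → P (insert x u) → P (x ∷ u)
  insert-induction P inv x [] p = p
  insert-induction P inv x (y ∷ ys) p with x ≤? y
  ... | no _ = p
  ... | yes _ = inv zero (x ∷ y ∷ ys)
    (insert-induction (λ u → P (y ∷ u)) (λ i v → inv (suc i) (y ∷ v)) x ys p)

  -- Insertion sort is a sequence of adjacent exchanges, and each of them can be undone for `P`.
  -- This spreads a statement about a sorted weight to all its rearrangements.
  sort-induction : ∀ {k} (P : Vec ℤ (suc k) → Set) → (∀ (i : Fin k) v → P (swapAt i v) → P v) →
                   ∀ v → P (sort v) → P v
  sort-induction P inv (x ∷ []) p = p
  sort-induction P inv (x ∷ xs@(_ ∷ _)) p =
    sort-induction (λ u → P (x ∷ u)) (λ i v → inv (suc i) (x ∷ v)) xs (insert-induction P inv x (sort xs) p)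

  deg-insert : ∀ {n} x (u : Vec ℤ n) → deg (insert x u) ≡ x + deg u
  deg-insert x [] = refl
  deg-insert x (y ∷ ys) with x ≤? y
  ... | no _ = refl
  ... | yes _ = trans (cong (_+_ y) (deg-insert x ys)) (lem y x (deg ys))
    where
    lem : ∀ a b c → a + (b + c) ≡ b + (a + c)
    lem = solve-∀

  deg-sort : ∀ {n} (v : Vec ℤ n) → deg (sort v) ≡ deg v
  deg-sort [] = refl
  deg-sort (x ∷ xs) = trans (deg-insert x (sort xs)) (cong (_+_ x) (deg-sort xs))

  -- The squared length of v + (s, s + 1, ...), the analogue of |v + ρ|². Shifting by (j, j + 1,
  -- ...) undoes `stair j`, and among the rearrangements of a vector the decreasing one has the
  -- least `norm`. This orders the weights of equal degree whose stairs are rearrangements of each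
  -- other.
  norm : ∀ {n} → ℤ → Vec ℤ n → ℤ
  norm s [] = 0ℤ
  norm s (x ∷ xs) = (x + s) * (x + s) + norm (1ℤ + s) xs

  norm-swap : ∀ {n} s x y (u : Vec ℤ n) → norm s (x ∷ y ∷ u) ≡ norm s (y ∷ x ∷ u) + + 2 * (y - x)
  norm-swap s x y u = lem s x y (norm (1ℤ + (1ℤ + s)) u)
    where
    lem : ∀ s x y q → (x + s) * (x + s) + ((y + (1ℤ + s)) * (y + (1ℤ + s)) + q) ≡
          (y + s) * (y + s) + ((x + (1ℤ + s)) * (x + (1ℤ + s)) + q) + + 2 * (y - x)
    lem = solve-∀

  norm-swap-< : ∀ {n} s {x y} (u : Vec ℤ n) → x < y → norm s (y ∷ x ∷ u) < norm s (x ∷ y ∷ u)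
  norm-swap-< s {x} {y} u l = subst₂ _<_ (+-identityʳ _) (sym (norm-swap s x y u))
    (+-monoʳ-< (norm s (y ∷ x ∷ u)) (*-monoˡ-<-pos (+ 2) (0<d l)))
    where
    0<d : x < y → 0ℤ < y - x
    0<d l = subst (_< y - x) (+-inverseʳ x) (+-monoˡ-< (- x) l)

  -- Moving `x` past a strictly larger entry lowers `norm` by `norm-swap`, and moving it past an
  -- equal entry changes nothing; hence the two alternatives.
  norm-insert : ∀ {n} s x (u : Vec ℤ n) → insert x u ≡ x ∷ u ⊎ norm s (insert x u) < norm s (x ∷ u)
  norm-insert s x [] = inj₁ refl
  norm-insert s x (y ∷ ys) with x ≤? y
  ... | no _ = inj₁ refl
  ... | yes l with norm-insert (1ℤ + s) x ys | x ≟ y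
  ... | inj₁ eq | yes refl = inj₁ (cong (x ∷_) eq)
  ... | inj₁ eq | no x≢y rewrite eq = inj₂ (norm-swap-< s ys (≤∧≢⇒< l x≢y))
  ... | inj₂ lt | yes refl = inj₂ (+-monoʳ-< ((x + s) * (x + s)) lt)
  ... | inj₂ lt | no x≢y = inj₂ (<-trans (+-monoʳ-< ((y + s) * (y + s)) lt) (norm-swap-< s ys (≤∧≢⇒< l x≢y)))

  norm-sort : ∀ {n} s (v : Vec ℤ n) → sort v ≡ v ⊎ norm s (sort v) < norm s v
  norm-sort s [] = inj₁ refl
  norm-sort s (x ∷ xs) with norm-insert s x (sort xs) | norm-sort (1ℤ + s) xs
  ... | inj₁ eq | inj₁ eq′ = inj₁ (trans eq (cong (x ∷_) eq′))
  ... | inj₁ eq | inj₂ lt = inj₂ (subst (λ w → norm s w < norm s (x ∷ xs)) (sym eq) (+-monoʳ-< ((x + s) * (x + s)) lt))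
  ... | inj₂ lt | inj₁ eq′ = inj₂ (subst (λ w → norm s (insert x (sort xs)) < norm s (x ∷ w)) eq′ lt)
  ... | inj₂ lt | inj₂ lt′ = inj₂ (<-trans lt (+-monoʳ-< ((x + s) * (x + s)) lt′))

  sumSq : ∀ {n} → Vec ℤ n → ℤ
  sumSq [] = 0ℤ
  sumSq (x ∷ xs) = x * x + sumSq xs

  norm-stair : ∀ {n} j (v : Vec ℤ n) → norm (+ j) (stair j v) ≡ sumSq v
  norm-stair j [] = refl
  norm-stair j (x ∷ xs) = cong₂ _+_ (lem x (+ j)) (norm-stair (suc j) xs)
    where
    lem : ∀ x j → (x - j + j) * (x - j + j) ≡ x * x
    lem = solve-∀

  sumSq-insert : ∀ {n} x (u : Vec ℤ n) → sumSq (insert x u) ≡ x * x + sumSq u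
  sumSq-insert x [] = refl
  sumSq-insert x (y ∷ ys) with x ≤? y
  ... | no _ = refl
  ... | yes _ = trans (cong (_+_ (y * y)) (sumSq-insert x ys)) (lem (y * y) (x * x) (sumSq ys))
    where
    lem : ∀ a b c → a + (b + c) ≡ b + (a + c)
    lem = solve-∀

  sumSq-sort : ∀ {n} (v : Vec ℤ n) → sumSq (sort v) ≡ sumSq v
  sumSq-sort [] = refl
  sumSq-sort (x ∷ xs) = trans (sumSq-insert x (sort xs)) (cong (_+_ (x * x)) (sumSq-sort xs))

  stair-injective : ∀ {n} j (u v : Vec ℤ n) → stair j u ≡ stair j v → u ≡ v
  stair-injective j [] [] eq = refl
  stair-injective j (x ∷ u) (y ∷ v) eq with VecP.∷-injective eq
  ... | p , q = cong₂ _∷_ (+-cancelʳ x y (- + j) p) (stair-injective (suc j) u v q)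

  -- The constant is j + (j + 1) + ⋯. Only its independence of `v` matters, since it is cancelled in
  -- every comparison of degrees.
  deg-stair : ∀ {n} j → ∃ λ c → ∀ (v : Vec ℤ n) → deg (stair j v) ≡ deg v - c
  deg-stair {zero} j = 0ℤ , λ { [] → refl }
  deg-stair {suc n} j with deg-stair {n} (suc j)
  ... | c , h = + j + c , λ { (x ∷ v) → trans (cong (_+_ (x - + j)) (h v)) (lem x (+ j) (deg v) c) }
    where
    lem : ∀ x j d c → x - j + (d - c) ≡ x + d - (j + c)
    lem = solve-∀

  data Desc (_R_ : ℤ → ℤ → Set) : ∀ {n} → Vec ℤ n → Set where
    [] : Desc _R_ []
    [-] : ∀ {x} → Desc _R_ (x ∷ [])
    _∷_ : ∀ {n x y} {u : Vec ℤ n} → y R x → Desc _R_ (y ∷ u) → Desc _R_ (x ∷ y ∷ u)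

  insert-desc : ∀ {n} x (u : Vec ℤ n) → Desc _≤_ u → Desc _≤_ (insert x u)
  insert-desc x [] d = [-]
  insert-desc x (y ∷ []) d with x ≤? y
  ... | yes l = l ∷ [-]
  ... | no l = <⇒≤ (≰⇒> l) ∷ d
  insert-desc x (y ∷ z ∷ u) (r ∷ d) with x ≤? y
  ... | no l = <⇒≤ (≰⇒> l) ∷ r ∷ d
  ... | yes l with x ≤? z | insert-desc x (z ∷ u) d
  ... | yes _ | d′ = r ∷ d′
  ... | no _ | d′ = l ∷ d′

  sort-desc : ∀ {n} (v : Vec ℤ n) → Desc _≤_ (sort v)
  sort-desc [] = []
  sort-desc (x ∷ xs) = insert-desc x (sort xs) (sort-desc xs)

  stair-desc : ∀ {n} j (v : Vec ℤ n) → Desc _≤_ v → Desc _<_ (stair j v)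
  stair-desc j [] [] = []
  stair-desc j (x ∷ []) [-] = [-]
  stair-desc j (x ∷ y ∷ v) (l ∷ d) =
    +-mono-≤-< l (neg-mono-< (+<+ (ℕP.n<1+n j))) ∷ stair-desc (suc j) (y ∷ v) d

  sort-strict : ∀ {n} (v : Vec ℤ n) → Desc _<_ v → sort v ≡ v
  sort-strict [] d = refl
  sort-strict (x ∷ []) d = refl
  sort-strict (x ∷ y ∷ v) (l ∷ d) = trans (cong (insert x) (sort-strict (y ∷ v) d)) (insert-> x y v l)

  *-≢0 : ∀ a b → a ≢ 0ℤ → b ≢ 0ℤ → a * b ≢ 0ℤ
  *-≢0 a b p q eq with i*j≡0⇒i≡0∨j≡0 a eq
  ... | inj₁ z = p z
  ... | inj₂ z = q z

  vandermonde-strict : ∀ {n} (v : Vec ℤ n) → Desc _<_ v → vandermonde v ≢ 0ℤ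
  vandermonde-strict [] d ()
  vandermonde-strict (x ∷ []) d ()
  vandermonde-strict (x ∷ y ∷ v) (l ∷ d) =
    *-≢0 (diffs x (y ∷ v)) (vandermonde (y ∷ v)) (diffs-strict x (y ∷ v) (l ∷ d)) (vandermonde-strict (y ∷ v) d)
    where
    diffs-strict : ∀ {n} x (u : Vec ℤ n) → Desc _<_ (x ∷ u) → diffs x u ≢ 0ℤ
    diffs-strict x [] d ()
    diffs-strict x (y ∷ []) (l ∷ d) = *-≢0 (x - y) 1ℤ (λ eq → <-irrefl (sym (i-j≡0⇒i≡j x y eq)) l) (λ ())
    diffs-strict x (y ∷ z ∷ u) (l ∷ m ∷ d) = *-≢0 (x - y) (diffs x (z ∷ u))
      (λ eq → <-irrefl (sym (i-j≡0⇒i≡j x y eq)) l) (diffs-strict x (z ∷ u) (<-trans m l ∷ d))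

  -- Alternants and triangularity

  _≟ᵛ_ : ∀ {n} (u v : Vec ℤ n) → Dec (u ≡ v)
  _≟ᵛ_ = VecP.≡-dec _≟_

  when : ∀ {P : Set} → Dec P → ℤ → ℤ
  when (yes _) z = z
  when (no _) z = 0ℤ

  -- The test function supported on the rearrangements of `μ`. The Vandermonde product takes the
  -- place of the sign of the sorting permutation: it is antisymmetric and nonzero on distinct
  -- entries, so neither permutations nor signs have to be constructed.
  alternant : ∀ {n} → Vec ℤ n → Vec ℤ n → ℤ
  alternant μ v = when (sort v ≟ᵛ μ) (vandermonde v)

  alternant-antisym : ∀ {k} (μ : Vec ℤ (suc k)) → Antisym (alternant μ)
  alternant-antisym μ i v rewrite sort-swapAt i v with sort v ≟ᵛ μ
  ... | yes _ = vandermonde-swapAt i v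
  ... | no _ = refl

  alternant-support : ∀ {n} {μ v : Vec ℤ n} → alternant μ v ≢ 0ℤ → sort v ≡ μ
  alternant-support {μ = μ} {v} ne with sort v ≟ᵛ μ
  ... | yes eq = eq
  ... | no _ = ⊥-elim (ne refl)

  -- Sorting preserves the degree, so the alternant lives in the degree of `stair 0 λ′`. When `β`
  -- has at least the degree of `λ′`, every term of the expansion except the lowest lies above that
  -- degree.
  alternant-lowest : ∀ {n} (λ′ β : Vec ℤ n) → deg λ′ ≤ deg β →
    K 0 β (alternant (stair 0 λ′)) ≡ alternant (stair 0 λ′) (stair 0 β)
  alternant-lowest {n} λ′ β le = K-lowest 0 β (alternant (stair 0 λ′)) vanish
    where
    c = proj₁ (deg-stair {n} 0)
    vanish : ∀ v → deg (stair 0 β) < deg v → alternant (stair 0 λ′) v ≡ 0ℤ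
    vanish v lt with sort v ≟ᵛ stair 0 λ′
    ... | no _ = refl
    ... | yes eq = ⊥-elim (<⇒≱ lt (subst₂ _≤_ (trans (sym (proj₂ (deg-stair 0) λ′)) (trans (cong deg (sym eq)) (deg-sort v)))
                     (sym (proj₂ (deg-stair 0) β)) (+-monoˡ-≤ (- c) le)))

  alternant-self : ∀ {n} (λ′ : Vec ℤ n) → Desc _≤_ λ′ → K 0 λ′ (alternant (stair 0 λ′)) ≢ 0ℤ
  alternant-self λ′ d eq = vandermonde-strict μ dμ (trans (sym at-μ) (trans (sym (alternant-lowest λ′ λ′ ≤-refl)) eq))
    where
    μ = stair 0 λ′
    dμ = stair-desc 0 λ′ d
    at-μ : alternant μ μ ≡ vandermonde μ
    at-μ with sort μ ≟ᵛ μ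
    ... | yes _ = refl
    ... | no ne = ⊥-elim (ne (sort-strict μ dμ))

  -- The triangularity. If `β` has at least the degree of `λ′`, then `stair 0 β` is a rearrangement
  -- of the decreasing `stair 0 λ′`. The degrees are then equal, and sorting a vector different from
  -- its sorted form strictly lowers `norm`, which on stairs is the squared length of the weight.
  alternant-other : ∀ {n} (λ′ β : Vec ℤ n) → K 0 β (alternant (stair 0 λ′)) ≢ 0ℤ → β ≢ λ′ →
    deg β < deg λ′ ⊎ (deg β ≡ deg λ′ × sumSq λ′ < sumSq β)
  alternant-other {n} λ′ β ne β≢ with deg λ′ ≤? deg β
  ... | no gt = inj₁ (≰⇒> gt)
  ... | yes le = inj₂ (deg-eq , bigger (norm-sort (+ 0) (stair 0 β)))
    where
    sorted : sort (stair 0 β) ≡ stair 0 λ′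
    sorted = alternant-support {v = stair 0 β} (λ z → ne (trans (alternant-lowest λ′ β le) z))
    deg-eq : deg β ≡ deg λ′
    deg-eq = +-cancelʳ (deg β) (deg λ′) (- proj₁ (deg-stair {n} 0))
      (trans (sym (proj₂ (deg-stair 0) β)) (trans (sym (deg-sort (stair 0 β))) (trans (cong deg sorted) (proj₂ (deg-stair 0) λ′))))
    bigger : sort (stair 0 β) ≡ stair 0 β ⊎ norm (+ 0) (sort (stair 0 β)) < norm (+ 0) (stair 0 β) → sumSq λ′ < sumSq β
    bigger (inj₁ eq) = ⊥-elim (β≢ (stair-injective 0 β λ′ (trans (sym eq) sorted)))
    bigger (inj₂ lt) = subst₂ _<_ (trans (cong (norm (+ 0)) sorted) (norm-stair 0 λ′)) (norm-stair 0 β) lt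

  -- Multiplicities of monomials

  δ : ∀ {n} → Vec ℤ n → Vec ℤ n → ℤ
  δ α β = when (β ≟ᵛ α) 1ℤ

  mult : ∀ {n} → Vec ℤ n → List (Vec ℤ n) → ℤ
  mult α L = ∑ (δ α) L

  module _ {n : ℕ} where

    δ-self : ∀ (α : Vec ℤ n) → δ α α ≡ 1ℤ
    δ-self α with α ≟ᵛ α
    ... | yes _ = refl
    ... | no ne = ⊥-elim (ne refl)

    δ-other : ∀ {α β : Vec ℤ n} → β ≢ α → δ α β ≡ 0ℤ
    δ-other {α} {β} ne with β ≟ᵛ α
    ... | yes eq = ⊥-elim (ne eq)
    ... | no _ = refl

    δ-nonneg : ∀ (α β : Vec ℤ n) → 0ℤ ≤ δ α β
    δ-nonneg α β with β ≟ᵛ α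
    ... | yes _ = +≤+ ℕ.z≤n
    ... | no _ = +≤+ ℕ.z≤n

    mult-nonneg : ∀ (α : Vec ℤ n) L → 0ℤ ≤ mult α L
    mult-nonneg α [] = ≤-refl
    mult-nonneg α (β ∷ L) = +-mono-≤ (δ-nonneg α β) (mult-nonneg α L)

    mult-head : ∀ (α : Vec ℤ n) L → mult α (α ∷ L) ≢ 0ℤ
    mult-head α L eq = <-irrefl (sym eq) (subst (λ z → 0ℤ < z + mult α L) (sym (δ-self α)) (+-mono-<-≤ (+<+ (ℕ.s≤s ℕ.z≤n)) (mult-nonneg α L)))

    mult-∉ : ∀ {α : Vec ℤ n} L → α ∉ L → mult α L ≡ 0ℤ
    mult-∉ [] _ = refl
    mult-∉ {α} (β ∷ L) α∉ = cong₂ _+_ (δ-other (λ eq → α∉ (here (sym eq)))) (mult-∉ L (λ m → α∉ (there m)))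

    open DecMembership (_≟ᵛ_ {n}) using (_∈?_)

    mult-↭ : ∀ {L L′ : List (Vec ℤ n)} → (∀ α → mult α L ≡ mult α L′) → L ↭ L′
    mult-↭ {[]} {[]} h = Perm.refl
    mult-↭ {[]} {β ∷ L′} h = ⊥-elim (mult-head β L′ (sym (h β)))
    mult-↭ {α ∷ L} {L′} h with α ∈? L′
    ... | no α∉ = ⊥-elim (mult-head α L (trans (h α) (mult-∉ L′ α∉)))
    ... | yes α∈ with ∈-∃++ α∈
    ... | us , vs , refl = ↭-trans (Perm.prep α (mult-↭ rest)) (↭-sym (↭-shift α us vs))
      where
      rest : ∀ β → mult β L ≡ mult β (us ++ vs)
      rest β = +-cancelʳ _ _ (δ β α) (trans (+-comm (mult β L) _) (trans (h β)
        (trans (∑-↭ (δ β) (↭-shift α us vs)) (+-comm (δ β α) _))))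

    mult-filter-yes : ∀ {P : Vec ℤ n → Set} (P? : ∀ α → Dec (P α)) {α} → P α → ∀ L → mult α (filter P? L) ≡ mult α L
    mult-filter-yes P? p [] = refl
    mult-filter-yes P? {α} p (β ∷ L) with P? β
    ... | yes _ = cong (_+_ (δ α β)) (mult-filter-yes P? p L)
    ... | no ¬p = trans (mult-filter-yes P? p L) (trans (sym (+-identityˡ _))
      (cong (_+ mult α L) (sym (δ-other {α} {β} λ { refl → ¬p p }))))

    mult-filter-no : ∀ {P : Vec ℤ n → Set} (P? : ∀ α → Dec (P α)) {α} → ¬ P α → ∀ L → mult α (filter P? L) ≡ 0ℤ
    mult-filter-no P? ¬p L = mult-∉ (filter P? L) (λ m → ¬p (proj₂ (∈-filter⁻ P? {xs = L} m)))

    ∑-filter-support : ∀ (h : Vec ℤ n → ℤ) L → ∑ h (filter (λ α → ¬? (h α ≟ 0ℤ)) L) ≡ ∑ h L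
    ∑-filter-support h [] = refl
    ∑-filter-support h (α ∷ L) with h α ≟ 0ℤ
    ... | no _ = cong (_+_ (h α)) (∑-filter-support h L)
    ... | yes eq = trans (∑-filter-support h L) (trans (sym (+-identityˡ _)) (cong (_+ ∑ h L) (sym eq)))

    -- Restricted to the support of `h`, the two lists have equal multiplicities everywhere and are
    -- therefore permutations of each other.
    ∑-mult-cong : ∀ (h : Vec ℤ n → ℤ) L L′ → (∀ α → h α ≢ 0ℤ → mult α L ≡ mult α L′) → ∑ h L ≡ ∑ h L′
    ∑-mult-cong h L L′ eq = trans (sym (∑-filter-support h L))
      (trans (∑-↭ h (mult-↭ {filter S? L} {filter S? L′} same)) (∑-filter-support h L′))
      where
      S? = λ α → ¬? (h α ≟ 0ℤ)
      same : ∀ α → mult α (filter S? L) ≡ mult α (filter S? L′)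
      same α with h α ≟ 0ℤ
      ... | no ne = trans (mult-filter-yes S? ne L) (trans (eq α ne) (sym (mult-filter-yes S? ne L′)))
      ... | yes z = trans (mult-filter-no S? (λ ne → ne z) L) (sym (mult-filter-no S? (λ ne → ne z) L′))

    ∑-scale : ∀ c (h : Vec ℤ n → ℤ) L → ∑ (λ α → c * h α) L ≡ c * ∑ h L
    ∑-scale c h [] = sym (*-zeroʳ c)
    ∑-scale c h (α ∷ L) = trans (cong (_+_ (c * h α)) (∑-scale c h L)) (sym (*-distribˡ-+ c (h α) (∑ h L)))

    -- A linear equation in one unknown. The function `h₀` is `h` with its value at `λ′` removed, so
    -- its sums over both lists agree; what is left is `h λ′` times the multiplicity of `λ′`, and
    -- the factor cancels.
    mult-determined : ∀ (h : Vec ℤ n → ℤ) L L′ λ′ → ∑ h L ≡ ∑ h L′ → h λ′ ≢ 0ℤ →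
      (∀ β → h β ≢ 0ℤ → β ≢ λ′ → mult β L ≡ mult β L′) → mult λ′ L ≡ mult λ′ L′
    mult-determined h L L′ λ′ sums ne others =
      *-cancelˡ-≡ (h λ′) _ _ {{≢-nonZero ne}} (+-cancelʳ _ _ (∑ h₀ L)
        (trans (sym (split L)) (trans sums (trans (split L′)
          (cong (_+_ (h λ′ * mult λ′ L′)) (sym (∑-mult-cong h₀ L L′ eq₀)))))))
      where
      h₀ : Vec ℤ n → ℤ
      h₀ β = h β - h λ′ * δ λ′ β
      split : ∀ M → ∑ h M ≡ h λ′ * mult λ′ M + ∑ h₀ M
      split M = trans (∑-cong M (λ {β} _ → lem (h β) (h λ′ * δ λ′ β)))
        (trans (∑-+ (λ β → h λ′ * δ λ′ β) h₀ M) (cong (_+ ∑ h₀ M) (∑-scale (h λ′) (δ λ′) M)))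
        where
        lem : ∀ a b → a ≡ b + (a - b)
        lem = solve-∀
      eq₀ : ∀ β → h₀ β ≢ 0ℤ → mult β L ≡ mult β L′
      eq₀ β ne₀ with β ≟ᵛ λ′
      ... | yes refl = ⊥-elim (ne₀ (trans (cong (λ z → h β - h β * z) refl) (trans (cong (λ z → h β - z) (*-identityʳ (h β))) (+-inverseʳ (h β)))))
      ... | no β≢ = others β (λ z → ne₀ (trans (cong (λ z → h β - z) (*-zeroʳ (h λ′))) (trans (+-identityʳ (h β)) z))) β≢

  NonNeg : ∀ {n} → Vec ℤ n → Set
  NonNeg v = ∀ j → 0ℤ ≤ lookup v j

  deg-nonneg : ∀ {n} (v : Vec ℤ n) → NonNeg v → 0ℤ ≤ deg v
  deg-nonneg [] nn = ≤-refl
  deg-nonneg (x ∷ v) nn = +-mono-≤ (nn zero) (deg-nonneg v (λ j → nn (suc j)))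

  *-nonneg : ∀ {a b} → 0ℤ ≤ a → 0ℤ ≤ b → 0ℤ ≤ a * b
  *-nonneg {+ a} {+ b} _ _ = subst (0ℤ ≤_) (pos-* a b) (+≤+ ℕ.z≤n)

  square-nonneg : ∀ a → 0ℤ ≤ a * a
  square-nonneg (+ a) = subst (0ℤ ≤_) (pos-* a a) (+≤+ ℕ.z≤n)
  square-nonneg -[1+ a ] = +≤+ ℕ.z≤n

  sumSq-nonneg : ∀ {n} (v : Vec ℤ n) → 0ℤ ≤ sumSq v
  sumSq-nonneg [] = ≤-refl
  sumSq-nonneg (x ∷ v) = +-mono-≤ (square-nonneg x) (sumSq-nonneg v)

  sumSq≤deg² : ∀ {n} (v : Vec ℤ n) → NonNeg v → sumSq v ≤ deg v * deg v
  sumSq≤deg² [] nn = ≤-refl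
  sumSq≤deg² (x ∷ v) nn = ≤-trans (+-monoʳ-≤ (x * x) (sumSq≤deg² v nn′))
    (subst₂ _≤_ (+-identityʳ _) (sym (lem x (deg v))) (+-monoʳ-≤ (x * x + deg v * deg v) cross))
    where
    nn′ : NonNeg v
    nn′ j = nn (suc j)
    cross : 0ℤ ≤ x * deg v + x * deg v
    cross = +-mono-≤ (*-nonneg (nn zero) (deg-nonneg v nn′)) (*-nonneg (nn zero) (deg-nonneg v nn′))
    lem : ∀ a d → (a + d) * (a + d) ≡ a * a + d * d + (a * d + a * d)
    lem = solve-∀

  -- Induct on the degree, and within a degree downwards on the squared norm.
  module _ {k : ℕ} (L L′ : List (Vec ℤ (suc k)))
    (nn : ∀ {α} → α ∈ L → NonNeg α) (nn′ : ∀ {α} → α ∈ L′ → NonNeg α)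
    (sy : ∀ i → map (swapAt i) L ↭ L) (sy′ : ∀ i → map (swapAt i) L′ ↭ L′)
    (pairings : ∀ g → Antisym g → ∑ (λ α → K 0 α g) L ≡ ∑ (λ α → K 0 α g) L′)
    where

    private
      open DecMembership (_≟ᵛ_ {suc k}) using (_∈?_)

      Same : Vec ℤ (suc k) → Set
      Same α = mult α L ≡ mult α L′

      -- A weight with a negative coordinate occurs in neither list. Restricting to non-negative
      -- weights is what ends both inductions: their degree is a natural number and bounds their
      -- squared length.
      same-unless : ∀ α → (NonNeg α → Same α) → Same α
      same-unless α h with α ∈? L | α ∈? L′
      ... | yes m | _ = h (nn m)
      ... | no _ | yes m = h (nn′ m)
      ... | no p | no q = trans (mult-∉ L p) (sym (mult-∉ L′ q))

      δ-swapAt : ∀ i (α β : Vec ℤ (suc k)) → δ (swapAt i α) (swapAt i β) ≡ δ α β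
      δ-swapAt i α β with β ≟ᵛ α
      ... | yes refl = δ-self (swapAt i α)
      ... | no ne = δ-other (λ eq → ne (trans (sym (swapAt-involutive i β)) (trans (cong (swapAt i) eq) (swapAt-involutive i α))))

      mult-swapAt : ∀ M i α → map (swapAt i) M ↭ M → mult (swapAt i α) M ≡ mult α M
      mult-swapAt M i α p = trans (sym (∑-↭ (δ (swapAt i α)) p))
        (trans (∑-map (δ (swapAt i α)) (swapAt i) M) (∑-cong M (λ {β} _ → δ-swapAt i α β)))

      same-sort : ∀ α → Same (sort α) → Same α
      same-sort = sort-induction Same (λ i v s →
        trans (sym (mult-swapAt L i v (sy i))) (trans s (mult-swapAt L′ i v (sy′ i))))

      degree : ∀ (α : Vec ℤ (suc k)) → NonNeg α → ∃ λ D → deg α ≡ + D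
      degree α h with deg α | deg-nonneg α h
      ... | + D | _ = D , refl

      above : ∀ c (α : Vec ℤ (suc k)) → + c < sumSq α + + suc c
      above c α = subst (_< sumSq α + + suc c) (+-identityˡ (+ c)) (+-mono-≤-< (sumSq-nonneg α) (+<+ (ℕP.n<1+n c)))

      -- The number `m` bounds how often the squared length can still grow. A non-negative weight of
      -- degree D has squared length at most D², so nothing is left to prove when `m` reaches zero.
      same-step : ∀ D → (∀ D′ → D′ ℕ.< D → ∀ α → deg α ≡ + D′ → Same α) →
                  ∀ m α → deg α ≡ + D → + (D ℕ.* D) < sumSq α + + m → Same α
      same-step D lower zero α eq lt = same-unless α λ h → ⊥-elim
        (<⇒≱ (subst (+ (D ℕ.* D) <_) (+-identityʳ (sumSq α)) lt)
          (subst (sumSq α ≤_) (trans (cong (λ z → z * z) eq) (sym (pos-* D D))) (sumSq≤deg² α h)))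
      -- The diagonal value `alternant-self` is known to be nonzero only for a decreasing weight, so
      -- the claim is first moved to `sort α`; the symmetry of both lists permits this.
      same-step D lower (suc m) α eq lt = same-sort α
        (mult-determined (λ β → K 0 β (alternant (stair 0 λ′))) L L′ λ′
          (pairings _ (alternant-antisym (stair 0 λ′))) (alternant-self λ′ (sort-desc α))
          (λ β ne β≢ → other β (alternant-other λ′ β ne β≢)))
        where
        λ′ = sort α
        other : ∀ β → deg β < deg λ′ ⊎ (deg β ≡ deg λ′ × sumSq λ′ < sumSq β) → Same β
        other β (inj₁ l) = same-unless β λ h → smaller (degree β h)
          where
          smaller : (∃ λ D′ → deg β ≡ + D′) → Same β
          smaller (D′ , e) = lower D′ (drop‿+<+ (subst₂ _<_ e (trans (deg-sort α) eq) l)) β e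
        other β (inj₂ (e , l)) = same-step D lower m β (trans e (trans (deg-sort α) eq))
          (<-≤-trans lt (subst (_≤ sumSq β + + m) (lem (sumSq α) (+ m))
            (+-monoˡ-≤ (+ m) (i<j⇒suc[i]≤j (subst (_< sumSq β) (sumSq-sort α) l)))))
          where
          lem : ∀ a m → 1ℤ + a + m ≡ a + (1ℤ + m)
          lem = solve-∀

      same-below : ∀ N D → D ℕ.< N → ∀ α → deg α ≡ + D → Same α
      same-below (suc N) D D<N α e = same-step D
        (λ D′ D′<D → same-below N D′ (ℕP.≤-trans D′<D (ℕP.≤-pred D<N)))
        (suc (D ℕ.* D)) α e (above (D ℕ.* D) α)

    alternants-separate : L ↭ L′
    alternants-separate = mult-↭ λ α → same-unless α λ h → go α (degree α h)
      where
      go : ∀ α → (∃ λ D → deg α ≡ + D) → Same α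
      go α (D , e) = same-below (suc D) D ℕP.≤-refl α e

open Alternants
open import Data.Nat using (_≤_; _<_; _∸_; _^_; _≤ᵇ_; _<ᵇ_; _≡ᵇ_)
open import Data.Integer using (_+_; _-_; -_)

-- Strings and reflections in a crystal

≢nothing⇒just : ∀ {A : Set} {m : Maybe A} → m ≢ nothing → ∃ λ a → m ≡ just a
≢nothing⇒just {m = just a} _ = a , refl
≢nothing⇒just {m = nothing} ne = ⊥-elim (ne refl)

module _ {A : Set} {g : A → Maybe A} where

  just≢nothing : ∀ {m : Maybe A} {a} → m ≡ just a → m ≢ nothing
  just≢nothing refl ()

  iter-first : ∀ j {b c} → g b ≡ just c → iter g (suc j) b ≡ iter g j c
  iter-first zero eq = eq
  iter-first (suc j) eq rewrite iter-first j eq = refl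

  iter-stuck : ∀ j {b} → g b ≡ nothing → iter g (suc j) b ≡ nothing
  iter-stuck zero eq = eq
  iter-stuck (suc j) eq rewrite iter-stuck j eq = refl

  iter-last : ∀ j {b c} → iter g (suc j) b ≡ just c → ∃ λ c′ → iter g j b ≡ just c′ × g c′ ≡ just c
  iter-last j {b} eq with iter g j b
  ... | just c′ = c′ , refl , eq

  iter-mono : ∀ j d {b} → iter g j b ≡ nothing → iter g (d ℕ.+ j) b ≡ nothing
  iter-mono j zero eq = eq
  iter-mono j (suc d) eq rewrite iter-mono j d eq = refl

  iter-prefix : ∀ {j l b} → j ℕ.≤ l → iter g l b ≢ nothing → iter g j b ≢ nothing
  iter-prefix {j} {l} {b} j≤l ne eq =
    ne (subst (λ m → iter g m b ≡ nothing) (ℕP.m∸n+n≡m j≤l) (iter-mono j (l ℕ.∸ j) eq))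

  IsLength : A → ℕ → Set
  IsLength b j = iter g j b ≢ nothing × iter g (suc j) b ≡ nothing

  length-unique : ∀ {b j j′} → IsLength b j → IsLength b j′ → j ≡ j′
  length-unique {b} {j} {j′} (p , q) (p′ , q′) with ℕP.<-cmp j j′
  ... | tri< l _ _ = ⊥-elim (iter-prefix l p′ q)
  ... | tri≈ _ eq _ = eq
  ... | tri> _ _ l = ⊥-elim (iter-prefix l p q′)

iter-inverse : ∀ {A : Set} {g h : A → Maybe A} → (∀ {b c} → g b ≡ just c → h c ≡ just b) →
               ∀ j {b c} → iter g j b ≡ just c → iter h j c ≡ just b
iter-inverse inv zero refl = refl
iter-inverse {g = g} {h} inv (suc j) {b} {c} eq with iter-last {g = g} j eq
... | c′ , eq₁ , eq₂ = trans (iter-first {g = h} j (inv eq₂)) (iter-inverse inv j eq₁)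

evenᵇ-suc : ∀ n → evenᵇ (suc n) ≡ not (evenᵇ n)
evenᵇ-suc zero = refl
evenᵇ-suc (suc zero) = refl
evenᵇ-suc (suc (suc n)) = evenᵇ-suc n

evenᵇ-double : ∀ m n → evenᵇ (m ℕ.+ m ℕ.+ n) ≡ evenᵇ n
evenᵇ-double zero n = refl
evenᵇ-double (suc m) n rewrite ℕP.+-suc m m = evenᵇ-double m n

double-≡ : ∀ a b m → + a - + b ≡ + 2 ℤ.* + m → a ≡ m ℕ.+ m ℕ.+ b
double-≡ a b m eq = ℤP.+-injective (trans (lem (+ a) (+ b)) (cong (_+ + b) (trans eq (lem₂ (+ m)))))
  where
  lem : ∀ a b → a ≡ a - b + b
  lem = solve-∀
  lem₂ : ∀ m → + 2 ℤ.* m ≡ m + m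
  lem₂ = solve-∀

double-≤ : ∀ a b m → + a - + b ≡ + 2 ℤ.* + m → m ℕ.+ m ℕ.≤ a
double-≤ a b m eq = subst (m ℕ.+ m ℕ.≤_) (sym (double-≡ a b m eq)) (ℕP.m≤m+n (m ℕ.+ m) b)

double-flip : ∀ a b d → + a - + b ≡ + 2 ℤ.* d → + b - + a ≡ + 2 ℤ.* (- d)
double-flip a b d eq = trans (lem (+ b) (+ a)) (trans (cong -_ eq) (ℤP.neg-distribʳ-* (+ 2) d))
  where
  lem : ∀ a b → a - b ≡ - (b - a)
  lem = solve-∀

-- Applied to `φ-ε`: on every element `φ` and `ε` have the same parity, so a string has an even
-- number of steps, and its elements below the top split into consecutive pairs.
double-parity : ∀ a b d → + a - + b ≡ + 2 ℤ.* d → evenᵇ a ≡ evenᵇ b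
double-parity a b (+ m) eq = trans (cong evenᵇ (double-≡ a b m eq)) (evenᵇ-double m b)
double-parity a b -[1+ m ] eq = sym (trans (cong evenᵇ (double-≡ b a (suc m) (double-flip a b -[1+ m ] eq))) (evenᵇ-double (suc m) a))

⊕-identityʳ : ∀ {n} (v : Vec ℤ n) → Vec.zipWith ℤ._+_ v (replicate _ 0ℤ) ≡ v
⊕-identityʳ [] = refl
⊕-identityʳ (x ∷ v) = cong₂ _∷_ (ℤP.+-identityʳ x) (⊕-identityʳ v)

-- The change of weight along 2d steps of `f`: of any two consecutive steps, one adds the unit at
-- `hi i` and the other removes the unit at `lo i`.
moveAt : ∀ {k} → Fin k → ℤ → Vec ℤ (suc k) → Vec ℤ (suc k)
moveAt zero d (x ∷ y ∷ v) = x - d ∷ y + d ∷ v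
moveAt (suc i) d (x ∷ v) = x ∷ moveAt i d v

gap : ∀ {k} → Fin k → Vec ℤ (suc k) → ℤ
gap i v = lookup v (lo i) - lookup v (hi i)

moveAt-0 : ∀ {k} (i : Fin k) v → moveAt i 0ℤ v ≡ v
moveAt-0 zero (x ∷ y ∷ v) = cong₂ (λ a b → a ∷ b ∷ v) (ℤP.+-identityʳ x) (ℤP.+-identityʳ y)
moveAt-0 (suc i) (x ∷ v) = cong (x ∷_) (moveAt-0 i v)

moveAt-+ : ∀ {k} (i : Fin k) a b v → moveAt i a (moveAt i b v) ≡ moveAt i (a + b) v
moveAt-+ zero a b (x ∷ y ∷ v) = cong₂ (λ p q → p ∷ q ∷ v) (lem₁ x a b) (lem₂ y a b)
  where
  lem₁ : ∀ x a b → x - b - a ≡ x - (a + b)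
  lem₁ = solve-∀
  lem₂ : ∀ x a b → x + b + a ≡ x + (a + b)
  lem₂ = solve-∀
moveAt-+ (suc i) a b (x ∷ v) = cong (x ∷_) (moveAt-+ i a b v)

moveAt-gap : ∀ {k} (i : Fin k) v → moveAt i (gap i v) v ≡ swapAt i v
moveAt-gap zero (x ∷ y ∷ v) = cong₂ (λ p q → p ∷ q ∷ v) (lem₁ x y) (lem₂ x y)
  where
  lem₁ : ∀ x y → x - (x - y) ≡ y
  lem₁ = solve-∀
  lem₂ : ∀ x y → y + (x - y) ≡ x
  lem₂ = solve-∀
moveAt-gap (suc i) (x ∷ v) = cong (x ∷_) (moveAt-gap i v)

gap-swapAt : ∀ {k} (i : Fin k) v → gap i (swapAt i v) ≡ - gap i v
gap-swapAt zero (x ∷ y ∷ v) = lem x y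
  where
  lem : ∀ x y → y - x ≡ - (x - y)
  lem = solve-∀
gap-swapAt (suc i) (x ∷ v) = gap-swapAt i v

decAt-unit : ∀ {k} (i : Fin k) v → decAt i (v ⊕ unit (lo i)) ≡ v
decAt-unit zero (x ∷ v) = cong₂ _∷_ (lem x) (⊕-identityʳ v)
  where
  lem : ∀ x → x + 1ℤ - 1ℤ ≡ x
  lem = solve-∀
decAt-unit (suc i) (x ∷ v) = cong₂ _∷_ (ℤP.+-identityʳ x) (decAt-unit i v)

moveAt-units : ∀ {k} (i : Fin k) v → moveAt i 1ℤ ((v ⊕ unit (lo i)) ⊕ Vec.map ℤ.-_ (unit (hi i))) ≡ v
moveAt-units zero (x ∷ y ∷ v) = cong₂ _∷_ (lem₁ x) (cong₂ _∷_ (lem₂ y) (zeros v))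
  where
  lem₁ : ∀ x → x + 1ℤ + 0ℤ - 1ℤ ≡ x
  lem₁ = solve-∀
  lem₂ : ∀ x → x + 0ℤ + (- 1ℤ) + 1ℤ ≡ x
  lem₂ = solve-∀
  zeros : ∀ {n} (v : Vec ℤ n) → Vec.zipWith ℤ._+_ (Vec.zipWith ℤ._+_ v (replicate _ 0ℤ)) (Vec.map ℤ.-_ (replicate _ 0ℤ)) ≡ v
  zeros [] = refl
  zeros (x ∷ v) = cong₂ _∷_ (trans (ℤP.+-identityʳ _) (ℤP.+-identityʳ x)) (zeros v)
moveAt-units (suc i) (x ∷ v) = cong₂ _∷_ (lem x) (moveAt-units i v)
  where
  lem : ∀ x → x + 0ℤ + 0ℤ ≡ x
  lem = solve-∀

⊕-swap : ∀ {n} (u v w : Vec ℤ n) → Vec.zipWith ℤ._+_ (Vec.zipWith ℤ._+_ u v) w ≡ Vec.zipWith ℤ._+_ (Vec.zipWith ℤ._+_ u w) v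
⊕-swap [] [] [] = refl
⊕-swap (x ∷ u) (y ∷ v) (z ∷ w) = cong₂ _∷_ (lem x y z) (⊕-swap u v w)
  where
  lem : ∀ x y z → x + y + z ≡ x + z + y
  lem = solve-∀

module _ {k : ℕ} {B : RawCrystal k} (isC : IsCrystal B) where
  open IsCrystal isC

  ε φ : Fin k → Carrier B → ℕ
  ε i b = proj₁ (axiom-a i b)
  φ i b = proj₁ (proj₂ (axiom-a i b))

  isEps : ∀ i b → IsEps B i b (ε i b)
  isEps i b = proj₁ (proj₂ (proj₂ (axiom-a i b)))

  isPhi : ∀ i b → IsPhi B i b (φ i b)
  isPhi i b = proj₁ (proj₂ (proj₂ (proj₂ (axiom-a i b))))

  φ-ε : ∀ i b → + φ i b - + ε i b ≡ + 2 ℤ.* gap i (wt B b)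
  φ-ε i b = proj₂ (proj₂ (proj₂ (proj₂ (axiom-a i b))))

  module _ {i : Fin k} where

    ef : ∀ {b c} → e B i b ≡ just c → f B i c ≡ just b
    ef = axiom-b-to i _ _

    fe : ∀ {b c} → f B i c ≡ just b → e B i b ≡ just c
    fe = axiom-b-from i _ _

    ε-f : ∀ {b c} → f B i b ≡ just c → ε i c ≡ suc (ε i b)
    ε-f {b} {c} eq = length-unique {g = e B i} (isEps i c)
      ( (λ z → proj₁ (isEps i b) (trans (sym (iter-first (ε i b) (fe eq))) z))
      , trans (iter-first (suc (ε i b)) (fe eq)) (proj₂ (isEps i b)))

    e-nothing : ∀ {b} → e B i b ≡ nothing → ε i b ≡ 0
    e-nothing {b} eq = length-unique {g = e B i} (isEps i b) ((λ ()) , eq)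

    f-nothing : ∀ {b} → f B i b ≡ nothing → φ i b ≡ 0
    f-nothing {b} eq = length-unique {g = f B i} (isPhi i b) ((λ ()) , eq)

    wt-f : ∀ {b c} → f B i b ≡ just c → wt B b ≡ wt B c ⊕ shift B i (suc (ε i b))
    wt-f {b} {c} eq = subst (λ j → wt B b ≡ wt B c ⊕ shift B i j) (ε-f eq) (axiom-b-wt i c b (ε i c) (fe eq) (isEps i c))

    -- From odd `ε` the step down removes a unit at `lo i`; this is the pair β, β - e_i to which
    -- `K-pair-antisym` applies.
    wt-f-odd : ∀ {b c} → f B i b ≡ just c → evenᵇ (ε i b) ≡ false → wt B c ≡ decAt i (wt B b)
    wt-f-odd {b} {c} eq odd = sym (trans (cong (decAt i) (trans (wt-f eq) (cong (λ z → wt B c ⊕ (if z then _ else _)) (trans (evenᵇ-suc (ε i b)) (cong not odd))))) (decAt-unit i (wt B c)))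

    wt-ff : ∀ {b c d} → f B i b ≡ just c → f B i c ≡ just d → wt B d ≡ moveAt i 1ℤ (wt B b)
    wt-ff {b} {c} {d} eq eq′ = sym (trans (cong (moveAt i 1ℤ) (trans (wt-f eq) (cong (_⊕ shift B i (suc (ε i b))) (wt-f eq′)))) step)
      where
      step : moveAt i 1ℤ ((wt B d ⊕ shift B i (suc (ε i c))) ⊕ shift B i (suc (ε i b))) ≡ wt B d
      step rewrite ε-f eq | evenᵇ-suc (ε i b) with evenᵇ (ε i b)
      ... | true = moveAt-units i (wt B d)
      ... | false = trans (cong (moveAt i 1ℤ) (⊕-swap (wt B d) _ _)) (moveAt-units i (wt B d))

    wt-iter : ∀ m {b c} → iter (f B i) (m ℕ.+ m) b ≡ just c → wt B c ≡ moveAt i (+ m) (wt B b)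
    wt-iter zero {b} refl = sym (moveAt-0 i (wt B b))
    wt-iter (suc m) {b} eq rewrite ℕP.+-suc m m with iter-last {g = f B i} (suc (m ℕ.+ m)) eq
    ... | c₁ , eq₁ , p₁ with iter-last {g = f B i} (m ℕ.+ m) eq₁
    ... | c₂ , eq₂ , p₂ = trans (wt-ff p₂ p₁) (trans (cong (moveAt i 1ℤ) (wt-iter m eq₂)) (moveAt-+ i 1ℤ (+ m) (wt B b)))

    ε-iter : ∀ m {b c} → iter (f B i) m b ≡ just c → ε i c ≡ m ℕ.+ ε i b
    ε-iter zero refl = refl
    ε-iter (suc m) eq with iter-last {g = f B i} m eq
    ... | c′ , eq′ , p = trans (ε-f p) (cong suc (ε-iter m eq′))

  -- The i-string is traversed by the signed distance 2d.
  path : Fin k → ℤ → Carrier B → Maybe (Carrier B)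
  path i (+ m) b = iter (f B i) (m ℕ.+ m) b
  path i -[1+ m ] b = iter (e B i) (suc m ℕ.+ suc m) b

  path-inverse : ∀ i d {b c} → path i d b ≡ just c → path i (- d) c ≡ just b
  path-inverse i (+ zero) refl = refl
  path-inverse i (+ suc m) eq = iter-inverse fe (suc m ℕ.+ suc m) eq
  path-inverse i -[1+ m ] eq = iter-inverse ef (suc m ℕ.+ suc m) eq

  path-wt : ∀ i d {b c} → path i d b ≡ just c → wt B c ≡ moveAt i d (wt B b)
  path-wt i (+ m) eq = wt-iter m eq
  path-wt i -[1+ m ] {b} {c} eq = sym (trans (cong (moveAt i -[1+ m ]) (wt-iter (suc m) (iter-inverse ef (suc m ℕ.+ suc m) eq)))
    (trans (moveAt-+ i -[1+ m ] (+ suc m) (wt B c)) (trans (cong (λ z → moveAt i z (wt B c)) (ℤP.+-inverseˡ (+ suc m))) (moveAt-0 i (wt B c)))))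

  path-parity : ∀ i d {b c} → path i d b ≡ just c → evenᵇ (ε i c) ≡ evenᵇ (ε i b)
  path-parity i (+ m) {b} eq = trans (cong evenᵇ (ε-iter (m ℕ.+ m) eq)) (evenᵇ-double m (ε i b))
  path-parity i -[1+ m ] {b} {c} eq = sym (trans (cong evenᵇ (ε-iter (suc m ℕ.+ suc m) (iter-inverse ef (suc m ℕ.+ suc m) eq))) (evenᵇ-double (suc m) (ε i c)))

  -- Twice the gap is φ - ε, so at least that many steps are available downwards when the gap is
  -- non-negative, and upwards when it is negative.
  path-just : ∀ i b d → gap i (wt B b) ≡ d → ∃ λ c → path i d b ≡ just c
  path-just i b (+ m) eq = ≢nothing⇒just (iter-prefix
    (double-≤ (φ i b) (ε i b) m (trans (φ-ε i b) (cong (+ 2 ℤ.*_) eq))) (proj₁ (isPhi i b)))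
  path-just i b -[1+ m ] eq = ≢nothing⇒just (iter-prefix
    (double-≤ (ε i b) (φ i b) (suc m) (double-flip (φ i b) (ε i b) -[1+ m ] (trans (φ-ε i b) (cong (+ 2 ℤ.*_) eq))))
    (proj₁ (isEps i b)))

  -- Reversal of the i-string, the action of a simple reflection on a crystal. The default `b` is
  -- never taken, by `reflect-path`.
  reflect : Fin k → Carrier B → Carrier B
  reflect i b = fromMaybe b (path i (gap i (wt B b)) b)

  reflect-path : ∀ i b → path i (gap i (wt B b)) b ≡ just (reflect i b)
  reflect-path i b with path i (gap i (wt B b)) b | path-just i b (gap i (wt B b)) refl
  ... | just c | _ = refl
  ... | nothing | _ , ()

  reflect-wt : ∀ i b → wt B (reflect i b) ≡ swapAt i (wt B b)
  reflect-wt i b = trans (path-wt i (gap i (wt B b)) (reflect-path i b)) (moveAt-gap i (wt B b))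

  reflect-involutive : ∀ i b → reflect i (reflect i b) ≡ b
  reflect-involutive i b = just-injective (trans (sym (reflect-path i (reflect i b)))
    (trans (cong (λ d → path i d (reflect i b)) (trans (cong (gap i) (reflect-wt i b)) (gap-swapAt i (wt B b))))
      (path-inverse i (gap i (wt B b)) (reflect-path i b))))

  -- Stated for a closed finite list inside a possibly infinite crystal: it serves both for a whole
  -- finite crystal and for the tableaux of one shape among all words.
  module _ {xs : List (Carrier B)} (unique : Unique xs)
    (e-closed : ∀ i {b c} → b ∈ xs → e B i b ≡ just c → c ∈ xs)
    (f-closed : ∀ i {b c} → b ∈ xs → f B i b ≡ just c → c ∈ xs) where

    iter-closed : ∀ {g} → (∀ {b c} → b ∈ xs → g b ≡ just c → c ∈ xs) →
                  ∀ m {b c} → b ∈ xs → iter g m b ≡ just c → c ∈ xs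
    iter-closed cl zero b∈ refl = b∈
    iter-closed {g} cl (suc m) b∈ eq with iter-last {g = g} m eq
    ... | c′ , eq′ , p = cl (iter-closed cl m b∈ eq′) p

    path-closed : ∀ i d {b c} → b ∈ xs → path i d b ≡ just c → c ∈ xs
    path-closed i (+ m) = iter-closed (f-closed i) (m ℕ.+ m)
    path-closed i -[1+ m ] = iter-closed (e-closed i) (suc m ℕ.+ suc m)

    reflect-closed : ∀ i {b} → b ∈ xs → reflect i b ∈ xs
    reflect-closed i {b} b∈ = path-closed i (gap i (wt B b)) b∈ (reflect-path i b)

    character-symmetric : ∀ i → map (swapAt i) (map (wt B) xs) ↭ map (wt B) xs
    character-symmetric i = ↭-trans (↭-reflexive eq) (map⁺ (wt B) reflected)
      where
      reflected : map (reflect i) xs ↭ xs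
      reflected = bijection-↭ (reflect i) (reflect i) unique unique
        (λ m → reflect-closed i m , reflect-involutive i _) (λ m → reflect-closed i m , reflect-involutive i _)
      eq : map (swapAt i) (map (wt B) xs) ≡ map (wt B) (map (reflect i) xs)
      eq = trans (sym (ListP.map-∘ xs)) (trans (ListP.map-cong (λ b → sym (reflect-wt i b)) xs) (ListP.map-∘ xs))

    -- A choice of string through every element that is not highest weight,
    -- constant along each chosen string once its top element is removed.
    module _ (sel : Carrier B → Maybe (Fin k))
      (sel-nothing : ∀ {b} → sel b ≡ nothing → IsHW B b)
      (sel-just : ∀ {b i} → sel b ≡ just i → e B i b ≢ nothing)
      (sel-f : ∀ {b i c} → sel b ≡ just i → f B i b ≡ just c → sel c ≡ just i)
      (sel-e : ∀ {b i c} → sel b ≡ just i → e B i b ≡ just c → e B i c ≢ nothing → sel c ≡ just i)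
      where

      -- The upper members of the pairs: in the chosen string `ε` takes the values 1, 2, 3, ...
      -- below the top, and the pairs are 1 and 2, 3 and 4, and so on.
      Odd : Carrier B → Set
      Odd b = ∃ λ i → sel b ≡ just i × evenᵇ (ε i b) ≡ false

      Odd? : ∀ b → Dec (Odd b)
      Odd? b with sel b
      ... | nothing = no λ { (_ , () , _) }
      ... | just i with evenᵇ (ε i b) in eq
      ... | false = yes (i , refl , eq)
      ... | true = no λ { (_ , refl , eq′) → case-⊥ (trans (sym eq) eq′) }
        where
        case-⊥ : true ≡ false → ⊥
        case-⊥ ()

      sel-iter-f : ∀ m {b i c} → sel b ≡ just i → iter (f B i) m b ≡ just c → sel c ≡ just i
      sel-iter-f zero s refl = s
      sel-iter-f (suc m) {i = i} s eq with iter-last {g = f B i} m eq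
      ... | c′ , eq′ , p = sel-f (sel-iter-f m s eq′) p

      sel-iter-e : ∀ m {b i c} → sel b ≡ just i → iter (e B i) m b ≡ just c → e B i c ≢ nothing → sel c ≡ just i
      sel-iter-e zero s refl ne = s
      sel-iter-e (suc m) {i = i} s eq ne with iter-last {g = e B i} m eq
      ... | c′ , eq′ , p = sel-e (sel-iter-e m s eq′ (λ z → just≢nothing {g = e B i} p z)) p ne

      odd⇒e : ∀ {i b} → evenᵇ (ε i b) ≡ false → e B i b ≢ nothing
      odd⇒e odd z with trans (sym odd) (cong evenᵇ (e-nothing z))
      ... | ()

      -- An upward path may leave the truncated string only by arriving at the top, where `ε` is
      -- zero. Odd `ε` at its end rules this out.
      sel-path : ∀ i d {b c} → sel b ≡ just i → path i d b ≡ just c → evenᵇ (ε i c) ≡ false → sel c ≡ just i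
      sel-path i (+ m) s eq odd = sel-iter-f (m ℕ.+ m) s eq
      sel-path i -[1+ m ] s eq odd = sel-iter-e (suc m ℕ.+ suc m) s eq (odd⇒e odd)

      along : (Fin k → Carrier B → Carrier B) → Carrier B → Carrier B
      along h b with sel b
      ... | just i = h i b
      ... | nothing = b

      along-just : ∀ h {b i} → sel b ≡ just i → along h b ≡ h i b
      along-just h {b} eq with sel b
      along-just h refl | just i = refl

      ys Os Es : List (Carrier B)
      ys = filter (λ b → ¬? (IsHW? B b)) xs
      Os = filter Odd? ys
      Es = filter (λ b → ¬? (Odd? b)) ys

      ¬hw : ∀ {b i} → sel b ≡ just i → ¬ IsHW B b
      ¬hw s hw = sel-just s (hw _)

      ∈Os⁺ : ∀ {b i} → b ∈ xs → sel b ≡ just i → evenᵇ (ε i b) ≡ false → b ∈ Os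
      ∈Os⁺ b∈ s odd = ∈-filter⁺ Odd? (∈-filter⁺ (λ b → ¬? (IsHW? B b)) b∈ (¬hw s)) (_ , s , odd)

      ∈Os⁻ : ∀ {b} → b ∈ Os → b ∈ xs × Odd b
      ∈Os⁻ m with ∈-filter⁻ Odd? {xs = ys} m
      ... | m′ , o = proj₁ (∈-filter⁻ (λ b → ¬? (IsHW? B b)) {xs = xs} m′) , o

      ∈Es⁺ : ∀ {b i} → b ∈ xs → sel b ≡ just i → evenᵇ (ε i b) ≡ true → b ∈ Es
      ∈Es⁺ {b} b∈ s even = ∈-filter⁺ (λ b → ¬? (Odd? b)) (∈-filter⁺ (λ b → ¬? (IsHW? B b)) b∈ (¬hw s)) not-odd
        where
        not-odd : ¬ Odd b
        not-odd (j , s′ , o) with trans (sym s) s′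
        ... | refl with trans (sym even) o
        ... | ()

      ∈Es⁻ : ∀ {b} → b ∈ Es → b ∈ xs × ∃ λ i → sel b ≡ just i × evenᵇ (ε i b) ≡ true
      ∈Es⁻ {b} m with ∈-filter⁻ (λ b → ¬? (Odd? b)) {xs = ys} m
      ... | m′ , ¬o with ∈-filter⁻ (λ b → ¬? (IsHW? B b)) {xs = xs} m′
      ... | m″ , ¬h with sel b in s
      ... | nothing = ⊥-elim (¬h (sel-nothing s))
      ... | just i with evenᵇ (ε i b) in ev
      ... | true = m″ , i , refl , ev
      ... | false = ⊥-elim (¬o (i , refl , ev))

      down up : Fin k → Carrier B → Carrier B
      down i b = fromMaybe b (f B i b)
      up i b = fromMaybe b (e B i b)

      -- At the bottom of a string `φ` is zero, and `ε` has the parity of `φ`.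
      odd⇒f : ∀ {i b} → evenᵇ (ε i b) ≡ false → ∃ λ c → f B i b ≡ just c
      odd⇒f {i} {b} odd with f B i b in eq
      ... | just c = c , refl
      ... | nothing = ⊥-elim (contra (trans (sym odd) even))
        where
        contra : false ≡ true → ⊥
        contra ()
        even : evenᵇ (ε i b) ≡ true
        even = trans (sym (double-parity (φ i b) (ε i b) (gap i (wt B b)) (φ-ε i b))) (cong evenᵇ (f-nothing eq))

      -- One step of `f` matches the two halves of the pairs: an odd element is never the bottom of
      -- its string, and an even element that has been assigned a string is not its top.
      Es↭ : map (along down) Os ↭ Es
      Es↭ = bijection-↭ (along down) (along up) (UniqueP.filter⁺ Odd? (UniqueP.filter⁺ (λ b → ¬? (IsHW? B b)) unique))
        (UniqueP.filter⁺ (λ b → ¬? (Odd? b)) (UniqueP.filter⁺ (λ b → ¬? (IsHW? B b)) unique)) to from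
        where
        to : ∀ {b} → b ∈ Os → along down b ∈ Es × along up (along down b) ≡ b
        to {b} m with ∈Os⁻ m
        ... | b∈ , i , s , odd with odd⇒f odd
        ... | c , fb = subst (_∈ Es) (sym down≡) (∈Es⁺ (f-closed i b∈ fb) s′ even)
                     , trans (cong (along up) down≡) (trans (along-just up s′) (cong (fromMaybe c) (fe fb)))
          where
          s′ = sel-f s fb
          down≡ : along down b ≡ c
          down≡ = trans (along-just down s) (cong (fromMaybe b) fb)
          even : evenᵇ (ε i c) ≡ true
          even = trans (cong evenᵇ (ε-f fb)) (trans (evenᵇ-suc (ε i b)) (cong not odd))
        from : ∀ {c} → c ∈ Es → along up c ∈ Os × along down (along up c) ≡ c
        from {c} m with ∈Es⁻ m
        ... | c∈ , i , s , even with ≢nothing⇒just (sel-just s)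
        ... | b , ec = subst (_∈ Os) (sym up≡) (∈Os⁺ (e-closed i c∈ ec) s′ odd)
                     , trans (cong (along down) up≡) (trans (along-just down s′) (cong (fromMaybe b) (ef ec)))
          where
          odd : evenᵇ (ε i b) ≡ false
          odd with trans (sym (evenᵇ-suc (ε i b))) (trans (cong evenᵇ (sym (ε-f (ef ec)))) even)
          ... | p with evenᵇ (ε i b)
          ... | false = refl
          s′ = sel-e s ec (odd⇒e odd)
          up≡ : along up c ≡ b
          up≡ = trans (along-just up s) (cong (fromMaybe c) ec)

      -- The reflection moves by an even number of steps. It thus preserves the parity of `ε`, and
      -- it cannot land on the top, so the chosen direction persists.
      Os↭ : map (along reflect) Os ↭ Os
      Os↭ = bijection-↭ (along reflect) (along reflect) uOs uOs to to
        where
        uOs = UniqueP.filter⁺ Odd? (UniqueP.filter⁺ (λ b → ¬? (IsHW? B b)) unique)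
        to : ∀ {b} → b ∈ Os → along reflect b ∈ Os × along reflect (along reflect b) ≡ b
        to {b} m with ∈Os⁻ m
        ... | b∈ , i , s , odd = subst (_∈ Os) (sym r≡) (∈Os⁺ (reflect-closed i b∈) s′ odd′)
                               , trans (cong (along reflect) r≡) (trans (along-just reflect s′) (reflect-involutive i b))
          where
          r≡ : along reflect b ≡ reflect i b
          r≡ = along-just reflect s
          odd′ : evenᵇ (ε i (reflect i b)) ≡ false
          odd′ = trans (path-parity i (gap i (wt B b)) (reflect-path i b)) odd
          s′ = sel-path i (gap i (wt B b)) s (reflect-path i b) odd′

      module _ {g : Vec ℤ (suc k) → ℤ} (anti : Antisym g) where

        κ : Carrier B → ℤ
        κ b = K 0 (wt B b) g

        -- Instead of cancelling string by string, the reflections of all chosen strings are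
        -- combined into one involution of `Os`. It negates the sum `h` over a pair, so the total
        -- equals its own negative.
        non-highest-cancel : ∑ κ ys ≡ 0ℤ
        non-highest-cancel = begin
          ∑ κ ys                                    ≡⟨ ∑-filter Odd? (λ b → ¬? (Odd? b)) κ ys ⟩
          ∑ κ Os + ∑ κ Es                           ≡⟨ cong (_+_ (∑ κ Os)) (trans (sym (∑-↭ κ Es↭)) (∑-map κ (along down) Os)) ⟩
          ∑ κ Os + ∑ (λ b → κ (along down b)) Os    ≡⟨ sym (∑-+ κ (λ b → κ (along down b)) Os) ⟩
          ∑ h Os                                    ≡⟨ self-negative⇒0 (∑ h Os) negated ⟩
          0ℤ ∎
          where
          open ≡-Reasoning
          h : Carrier B → ℤ
          h b = κ b + κ (along down b)
          h≡ : ∀ {b i} → sel b ≡ just i → evenᵇ (ε i b) ≡ false → h b ≡ K 0 (wt B b) g + K 0 (decAt i (wt B b)) g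
          h≡ {b} {i} s odd with odd⇒f odd
          ... | c , fb = cong (λ w → κ b + K 0 w g)
            (trans (cong (wt B) (trans (along-just down s) (cong (fromMaybe b) fb))) (wt-f-odd fb odd))
          h-reflect : ∀ {b} → b ∈ Os → h (along reflect b) ≡ - h b
          h-reflect {b} m with ∈Os⁻ m
          ... | b∈ , i , s , odd = begin
            h (along reflect b)   ≡⟨ cong h (along-just reflect s) ⟩
            h (reflect i b)       ≡⟨ h≡ (sel-path i (gap i (wt B b)) s (reflect-path i b) odd′) odd′ ⟩
            K 0 (wt B (reflect i b)) g + K 0 (decAt i (wt B (reflect i b))) g
              ≡⟨ cong (λ w → K 0 w g + K 0 (decAt i w) g) (reflect-wt i b) ⟩
            K 0 (swapAt i (wt B b)) g + K 0 (decAt i (swapAt i (wt B b))) g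
              ≡⟨ K-pair-antisym 0 {g} anti i (wt B b) ⟩
            - (K 0 (wt B b) g + K 0 (decAt i (wt B b)) g)
              ≡⟨ cong -_ (sym (h≡ s odd)) ⟩
            - h b ∎
            where
            odd′ : evenᵇ (ε i (reflect i b)) ≡ false
            odd′ = trans (path-parity i (gap i (wt B b)) (reflect-path i b)) odd
          negated : ∑ h Os ≡ - ∑ h Os
          negated = begin
            ∑ h Os                                ≡⟨ sym (∑-↭ h Os↭) ⟩
            ∑ h (map (along reflect) Os)          ≡⟨ ∑-map h (along reflect) Os ⟩
            ∑ (λ b → h (along reflect b)) Os      ≡⟨ ∑-cong Os h-reflect ⟩
            ∑ (λ b → - h b) Os                    ≡⟨ ∑-neg h Os ⟩
            - ∑ h Os ∎

        highest-weight-sum : ∑ κ xs ≡ ∑ κ (filter (IsHW? B) xs)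
        highest-weight-sum = trans (∑-filter (IsHW? B) (λ b → ¬? (IsHW? B b)) κ xs)
          (trans (cong (_+_ (∑ κ (filter (IsHW? B) xs))) non-highest-cancel) (ℤP.+-identityʳ _))

-- Tensor products of subsets

Pair : Set
Pair = Bool × Bool

getAt : ∀ {k} → Fin k → Subset (suc k) → Pair
getAt zero (a ∷ b ∷ S) = a , b
getAt (suc i) (_ ∷ S) = getAt i S

setAt : ∀ {k} → Fin k → Pair → Subset (suc k) → Subset (suc k)
setAt zero (a , b) (_ ∷ _ ∷ S) = a ∷ b ∷ S
setAt (suc i) p (a ∷ S) = a ∷ setAt i p S

getAt-setAt : ∀ {k} (i : Fin k) p S → getAt i (setAt i p S) ≡ p
getAt-setAt zero p (_ ∷ _ ∷ S) = refl
getAt-setAt (suc i) p (_ ∷ S) = getAt-setAt i p S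

setAt-setAt : ∀ {k} (i : Fin k) p q S → setAt i p (setAt i q S) ≡ setAt i p S
setAt-setAt zero p q (_ ∷ _ ∷ S) = refl
setAt-setAt (suc i) p q (a ∷ S) = cong (a ∷_) (setAt-setAt i p q S)

setAt-getAt : ∀ {k} (i : Fin k) S → setAt i (getAt i S) S ≡ S
setAt-getAt zero (_ ∷ _ ∷ S) = refl
setAt-getAt (suc i) (a ∷ S) = cong (a ∷_) (setAt-getAt i S)

getAt-lookup : ∀ {k} (i : Fin k) S → getAt i S ≡ (lookup S (lo i) , lookup S (hi i))
getAt-lookup zero (_ ∷ _ ∷ S) = refl
getAt-lookup (suc i) (_ ∷ S) = getAt-lookup i S

lookup-setAt : ∀ {k} (i : Fin k) p S j → j ≢ lo i → j ≢ hi i → lookup (setAt i p S) j ≡ lookup S j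
lookup-setAt zero p (_ ∷ _ ∷ S) zero l h = ⊥-elim (l refl)
lookup-setAt zero p (_ ∷ _ ∷ S) (suc zero) l h = ⊥-elim (h refl)
lookup-setAt zero p (_ ∷ _ ∷ S) (suc (suc j)) l h = refl
lookup-setAt (suc i) p (_ ∷ S) zero l h = refl
lookup-setAt (suc i) p (_ ∷ S) (suc j) l h = lookup-setAt i p S j (λ { refl → l refl }) (λ { refl → h refl })

e₂ f₂ : Pair → Maybe Pair
e₂ (false , true) = just (true , true)
e₂ (true , true) = just (true , false)
e₂ _ = nothing
f₂ (true , false) = just (true , true)
f₂ (true , true) = just (false , true)
f₂ _ = nothing

ε₂ φ₂ : Pair → ℕ
ε₂ (false , true) = 2
ε₂ (true , true) = 1
ε₂ _ = 0
φ₂ (true , false) = 2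
φ₂ (true , true) = 1
φ₂ _ = 0

f₂-just : ∀ p {q} → f₂ p ≡ just q → e₂ q ≡ just p × φ₂ p ≡ suc (φ₂ q) × ε₂ q ≡ suc (ε₂ p)
f₂-just (true , false) refl = refl , refl , refl
f₂-just (true , true) refl = refl , refl , refl

e₂-just : ∀ p {q} → e₂ p ≡ just q → f₂ q ≡ just p
e₂-just (false , true) refl = refl
e₂-just (true , true) refl = refl

f₂-nothing : ∀ p → f₂ p ≡ nothing → φ₂ p ≡ 0
f₂-nothing (false , false) _ = refl
f₂-nothing (false , true) _ = refl

e₂-nothing : ∀ p → e₂ p ≡ nothing → ε₂ p ≡ 0
e₂-nothing (false , false) _ = refl
e₂-nothing (true , false) _ = refl

map-just : ∀ {A B : Set} {f : A → B} (m : Maybe A) {y} → mapMaybe f m ≡ just y → ∃ λ x → m ≡ just x × y ≡ f x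
map-just (just x) refl = x , refl , refl

map-nothing : ∀ {A B : Set} {f : A → B} (m : Maybe A) → mapMaybe f m ≡ nothing → m ≡ nothing
map-nothing nothing _ = refl

module _ {k : ℕ} (i : Fin k) where

  eL fL : Subset (suc k) → Maybe (Subset (suc k))
  eL S = mapMaybe (λ p → setAt i p S) (e₂ (getAt i S))
  fL S = mapMaybe (λ p → setAt i p S) (f₂ (getAt i S))

  εL φL : Subset (suc k) → ℕ
  εL S = ε₂ (getAt i S)
  φL S = φ₂ (getAt i S)

  undo : ∀ {g : Pair → Maybe Pair} S q → g q ≡ just (getAt i S) → mapMaybe (λ p → setAt i p (setAt i q S)) (g (getAt i (setAt i q S))) ≡ just S
  undo S q eq rewrite getAt-setAt i q S | eq | setAt-setAt i (getAt i S) q S = cong just (setAt-getAt i S)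

  fL-just : ∀ S {S′} → fL S ≡ just S′ → eL S′ ≡ just S × φL S ≡ suc (φL S′) × εL S′ ≡ suc (εL S)
  fL-just S eq with map-just (f₂ (getAt i S)) eq
  ... | q , eq′ , refl with f₂-just (getAt i S) eq′
  ... | p₁ , p₂ , p₃ = undo {e₂} S q p₁
                     , trans p₂ (cong (λ z → suc (φ₂ z)) (sym (getAt-setAt i q S)))
                     , trans (cong ε₂ (getAt-setAt i q S)) p₃

  eL-just : ∀ S {S′} → eL S ≡ just S′ → fL S′ ≡ just S
  eL-just S eq with map-just (e₂ (getAt i S)) eq
  ... | q , eq′ , refl = undo {f₂} S q (e₂-just (getAt i S) eq′)

  fL-nothing : ∀ S → fL S ≡ nothing → φL S ≡ 0
  fL-nothing S eq = f₂-nothing (getAt i S) (map-nothing _ eq)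

  eL-nothing : ∀ S → eL S ≡ nothing → εL S ≡ 0
  eL-nothing S eq = e₂-nothing (getAt i S) (map-nothing _ eq)

<⇒<ᵇ≡true : ∀ {m n} → m < n → (m <ᵇ n) ≡ true
<⇒<ᵇ≡true {m} {n} l with m <ᵇ n | ℕP.<⇒<ᵇ l
... | true | _ = refl

≤⇒≤ᵇ≡true : ∀ {m n} → m ≤ n → (m ≤ᵇ n) ≡ true
≤⇒≤ᵇ≡true {m} {n} l with m ≤ᵇ n | ℕP.≤⇒≤ᵇ l
... | true | _ = refl

≤⇒<ᵇ≡false : ∀ {m n} → n ≤ m → (m <ᵇ n) ≡ false
≤⇒<ᵇ≡false {m} {n} l with m <ᵇ n in eq
... | false = refl
... | true = ⊥-elim (ℕP.<⇒≱ (ℕP.<ᵇ⇒< m n (subst T (sym eq) tt)) l)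

<⇒≤ᵇ≡false : ∀ {m n} → n < m → (m ≤ᵇ n) ≡ false
<⇒≤ᵇ≡false {m} {n} l with m ≤ᵇ n in eq
... | false = refl
... | true = ⊥-elim (ℕP.<⇒≱ l (ℕP.≤ᵇ⇒≤ m n (subst T (sym eq) tt)))

<ᵇ≡true⇒< : ∀ {m n} → (m <ᵇ n) ≡ true → m < n
<ᵇ≡true⇒< {m} {n} eq = ℕP.<ᵇ⇒< m n (subst T (sym eq) tt)

<ᵇ≡false⇒≤ : ∀ {m n} → (m <ᵇ n) ≡ false → n ≤ m
<ᵇ≡false⇒≤ {m} {n} eq with n ℕP.≤? m
... | yes l = l
... | no ¬l = ⊥-elim (contra (trans (sym (<⇒<ᵇ≡true (ℕP.≰⇒> ¬l))) eq))
  where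
  contra : true ≡ false → ⊥
  contra ()

module _ {k : ℕ} {L : Set} where

  -- The label in `L` is inert. For a tableau it records the box of each letter, which makes reading
  -- injective and letters traceable; for tensor powers it is `⊤`.
  Word : Set
  Word = List (L × Subset (suc k))

  module _ (i : Fin k) where

    -- The tensor product formulas φ(b ⊗ c) = φ(b) + max(φ(c) - ε(b), 0) and ε(b ⊗ c) = ε(c) +
    -- max(ε(b) - φ(c), 0), taken as definitions. That they are string lengths is part of
    -- `words-crystal`.
    φW εW : Word → ℕ
    φW [] = 0
    φW ((l , S) ∷ w) = φL i S ℕ.+ (φW w ∸ εL i S)
    εW [] = 0
    εW ((l , S) ∷ w) = εW w ℕ.+ (εL i S ∸ φW w)

    eW fW : Word → Maybe Word
    eW [] = nothing
    eW ((l , S) ∷ w) = if εL i S ≤ᵇ φW w then mapMaybe ((l , S) ∷_) (eW w)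
                                         else mapMaybe (λ S′ → (l , S′) ∷ w) (eL i S)
    fW [] = nothing
    fW ((l , S) ∷ w) = if εL i S <ᵇ φW w then mapMaybe ((l , S) ∷_) (fW w)
                                         else mapMaybe (λ S′ → (l , S′) ∷ w) (fL i S)

    eW-tail : ∀ {l S w} → εL i S ≤ φW w → eW ((l , S) ∷ w) ≡ mapMaybe ((l , S) ∷_) (eW w)
    eW-tail {l} {S} {w} le rewrite ≤⇒≤ᵇ≡true le = refl

    eW-head : ∀ {l S w} → φW w < εL i S → eW ((l , S) ∷ w) ≡ mapMaybe (λ S′ → (l , S′) ∷ w) (eL i S)
    eW-head {l} {S} {w} lt rewrite <⇒≤ᵇ≡false lt = refl

    fW-tail : ∀ {l S w} → εL i S < φW w → fW ((l , S) ∷ w) ≡ mapMaybe ((l , S) ∷_) (fW w)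
    fW-tail {l} {S} {w} lt rewrite <⇒<ᵇ≡true lt = refl

    fW-head : ∀ {l S w} → φW w ≤ εL i S → fW ((l , S) ∷ w) ≡ mapMaybe (λ S′ → (l , S′) ∷ w) (fL i S)
    fW-head {l} {S} {w} le rewrite ≤⇒<ᵇ≡false le = refl

    -- The three claims go through one induction: whether `eW` returns to the factor on which `fW`
    -- acted depends on how `φ` of the tail or `ε` of the head has changed.
    fW-just : ∀ w {w′} → fW w ≡ just w′ → eW w′ ≡ just w × φW w ≡ suc (φW w′) × εW w′ ≡ suc (εW w)
    fW-just ((l , S) ∷ w) eq with εL i S ℕP.<? φW w
    ... | yes lt with map-just (fW w) (trans (sym (fW-tail {l} {S} {w} lt)) eq)
    ...   | w₁ , eq₁ , refl with fW-just w eq₁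
    ...     | p₁ , p₂ , p₃ = trans (eW-tail {l} {S} {w₁} le) (cong (mapMaybe ((l , S) ∷_)) p₁)
                           , trans (cong (λ z → φL i S ℕ.+ (z ∸ εL i S)) p₂)
                               (trans (cong (φL i S ℕ.+_) (ℕP.+-∸-assoc 1 le)) (ℕP.+-suc (φL i S) _))
                           , trans (cong₂ ℕ._+_ p₃ (ℕP.m≤n⇒m∸n≡0 le))
                               (cong (λ z → suc (εW w ℕ.+ z)) (sym (ℕP.m≤n⇒m∸n≡0 (ℕP.<⇒≤ lt))))
      where
      -- Acting on the tail lowers its `φ` by one, so the strict inequality that sends `f` to the
      -- tail becomes the weak one that sends `e` there.
      le : εL i S ≤ φW w₁
      le = ℕP.≤-pred (subst (εL i S <_) p₂ lt)
    fW-just ((l , S) ∷ w) eq | no ¬lt with map-just (fL i S) (trans (sym (fW-head {l} {S} {w} (ℕP.≮⇒≥ ¬lt))) eq)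
    ...   | S′ , eq₁ , refl with fL-just i S eq₁
    ...     | p₁ , p₂ , p₃ = trans (eW-head {l} {S′} {w} lt′) (cong (mapMaybe (λ S″ → (l , S″) ∷ w)) p₁)
                           , cong₂ ℕ._+_ p₂ (trans (ℕP.m≤n⇒m∸n≡0 le) (sym (ℕP.m≤n⇒m∸n≡0 (ℕP.<⇒≤ lt′))))
                           , trans (cong (λ z → εW w ℕ.+ (z ∸ φW w)) p₃)
                               (trans (cong (εW w ℕ.+_) (ℕP.+-∸-assoc 1 le)) (ℕP.+-suc (εW w) _))
      where
      le : φW w ≤ εL i S
      le = ℕP.≮⇒≥ ¬lt
      lt′ : φW w < εL i S′
      lt′ = subst (φW w <_) (sym p₃) (ℕ.s≤s le)

    eW-just : ∀ w {w′} → eW w ≡ just w′ → fW w′ ≡ just w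
    eW-just ((l , S) ∷ w) eq with εL i S ℕP.≤? φW w
    ... | yes le with map-just (eW w) (trans (sym (eW-tail {l} {S} {w} le)) eq)
    ...   | w₁ , eq₁ , refl = trans (fW-tail {l} {S} {w₁} lt) (cong (mapMaybe ((l , S) ∷_)) eq₂)
      where
      eq₂ = eW-just w eq₁
      lt : εL i S < φW w₁
      lt = subst (εL i S <_) (sym (proj₁ (proj₂ (fW-just w₁ eq₂)))) (ℕ.s≤s le)
    eW-just ((l , S) ∷ w) eq | no ¬le with map-just (eL i S) (trans (sym (eW-head {l} {S} {w} (ℕP.≰⇒> ¬le))) eq)
    ...   | S′ , eq₁ , refl = trans (fW-head {l} {S′} {w} le) (cong (mapMaybe (λ S″ → (l , S″) ∷ w)) eq₂)
      where
      eq₂ = eL-just i S eq₁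
      le : φW w ≤ εL i S′
      le = ℕP.≤-pred (subst (φW w <_) (proj₂ (proj₂ (fL-just i S′ eq₂))) (ℕP.≰⇒> ¬le))

    fW-nothing : ∀ w → fW w ≡ nothing → φW w ≡ 0
    fW-nothing [] eq = refl
    fW-nothing ((l , S) ∷ w) eq with εL i S ℕP.<? φW w
    ... | yes lt with subst (εL i S <_) (fW-nothing w (map-nothing _ (trans (sym (fW-tail {l} {S} {w} lt)) eq))) lt
    ...   | ()
    fW-nothing ((l , S) ∷ w) eq | no ¬lt = cong₂ ℕ._+_
      (fL-nothing i S (map-nothing _ (trans (sym (fW-head {l} {S} {w} (ℕP.≮⇒≥ ¬lt))) eq))) (ℕP.m≤n⇒m∸n≡0 (ℕP.≮⇒≥ ¬lt))

    eW-nothing : ∀ w → eW w ≡ nothing → εW w ≡ 0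
    eW-nothing [] eq = refl
    eW-nothing ((l , S) ∷ w) eq with εL i S ℕP.≤? φW w
    ... | yes le = cong₂ ℕ._+_ (eW-nothing w (map-nothing _ (trans (sym (eW-tail {l} {S} {w} le)) eq))) (ℕP.m≤n⇒m∸n≡0 le)
    ... | no ¬le with subst (φW w <_) (eL-nothing i S (map-nothing _ (trans (sym (eW-head {l} {S} {w} (ℕP.≰⇒> ¬le))) eq))) (ℕP.≰⇒> ¬le)
    ...   | ()

  wtW : Word → Wt k
  wtW [] = zeroWt
  wtW ((l , S) ∷ w) = indicator S ⊕ wtW w

Words : (k : ℕ) → Set → RawCrystal k
Words k L = record { Carrier = Word {k} {L} ; wt = wtW ; e = eW ; f = fW }

module _ {A : Set} {g : A → Maybe A} (μ : A → ℕ)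
  (stop : ∀ b → g b ≡ nothing → μ b ≡ 0) (step : ∀ b {c} → g b ≡ just c → μ b ≡ suc (μ c)) where

  -- A number that drops by one at each step and is zero where `g` stops counts the steps. The same
  -- principle identifies `ε`, `φ` and, given enough fuel, `count`.
  measure-length : ∀ b → IsLength {g = g} b (μ b)
  measure-length b = go (μ b) b refl
    where
    go : ∀ n b → μ b ≡ n → IsLength {g = g} b n
    go n b eq with g b in gb
    go zero b eq | nothing = (λ ()) , gb
    go (suc n) b eq | nothing with trans (sym eq) (stop b gb)
    ... | ()
    go zero b eq | just c with trans (sym eq) (step b gb)
    ... | ()
    go (suc n) b eq | just c with go n c (ℕP.suc-injective (trans (sym (step b gb)) eq))
    ... | p , q = (λ z → p (trans (sym (iter-first n gb)) z)) , trans (iter-first (suc n) gb) q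

  count-measure : ∀ F b → μ b ≤ F → count g F b ≡ μ b
  count-measure zero b le = sym (ℕP.n≤0⇒n≡0 le)
  count-measure (suc F) b le with g b in gb
  ... | nothing = sym (stop b gb)
  ... | just c = trans (cong suc (count-measure F c (ℕP.≤-pred (subst (_≤ suc F) (step b gb) le)))) (sym (step b gb))

gap-⊕ : ∀ {k} (i : Fin k) (u v : Wt k) → gap i (u ⊕ v) ≡ gap i u + gap i v
gap-⊕ zero (a ∷ b ∷ u) (c ∷ d ∷ v) = lem a b c d
  where
  lem : ∀ a b c d → a + c - (b + d) ≡ a - b + (c - d)
  lem = solve-∀
gap-⊕ (suc i) (_ ∷ u) (_ ∷ v) = gap-⊕ i u v

gap-zero : ∀ {k} (i : Fin k) → gap i zeroWt ≡ 0ℤ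
gap-zero zero = refl
gap-zero (suc i) = gap-zero i

gap-indicator : ∀ {k} (i : Fin k) S → + φL i S - + εL i S ≡ + 2 ℤ.* gap i (indicator S)
gap-indicator zero (true ∷ true ∷ S) = refl
gap-indicator zero (true ∷ false ∷ S) = refl
gap-indicator zero (false ∷ true ∷ S) = refl
gap-indicator zero (false ∷ false ∷ S) = refl
gap-indicator (suc i) (_ ∷ S) = gap-indicator i S

⊕-assoc : ∀ {k} (u v w : Wt k) → (u ⊕ v) ⊕ w ≡ u ⊕ (v ⊕ w)
⊕-assoc = VecP.zipWith-assoc ℤP.+-assoc

⊕-comm : ∀ {k} (u v : Wt k) → u ⊕ v ≡ v ⊕ u
⊕-comm = VecP.zipWith-comm ℤP.+-comm

evenᵇ-+ : ∀ {a c} d → evenᵇ a ≡ evenᵇ c → evenᵇ (a ℕ.+ d) ≡ evenᵇ (c ℕ.+ d)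
evenᵇ-+ {a} {c} zero eq rewrite ℕP.+-identityʳ a | ℕP.+-identityʳ c = eq
evenᵇ-+ {a} {c} (suc d) eq rewrite ℕP.+-suc a d | ℕP.+-suc c d | evenᵇ-suc (a ℕ.+ d) | evenᵇ-suc (c ℕ.+ d) =
  cong not (evenᵇ-+ {a} {c} d eq)

monus-antisym : ∀ m n → + (m ∸ n) - + (n ∸ m) ≡ + m - + n
monus-antisym zero zero = refl
monus-antisym zero (suc n) = refl
monus-antisym (suc m) zero = refl
monus-antisym (suc m) (suc n) = trans (monus-antisym m n) (lem (+ m) (+ n))
  where
  lem : ∀ a b → a - b ≡ 1ℤ + a - (1ℤ + b)
  lem = solve-∀

stepWt : ∀ {k} → Fin k → Bool → Wt k
stepWt i b = if b then unit (lo i) else Vec.map ℤ.-_ (unit (hi i))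

indicator-up : ∀ {k} (i : Fin k) S → getAt i S ≡ (false , true) →
  indicator (setAt i (true , true) S) ≡ indicator S ⊕ unit (lo i)
indicator-up zero (.false ∷ .true ∷ S) refl = cong₂ _∷_ refl (cong₂ _∷_ refl (sym (⊕-identityʳ _)))
indicator-up (suc i) (b ∷ S) eq = cong₂ _∷_ (sym (ℤP.+-identityʳ _)) (indicator-up i S eq)

map-neg-zero : ∀ n → Vec.map ℤ.-_ (replicate n 0ℤ) ≡ replicate n 0ℤ
map-neg-zero zero = refl
map-neg-zero (suc n) = cong (0ℤ ∷_) (map-neg-zero n)

indicator-down : ∀ {k} (i : Fin k) S → getAt i S ≡ (true , true) →
  indicator (setAt i (true , false) S) ≡ indicator S ⊕ Vec.map ℤ.-_ (unit (hi i))
indicator-down zero (.true ∷ .true ∷ S) refl = cong₂ _∷_ refl (cong₂ _∷_ refl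
  (sym (trans (cong (Vec.zipWith ℤ._+_ _) (map-neg-zero _)) (⊕-identityʳ _))))
indicator-down (suc i) (b ∷ S) eq = cong₂ _∷_ (sym (ℤP.+-identityʳ _)) (indicator-down i S eq)

eL-wt : ∀ {k} (i : Fin k) S {S′} → eL i S ≡ just S′ → indicator S′ ≡ indicator S ⊕ stepWt i (evenᵇ (εL i S))
eL-wt i S eq with getAt i S in g
eL-wt i S refl | (false , true) = indicator-up i S g
eL-wt i S refl | (true , true) = indicator-down i S g

module _ {k : ℕ} {L : Set} where

  φW-εW : ∀ i (w : Word {k} {L}) → + φW i w - + εW i w ≡ + 2 ℤ.* gap i (wtW w)
  φW-εW i [] = sym (trans (cong (+ 2 ℤ.*_) (gap-zero i)) refl)
  φW-εW i ((l , S) ∷ w) = begin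
    + (φL i S ℕ.+ (φW i w ∸ εL i S)) - + (εW i w ℕ.+ (εL i S ∸ φW i w))
      ≡⟨ lem₁ (+ φL i S) (+ (φW i w ∸ εL i S)) (+ εW i w) (+ (εL i S ∸ φW i w)) ⟩
    + φL i S - + εW i w + (+ (φW i w ∸ εL i S) - + (εL i S ∸ φW i w))
      ≡⟨ cong (_+_ (+ φL i S - + εW i w)) (monus-antisym (φW i w) (εL i S)) ⟩
    + φL i S - + εW i w + (+ φW i w - + εL i S)
      ≡⟨ lem₂ (+ φL i S) (+ εW i w) (+ φW i w) (+ εL i S) ⟩
    (+ φL i S - + εL i S) + (+ φW i w - + εW i w)
      ≡⟨ cong₂ _+_ (gap-indicator i S) (φW-εW i w) ⟩
    + 2 ℤ.* gap i (indicator S) + + 2 ℤ.* gap i (wtW w)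
      ≡⟨ sym (ℤP.*-distribˡ-+ (+ 2) (gap i (indicator S)) (gap i (wtW w))) ⟩
    + 2 ℤ.* (gap i (indicator S) + gap i (wtW w))
      ≡⟨ cong (+ 2 ℤ.*_) (sym (gap-⊕ i (indicator S) (wtW w))) ⟩
    + 2 ℤ.* gap i (indicator S ⊕ wtW w) ∎
    where
    open ≡-Reasoning
    lem₁ : ∀ a b c d → a + b - (c + d) ≡ a - c + (b - d)
    lem₁ = solve-∀
    lem₂ : ∀ a b c d → a - b + (c - d) ≡ (a - d) + (c - b)
    lem₂ = solve-∀

  eW-wt : ∀ i (w : Word {k} {L}) {w′} → eW i w ≡ just w′ → wtW w′ ≡ wtW w ⊕ stepWt i (evenᵇ (εW i w))
  eW-wt i ((l , S) ∷ w) eq with εL i S ℕP.≤? φW i w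
  ... | yes le with map-just (eW i w) (trans (sym (eW-tail i {l} {S} {w} le)) eq)
  ...   | w₁ , eq₁ , refl = trans (cong (indicator S ⊕_) (eW-wt i w eq₁))
    (trans (sym (⊕-assoc (indicator S) (wtW w) _)) (cong (λ j → (indicator S ⊕ wtW w) ⊕ stepWt i (evenᵇ j))
      (trans (sym (ℕP.+-identityʳ _)) (cong (εW i w ℕ.+_) (sym (ℕP.m≤n⇒m∸n≡0 le))))))
  eW-wt i ((l , S) ∷ w) eq | no ¬le with map-just (eL i S) (trans (sym (eW-head i {l} {S} {w} (ℕP.≰⇒> ¬le))) eq)
  ...   | S′ , eq₁ , refl = begin
    indicator S′ ⊕ wtW w                        ≡⟨ cong (_⊕ wtW w) (eL-wt i S eq₁) ⟩
    (indicator S ⊕ s) ⊕ wtW w                   ≡⟨ ⊕-swap (indicator S) s (wtW w) ⟩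
    (indicator S ⊕ wtW w) ⊕ s                   ≡⟨ cong (λ b → (indicator S ⊕ wtW w) ⊕ stepWt i b) parity ⟩
    (indicator S ⊕ wtW w) ⊕ stepWt i (evenᵇ (εW i w ℕ.+ (εL i S ∸ φW i w))) ∎
    where
    open ≡-Reasoning
    s = stepWt i (evenᵇ (εL i S))
    -- The head changes according to the parity of its own ε(S), while the word has ε(w) + ε(S) -
    -- φ(w). These agree modulo 2 because ε(w) and φ(w) do.
    parity : evenᵇ (εL i S) ≡ evenᵇ (εW i w ℕ.+ (εL i S ∸ φW i w))
    parity = trans (cong evenᵇ (sym (ℕP.m+[n∸m]≡n (ℕP.<⇒≤ (ℕP.≰⇒> ¬le)))))
      (evenᵇ-+ {φW i w} {εW i w} (εL i S ∸ φW i w) (double-parity (φW i w) (εW i w) (gap i (wtW w)) (φW-εW i w)))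

  isEpsW : ∀ i w → IsEps (Words k L) i w (εW i w)
  isEpsW i = measure-length {g = eW i} (εW i) (eW-nothing i)
    (λ w {w′} eq → proj₂ (proj₂ (fW-just i w′ (eW-just i w eq))))

  words-crystal : IsCrystal (Words k L)
  words-crystal = record
    { axiom-a = λ i w → εW i w , φW i w , isEpsW i w
                      , measure-length {g = fW i} (φW i) (fW-nothing i) (λ w eq → proj₁ (proj₂ (fW-just i w eq))) w
                      , φW-εW i w
    ; axiom-b-to = λ i w w′ → eW-just i w
    ; axiom-b-from = λ i w w′ eq → proj₁ (fW-just i w′ eq)
    ; axiom-b-wt = λ i w w′ n eq isN → trans (eW-wt i w eq)
        (cong (λ j → wtW w ⊕ stepWt i (evenᵇ j)) (length-unique {g = eW i} {w} {εW i w} {n} (isEpsW i w) isN))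
    }

-- The choice of a string through each word

last : ∀ {k} → (Fin k → Bool) → Maybe (Fin k)
last {zero} P = nothing
last {suc k} P with last (λ i → P (suc i))
... | just i = just (suc i)
... | nothing = if P zero then just zero else nothing

last-nothing : ∀ {k} (P : Fin k → Bool) → last P ≡ nothing → ∀ i → P i ≡ false
last-nothing {suc k} P eq i with last (λ i → P (suc i)) in eq′
last-nothing {suc k} P eq (suc i) | nothing = last-nothing (λ i → P (suc i)) eq′ i
last-nothing {suc k} P eq zero | nothing with P zero
... | false = refl

last-just : ∀ {k} (P : Fin k → Bool) {i} → last P ≡ just i → P i ≡ true × (∀ j → i Fin.< j → P j ≡ false)
last-just {suc k} P eq with last (λ i → P (suc i)) in eq′
last-just {suc k} P refl | just i with last-just (λ i → P (suc i)) eq′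
... | p , q = p , λ { (suc j) (ℕ.s≤s l) → q j l }
last-just {suc k} P eq | nothing with P zero in p
last-just {suc k} P refl | nothing | true = p , λ { (suc j) _ → last-nothing (λ i → P (suc i)) eq′ j }

last-unique : ∀ {k} (P : Fin k → Bool) i → P i ≡ true → (∀ j → i Fin.< j → P j ≡ false) → last P ≡ just i
last-unique {suc k} P (suc i) p q rewrite last-unique (λ i → P (suc i)) i p (λ j l → q (suc j) (ℕ.s≤s l)) = refl
last-unique {suc k} P zero p q with last (λ i → P (suc i)) in eq
... | nothing rewrite p = refl
... | just j with trans (sym (proj₁ (last-just (λ i → P (suc i)) eq))) (q (suc j) (ℕ.s≤s ℕ.z≤n))
...   | ()

module _ {k : ℕ} {L : Set} where

  -- The largest string direction obstructing the first suffix that is not highest weight.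
  -- Since φ of a highest weight suffix is even, an obstruction in direction j only depends
  -- on whether S contains hi j, which is not affected along the i-string for i < j.
  sel : Word {k} {L} → Maybe (Fin k)
  sel [] = nothing
  sel ((l , S) ∷ w) with sel w
  ... | just i = just i
  ... | nothing = last (λ i → φW i w <ᵇ εL i S)

  sel-nothing : ∀ w → sel w ≡ nothing → ∀ i → eW i w ≡ nothing
  sel-nothing [] eq i = refl
  sel-nothing ((l , S) ∷ w) eq i with sel w in eq′
  ... | nothing = trans (eW-tail i {l} {S} {w} (<ᵇ≡false⇒≤ (last-nothing _ eq i))) (cong (mapMaybe _) (sel-nothing w eq′ i))

  eL-positive : ∀ {i : Fin k} {S m} → m < εL i S → ∃ λ S′ → eL i S ≡ just S′
  eL-positive {i} {S} l = ≢nothing⇒just (λ z → ℕP.<⇒≱ l (subst (_≤ _) (sym (eL-nothing i S z)) ℕ.z≤n))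

  sel-just : ∀ w {i} → sel w ≡ just i → eW i w ≢ nothing
  sel-just ((l , S) ∷ w) {i} eq z with εL i S ℕP.≤? φW i w
  ... | no ¬le with eL-positive {i} {S} (ℕP.≰⇒> ¬le)
  ...   | S′ , eq′ with trans (sym (trans (eW-head i {l} {S} {w} (ℕP.≰⇒> ¬le)) (cong (mapMaybe _) eq′))) z
  ...     | ()
  sel-just ((l , S) ∷ w) {i} eq z | yes le with sel w in s
  sel-just ((l , S) ∷ w) {i} refl z | yes le | just i = sel-just w s (map-nothing _ (trans (sym (eW-tail i {l} {S} {w} le)) z))
  ... | nothing = ℕP.<⇒≱ (<ᵇ≡true⇒< (proj₁ (last-just _ eq))) le

  -- A letter has ε equal to 0 without `hi j`, and 1 or 2 with it. For even n, both n < 1 and n < 2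
  -- just say that n is zero.
  obstruction-cong : ∀ (j : Fin k) S S′ n → evenᵇ n ≡ true → proj₂ (getAt j S) ≡ proj₂ (getAt j S′) →
                     (n <ᵇ εL j S) ≡ (n <ᵇ εL j S′)
  obstruction-cong j S S′ n ev eq with getAt j S | getAt j S′
  obstruction-cong j S S′ n ev refl | (a , false) | (b , .false) = cong (n <ᵇ_) (trans (z a) (sym (z b)))
    where
    z : ∀ a → ε₂ (a , false) ≡ 0
    z true = refl
    z false = refl
  obstruction-cong j S S′ zero ev refl | (a , true) | (b , .true) = trans (z a) (sym (z b))
    where
    z : ∀ a → (0 <ᵇ ε₂ (a , true)) ≡ true
    z true = refl
    z false = refl
  obstruction-cong j S S′ (suc (suc n)) ev refl | (a , true) | (b , .true) = trans (z a) (sym (z b))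
    where
    z : ∀ a → (suc (suc n) <ᵇ ε₂ (a , true)) ≡ false
    z true = refl
    z false = refl

  φW-even : ∀ j (w : Word {k} {L}) → eW j w ≡ nothing → evenᵇ (φW j w) ≡ true
  φW-even j w eq = trans (double-parity (φW j w) (εW j w) _ (φW-εW j w)) (cong evenᵇ (eW-nothing j w eq))

  hi-unchanged : ∀ (i j : Fin k) p S → i Fin.< j → proj₂ (getAt j S) ≡ proj₂ (getAt j (setAt i p S))
  hi-unchanged i j p S l = trans (cong proj₂ (getAt-lookup j S))
    (trans (sym (lookup-setAt i p S (hi j) ne₁ ne₂)) (sym (cong proj₂ (getAt-lookup j (setAt i p S)))))
    where
    ne₁ : hi j ≢ lo i
    ne₁ eq = ℕP.<⇒≢ (ℕP.m<n⇒m<1+n l) (sym (trans (cong toℕ eq) (FinP.toℕ-inject₁ i)))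
    ne₂ : hi j ≢ hi i
    ne₂ refl = ℕP.<-irrefl refl l

  -- This is why the largest direction is taken. For j > i the letter `hi j` is neither `lo i` nor
  -- `hi i`, although `lo j` may be `hi i`; so obstructions above `i` survive the change, whereas
  -- those below may not.
  last-obstruction : ∀ {w : Word {k} {L}} {i : Fin k} {S} p → (∀ j → eW j w ≡ nothing) →
    last (λ i → φW i w <ᵇ εL i S) ≡ just i → φW i w < εL i (setAt i p S) →
    last (λ j → φW j w <ᵇ εL j (setAt i p S)) ≡ just i
  last-obstruction {w} {i} {S} p hw eq lt = last-unique _ i (<⇒<ᵇ≡true lt) λ j l →
    trans (sym (obstruction-cong j S (setAt i p S) (φW j w) (φW-even j w (hw j)) (hi-unchanged i j p S l)))
      (proj₂ (last-just _ eq) j l)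

  -- If the tail already determines the direction, acting on the head leaves the tail alone and
  -- acting on the tail is the induction. If the tail is highest weight, the obstruction itself
  -- forces `f` onto the head.
  sel-f : ∀ w {i w′} → sel w ≡ just i → fW i w ≡ just w′ → sel w′ ≡ just i
  sel-f ((l , S) ∷ w) {i} s eq with sel w in sw
  sel-f ((l , S) ∷ w) {i} refl eq | just i with εL i S ℕP.<? φW i w
  ... | yes lt with map-just (fW i w) (trans (sym (fW-tail i {l} {S} {w} lt)) eq)
  ...   | w₁ , eq₁ , refl rewrite sel-f w sw eq₁ = refl
  sel-f ((l , S) ∷ w) {i} refl eq | just i | no ¬lt
    with map-just (fL i S) (trans (sym (fW-head i {l} {S} {w} (ℕP.≮⇒≥ ¬lt))) eq)
  ...   | S′ , eq₁ , refl rewrite sw = refl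
  sel-f ((l , S) ∷ w) {i} s eq | nothing
    with map-just (fL i S) (trans (sym (fW-head i {l} {S} {w} (ℕP.<⇒≤ (<ᵇ≡true⇒< (proj₁ (last-just _ s)))))) eq)
  ... | S′ , eq₁ , refl rewrite sw with map-just (f₂ (getAt i S)) eq₁
  ...   | p , _ , refl = last-obstruction {w} {i} {S} p (sel-nothing w sw) s
    (ℕP.<-trans (<ᵇ≡true⇒< (proj₁ (last-just _ s))) (ℕP.≤-reflexive (sym (proj₂ (proj₂ (fL-just i S eq₁))))))

  ≤-φW-e : ∀ {i m} {w w′ : Word {k} {L}} → m ≤ φW i w → eW i w ≡ just w′ → m ≤ φW i w′
  ≤-φW-e {i} {w = w} {w′} le eq =
    ℕP.≤-trans (ℕP.m≤n⇒m≤1+n le) (ℕP.≤-reflexive (sym (proj₁ (proj₂ (fW-just i w′ (eW-just i w eq))))))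

  sel-e : ∀ w {i w′} → sel w ≡ just i → eW i w ≡ just w′ → eW i w′ ≢ nothing → sel w′ ≡ just i
  sel-e ((l , S) ∷ w) {i} s eq ne with sel w in sw
  sel-e ((l , S) ∷ w) {i} refl eq ne | just i with εL i S ℕP.≤? φW i w
  ... | yes le with map-just (eW i w) (trans (sym (eW-tail i {l} {S} {w} le)) eq)
  ...   | w₁ , eq₁ , refl rewrite sel-e w sw eq₁ (λ z → ne (trans (eW-tail i {l} {S} {w₁} (≤-φW-e {w = w} le eq₁)) (cong (mapMaybe _) z))) = refl
  sel-e ((l , S) ∷ w) {i} refl eq ne | just i | no ¬le
    with map-just (eL i S) (trans (sym (eW-head i {l} {S} {w} (ℕP.≰⇒> ¬le))) eq)
  ...   | S′ , eq₁ , refl rewrite sw = refl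
  sel-e ((l , S) ∷ w) {i} s eq ne | nothing
    with map-just (eL i S) (trans (sym (eW-head i {l} {S} {w} (<ᵇ≡true⇒< (proj₁ (last-just _ s))))) eq)
  ... | S′ , eq₁ , refl rewrite sw with map-just (e₂ (getAt i S)) eq₁
  ...   | p , _ , refl = last-obstruction {w} {i} {S} p (sel-nothing w sw) s lt
    where
    -- Were the obstruction in direction `i` gone, the new word would be the top of its string,
    -- which `ne` excludes.
    lt : φW i w < εL i (setAt i p S)
    lt with εL i (setAt i p S) ℕP.≤? φW i w
    ... | no ¬le = ℕP.≰⇒> ¬le
    ... | yes le = ⊥-elim (ne (trans (eW-tail i {l} {setAt i p S} {w} le) (cong (mapMaybe _) (sel-nothing w sw i))))

-- Closure of set-valued tableaux under the crystal operators

_∋_ : ∀ {n} → Subset n → Fin n → Set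
S ∋ a = lookup S a ≡ true

¬∋⇒false : ∀ {n} {S : Subset n} {a} → ¬ S ∋ a → lookup S a ≡ false
¬∋⇒false {S = S} {a} h with lookup S a
... | true = ⊥-elim (h refl)
... | false = refl

map-++⁻ : ∀ {A B : Set} {g : A → B} xs u {y v} → map g xs ≡ u ++ y ∷ v →
          ∃ λ us → ∃ λ p → ∃ λ vs → xs ≡ us ++ p ∷ vs × map g us ≡ u × g p ≡ y × map g vs ≡ v
map-++⁻ (x ∷ xs) [] eq with ListP.∷-injective eq
... | h , t = [] , x , xs , refl , refl , h , t
map-++⁻ (x ∷ xs) (y ∷ u) eq with ListP.∷-injective eq
... | refl , t with map-++⁻ xs u t
... | us , p , vs , refl , refl , h , t′ = x ∷ us , p , vs , refl , refl , h , t′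

module _ {k : ℕ} {L : Set} (i : Fin k) where

  -- Unfolds the nested case distinction of the tensor rule: `f` changes the first letter whose ε is
  -- at least φ of the rest. The recorded inequalities at that letter and at those before it are all
  -- that the closure argument uses.
  fW-position : ∀ (w : Word {k} {L}) {w′} → fW i w ≡ just w′ →
    ∃ λ u → ∃ λ l → ∃ λ S → ∃ λ S′ → ∃ λ v →
      w ≡ u ++ (l , S) ∷ v × w′ ≡ u ++ (l , S′) ∷ v × fL i S ≡ just S′ × φW i v ≤ εL i S ×
      (∀ u₁ m R u₂ → u ≡ u₁ ++ (m , R) ∷ u₂ → εL i R < φW i (u₂ ++ (l , S) ∷ v))
  fW-position ((l , S) ∷ w) eq with εL i S ℕP.<? φW i w
  ... | no ¬lt with map-just (fL i S) (trans (sym (fW-head i {l} {S} {w} (ℕP.≮⇒≥ ¬lt))) eq)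
  ...   | S′ , eq₁ , refl = [] , l , S , S′ , w , refl , refl , eq₁ , ℕP.≮⇒≥ ¬lt , λ { [] _ _ _ () ; (_ ∷ _) _ _ _ () }
  fW-position ((l , S) ∷ w) eq | yes lt with map-just (fW i w) (trans (sym (fW-tail i {l} {S} {w} lt)) eq)
  ...   | w₁ , eq₁ , refl with fW-position w eq₁
  ...     | u , m , R , R′ , v , refl , refl , p , q , r =
    (l , S) ∷ u , m , R , R′ , v , refl , refl , p , q
    , λ { [] _ _ _ refl → lt ; (_ ∷ u₁) m′ T u₂ refl → r u₁ m′ T u₂ refl }

  eW-position : ∀ (w : Word {k} {L}) {w′} → eW i w ≡ just w′ →
    ∃ λ u → ∃ λ l → ∃ λ S → ∃ λ S′ → ∃ λ v →
      w ≡ u ++ (l , S) ∷ v × w′ ≡ u ++ (l , S′) ∷ v × eL i S ≡ just S′ × φW i v < εL i S ×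
      (∀ u₁ m R u₂ → u ≡ u₁ ++ (m , R) ∷ u₂ → εL i R ≤ φW i (u₂ ++ (l , S) ∷ v))
  eW-position ((l , S) ∷ w) eq with εL i S ℕP.≤? φW i w
  ... | no ¬le with map-just (eL i S) (trans (sym (eW-head i {l} {S} {w} (ℕP.≰⇒> ¬le))) eq)
  ...   | S′ , eq₁ , refl = [] , l , S , S′ , w , refl , refl , eq₁ , ℕP.≰⇒> ¬le , λ { [] _ _ _ () ; (_ ∷ _) _ _ _ () }
  eW-position ((l , S) ∷ w) eq | yes le with map-just (eW i w) (trans (sym (eW-tail i {l} {S} {w} le)) eq)
  ...   | w₁ , eq₁ , refl with eW-position w eq₁
  ...     | u , m , R , R′ , v , refl , refl , p , q , r =
    (l , S) ∷ u , m , R , R′ , v , refl , refl , p , q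
    , λ { [] _ _ _ refl → le ; (_ ∷ u₁) m′ T u₂ refl → r u₁ m′ T u₂ refl }

  φW-++-≥ : ∀ (u w : Word {k} {L}) → (∀ {m R} → (m , R) ∈ u → εL i R ≡ 0) → φW i w ≤ φW i (u ++ w)
  φW-++-≥ [] w z = ℕP.≤-refl
  φW-++-≥ ((l , S) ∷ u) w z rewrite z (here refl) =
    ℕP.≤-trans (φW-++-≥ u w (λ m → z (there m))) (ℕP.m≤n+m _ (φL i S))

  φW-++-≤ : ∀ (u w : Word {k} {L}) → (∀ {m R} → (m , R) ∈ u → φL i R ≡ 0) → φW i (u ++ w) ≤ φW i w
  φW-++-≤ [] w z = ℕP.≤-refl
  φW-++-≤ ((l , S) ∷ u) w z rewrite z (here refl) =
    ℕP.≤-trans (ℕP.m∸n≤m (φW i (u ++ w)) (εL i S)) (φW-++-≤ u w (λ m → z (there m)))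

  φW-positive : ∀ (w : Word {k} {L}) → 0 < φW i w → ∃ λ m → ∃ λ R → (m , R) ∈ w × R ∋ lo i
  φW-positive ((l , S) ∷ w) pos with lookup S (lo i) in eq
  ... | true = l , S , here refl , eq
  ... | false with φW-positive w (ℕP.≤-trans pos (ℕP.≤-trans (ℕP.≤-reflexive (cong (ℕ._+ (φW i w ∸ εL i S)) z)) (ℕP.m∸n≤m (φW i w) (εL i S))))
    where
    z : φL i S ≡ 0
    z rewrite getAt-lookup i S | eq = refl
  ...   | m , R , m∈ , R∋ = m , R , there m∈ , R∋

module _ {k : ℕ} (i : Fin k) (S : Subset (suc k)) where

  εL-∌ : lookup S (hi i) ≡ false → εL i S ≡ 0
  εL-∌ eq rewrite getAt-lookup i S | eq with lookup S (lo i)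
  ... | true = refl
  ... | false = refl

  φL-∌ : lookup S (lo i) ≡ false → φL i S ≡ 0
  φL-∌ eq rewrite getAt-lookup i S | eq = refl

  εL-∋ : S ∋ hi i → 0 < εL i S
  εL-∋ eq rewrite getAt-lookup i S | eq with lookup S (lo i)
  ... | true = ℕ.s≤s ℕ.z≤n
  ... | false = ℕ.s≤s ℕ.z≤n

  φL-∋ : S ∋ lo i → 0 < φL i S
  φL-∋ eq rewrite getAt-lookup i S | eq with lookup S (hi i)
  ... | true = ℕ.s≤s ℕ.z≤n
  ... | false = ℕ.s≤s ℕ.z≤n

  εL-pure : lookup S (lo i) ≡ false → S ∋ hi i → εL i S ≡ 2
  εL-pure eq eq′ rewrite getAt-lookup i S | eq | eq′ = refl

  φL-pure : S ∋ lo i → lookup S (hi i) ≡ false → φL i S ≡ 2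
  φL-pure eq eq′ rewrite getAt-lookup i S | eq | eq′ = refl

  -- One of the two steps in a letter's string removes an entry, which never harms a tableau; the
  -- other adds `new` beside `here`, and only then do the neighbouring boxes matter.
  data Change (S′ : Subset (suc k)) (here new : Fin (suc k)) : Set where
    shrink : (∀ {a} → S′ ∋ a → S ∋ a) → Change S′ here new
    grow : S ∋ here → lookup S new ≡ false → S′ ∋ new → (∀ {a} → S′ ∋ a → S ∋ a ⊎ a ≡ new) → Change S′ here new

  setAt-∋ : ∀ p {a} → setAt i p S ∋ a →
            (a ≡ lo i × proj₁ p ≡ true) ⊎ (a ≡ hi i × proj₂ p ≡ true) ⊎ S ∋ a
  setAt-∋ p {a} eq with a FinP.≟ lo i | a FinP.≟ hi i
  ... | yes refl | _ = inj₁ (refl , trans (sym (cong proj₁ (trans (sym (getAt-lookup i (setAt i p S))) (getAt-setAt i p S)))) eq)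
  ... | no _ | yes refl = inj₂ (inj₁ (refl , trans (sym (cong proj₂ (trans (sym (getAt-lookup i (setAt i p S))) (getAt-setAt i p S)))) eq))
  ... | no l | no h = inj₂ (inj₂ (trans (sym (lookup-setAt i p S a l h)) eq))

  setAt-lo : ∀ p → lookup (setAt i p S) (lo i) ≡ proj₁ p
  setAt-lo p = cong proj₁ (trans (sym (getAt-lookup i (setAt i p S))) (getAt-setAt i p S))

  setAt-hi : ∀ p → lookup (setAt i p S) (hi i) ≡ proj₂ p
  setAt-hi p = cong proj₂ (trans (sym (getAt-lookup i (setAt i p S))) (getAt-setAt i p S))

  fL-change : ∀ {S′} → fL i S ≡ just S′ → S′ ∋ hi i × Change S′ (lo i) (hi i)
  fL-change eq with getAt i S in g
  fL-change refl | (true , false) = setAt-hi (true , true) , grow l h (setAt-hi (true , true)) new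
    where
    l = cong proj₁ (trans (sym (getAt-lookup i S)) g)
    h = cong proj₂ (trans (sym (getAt-lookup i S)) g)
    new : ∀ {a} → setAt i (true , true) S ∋ a → S ∋ a ⊎ a ≡ hi i
    new m with setAt-∋ (true , true) m
    ... | inj₁ (refl , _) = inj₁ l
    ... | inj₂ (inj₁ (refl , _)) = inj₂ refl
    ... | inj₂ (inj₂ m′) = inj₁ m′
  fL-change refl | (true , true) = setAt-hi (false , true) , shrink old
    where
    h = cong proj₂ (trans (sym (getAt-lookup i S)) g)
    old : ∀ {a} → setAt i (false , true) S ∋ a → S ∋ a
    old m with setAt-∋ (false , true) m
    ... | inj₂ (inj₁ (refl , _)) = h
    ... | inj₂ (inj₂ m′) = m′

  eL-change : ∀ {S′} → eL i S ≡ just S′ → S′ ∋ lo i × Change S′ (hi i) (lo i)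
  eL-change eq with getAt i S in g
  eL-change refl | (false , true) = setAt-lo (true , true) , grow h l (setAt-lo (true , true)) new
    where
    l = cong proj₁ (trans (sym (getAt-lookup i S)) g)
    h = cong proj₂ (trans (sym (getAt-lookup i S)) g)
    new : ∀ {a} → setAt i (true , true) S ∋ a → S ∋ a ⊎ a ≡ lo i
    new m with setAt-∋ (true , true) m
    ... | inj₁ (refl , _) = inj₂ refl
    ... | inj₂ (inj₁ (refl , _)) = inj₁ h
    ... | inj₂ (inj₂ m′) = inj₁ m′
  eL-change refl | (true , true) = setAt-lo (true , false) , shrink old
    where
    l = cong proj₁ (trans (sym (getAt-lookup i S)) g)
    old : ∀ {a} → setAt i (true , false) S ∋ a → S ∋ a
    old m with setAt-∋ (true , false) m
    ... | inj₁ (refl , _) = l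
    ... | inj₂ (inj₂ m′) = m′

-- Set-valued tableaux and their reading words

regroup : ∀ {A : Set} {xs us vs : List A} {q p} → xs ≡ (us ++ q ∷ vs) ++ p → xs ≡ us ++ q ∷ vs ++ p
regroup {us = us} {vs} {q} {p} eq = trans eq (ListP.++-assoc us (q ∷ vs) p)

regroup′ : ∀ {A : Set} {xs us vs ws : List A} {q p} → xs ≡ us ++ p ∷ vs ++ q ∷ ws → xs ≡ (us ++ p ∷ vs) ++ q ∷ ws
regroup′ {us = us} {vs} {ws} {q} {p} eq = trans eq (sym (ListP.++-assoc us (p ∷ vs) (q ∷ ws)))

module LetterOrder {k : ℕ} (i : Fin k) where

  lo<hi : toℕ (lo i) < toℕ (hi i)
  lo<hi = ℕ.s≤s (ℕP.≤-reflexive (FinP.toℕ-inject₁ i))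

  ≤lo⇒<hi : ∀ {m} → m ≤ toℕ (lo i) → m < toℕ (hi i)
  ≤lo⇒<hi l = ℕP.≤-<-trans l lo<hi

  <hi⇒≤lo : ∀ {m} → m < toℕ (hi i) → m ≤ toℕ (lo i)
  <hi⇒≤lo (ℕ.s≤s l) = ℕP.≤-trans l (ℕP.≤-reflexive (sym (FinP.toℕ-inject₁ i)))

  lo<⇒hi≤ : ∀ {m} → toℕ (lo i) < m → toℕ (hi i) ≤ m
  lo<⇒hi≤ l = ℕP.≤-trans (ℕ.s≤s (ℕP.≤-reflexive (sym (FinP.toℕ-inject₁ i)))) l

  between-lo-hi : ∀ {m} → toℕ (lo i) < m → m < toℕ (hi i) → ⊥
  between-lo-hi l l′ = ℕP.<⇒≱ l (<hi⇒≤lo l′)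

  is-hi : ∀ {b : Fin (suc k)} → toℕ (lo i) < toℕ b → toℕ b ≤ toℕ (hi i) → b ≡ hi i
  is-hi l l′ = FinP.toℕ-injective (ℕP.≤-antisym l′ (lo<⇒hi≤ l))

  is-lo : ∀ {b : Fin (suc k)} → toℕ (lo i) ≤ toℕ b → toℕ b < toℕ (hi i) → b ≡ lo i
  is-lo l l′ = FinP.toℕ-injective (ℕP.≤-antisym (<hi⇒≤lo l′) l)

-- A Young diagram given only by the coordinates of its boxes. `below-closed` refers to smaller
-- coordinates: the diagram contains every position weakly above and to the left of a box.
module Tableaux {k N : ℕ} (row col : Fin N → ℕ)
  (box-injective : ∀ {p q} → row p ≡ row q → col p ≡ col q → p ≡ q)
  (below-closed : ∀ p r c → r ≤ row p → c ≤ col p → ∃ λ q → row q ≡ r × col q ≡ c)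
  where

  -- Reading order: columns from left to right, each from bottom to top.
  _≺_ : Fin N → Fin N → Set
  p ≺ q = col p < col q ⊎ (col p ≡ col q × row q < row p)

  ≺-irrefl : ∀ {p} → ¬ p ≺ p
  ≺-irrefl (inj₁ l) = ℕP.<-irrefl refl l
  ≺-irrefl (inj₂ (_ , l)) = ℕP.<-irrefl refl l

  ≺-trans : ∀ {p q r} → p ≺ q → q ≺ r → p ≺ r
  ≺-trans (inj₁ l) (inj₁ m) = inj₁ (ℕP.<-trans l m)
  ≺-trans (inj₁ l) (inj₂ (e , m)) = inj₁ (ℕP.<-≤-trans l (ℕP.≤-reflexive e))
  ≺-trans (inj₂ (e , l)) (inj₁ m) = inj₁ (ℕP.≤-<-trans (ℕP.≤-reflexive e) m)
  ≺-trans (inj₂ (e , l)) (inj₂ (e′ , m)) = inj₂ (trans e e′ , ℕP.<-trans m l)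

  no-between : ∀ {p y q} → p ≺ y → y ≺ q → col p ≡ col q → row p ≡ suc (row q) → ⊥
  no-between (inj₁ l) (inj₁ m) ec er = ℕP.<-irrefl ec (ℕP.<-trans l m)
  no-between (inj₁ l) (inj₂ (e , _)) ec er = ℕP.<-irrefl (trans ec (sym e)) l
  no-between (inj₂ (e , _)) (inj₁ m) ec er = ℕP.<-irrefl (trans (sym e) ec) m
  no-between {y = y} (inj₂ (_ , l)) (inj₂ (_ , m)) ec er = ℕP.<⇒≱ m (ℕP.≤-pred (subst (row y <_) er l))

  Fill : Set
  Fill = Vec (Subset (suc k)) N

  record SVT (F : Fill) : Set where
    field
      occupied : ∀ p → ∃ λ a → lookup F p ∋ a
      rows : ∀ {p q} → row p ≡ row q → col p < col q → ∀ {a b} → lookup F p ∋ a → lookup F q ∋ b → toℕ a ≤ toℕ b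
      columns : ∀ {p q} → col p ≡ col q → row p < row q → ∀ {a b} → lookup F p ∋ a → lookup F q ∋ b → toℕ a < toℕ b

  open SVT

  module _ {F : Fill} (svt : SVT F) where

    update-SVT : ∀ p {S′} → (∃ λ a → S′ ∋ a) →
      (∀ {a} → S′ ∋ a → ∀ {q} → row q ≡ row p → col q < col p → ∀ {b} → lookup F q ∋ b → toℕ b ≤ toℕ a) →
      (∀ {a} → S′ ∋ a → ∀ {q} → row q ≡ row p → col p < col q → ∀ {b} → lookup F q ∋ b → toℕ a ≤ toℕ b) →
      (∀ {a} → S′ ∋ a → ∀ {q} → col q ≡ col p → row q < row p → ∀ {b} → lookup F q ∋ b → toℕ b < toℕ a) →
      (∀ {a} → S′ ∋ a → ∀ {q} → col q ≡ col p → row p < row q → ∀ {b} → lookup F q ∋ b → toℕ a < toℕ b) →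
      SVT (F [ p ]≔ S′)
    update-SVT p {S′} ne left right above below = record { occupied = occ ; rows = rw ; columns = cl }
      where
      at : ∀ q {a} → lookup (F [ p ]≔ S′) q ∋ a → (q ≡ p × S′ ∋ a) ⊎ lookup F q ∋ a
      at q m with q FinP.≟ p
      ... | yes refl = inj₁ (refl , subst (_∋ _) (VecP.lookup∘update p F S′) m)
      ... | no q≢p = inj₂ (subst (_∋ _) (VecP.lookup∘update′ q≢p F S′) m)
      occ : ∀ q → ∃ λ a → lookup (F [ p ]≔ S′) q ∋ a
      occ q with q FinP.≟ p
      ... | yes refl = proj₁ ne , subst (_∋ _) (sym (VecP.lookup∘update p F S′)) (proj₂ ne)
      ... | no q≢p = proj₁ (occupied svt q) , subst (_∋ _) (sym (VecP.lookup∘update′ q≢p F S′)) (proj₂ (occupied svt q))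
      rw : ∀ {q r} → row q ≡ row r → col q < col r → ∀ {a b} → lookup (F [ p ]≔ S′) q ∋ a → lookup (F [ p ]≔ S′) r ∋ b → toℕ a ≤ toℕ b
      rw {q} {r} e l m m′ with at q m | at r m′
      ... | inj₁ (refl , n) | inj₁ (refl , _) = ⊥-elim (ℕP.<-irrefl refl l)
      ... | inj₁ (refl , n) | inj₂ n′ = right n (sym e) l n′
      ... | inj₂ n | inj₁ (refl , n′) = left n′ e l n
      ... | inj₂ n | inj₂ n′ = rows svt e l n n′
      cl : ∀ {q r} → col q ≡ col r → row q < row r → ∀ {a b} → lookup (F [ p ]≔ S′) q ∋ a → lookup (F [ p ]≔ S′) r ∋ b → toℕ a < toℕ b
      cl {q} {r} e l m m′ with at q m | at r m′
      ... | inj₁ (refl , n) | inj₁ (refl , _) = ⊥-elim (ℕP.<-irrefl refl l)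
      ... | inj₁ (refl , n) | inj₂ n′ = below n (sym e) l n′
      ... | inj₂ n | inj₁ (refl , n′) = above n′ e l n
      ... | inj₂ n | inj₂ n′ = columns svt e l n n′

    shrink-SVT : ∀ p {S′} → (∃ λ a → S′ ∋ a) → (∀ {a} → S′ ∋ a → lookup F p ∋ a) → SVT (F [ p ]≔ S′)
    shrink-SVT p ne sub = update-SVT p ne
      (λ m e l n → rows svt e l n (sub m)) (λ m e l n → rows svt (sym e) l (sub m) n)
      (λ m e l n → columns svt e l n (sub m)) (λ m e l n → columns svt (sym e) l (sub m) n)

    -- Entries increase strictly down the column that starts in row zero; rows and letters are both
    -- numbered from zero.
    row≤entry : ∀ p {a} → lookup F p ∋ a → row p ≤ toℕ a
    row≤entry p m = go (row p) p refl m
      where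
      go : ∀ r p → row p ≡ r → ∀ {a} → lookup F p ∋ a → r ≤ toℕ a
      go zero p e m = ℕ.z≤n
      go (suc r) p e m with below-closed p r (col p) (ℕP.≤-trans (ℕP.n≤1+n r) (ℕP.≤-reflexive (sym e))) ℕP.≤-refl
      ... | q , eq , ec with occupied svt q
      ... | b , n = ℕP.≤-<-trans (go r q eq n)
        (columns svt ec (subst₂ _<_ (sym eq) (sym e) (ℕP.n<1+n r)) n m)

  module Reading (order : List (Fin N)) (complete : ∀ p → p ∈ order) (sorted : AllPairs _≺_ order) where

    cell : Fill → Fin N → Fin N × Subset (suc k)
    cell F p = p , lookup F p

    read : Fill → Word {k} {Fin N}
    read F = map (cell F) order

    after : ∀ {xs} → AllPairs _≺_ xs → ∀ us {p vs q} → xs ≡ us ++ p ∷ vs → q ∈ vs → p ≺ q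
    after (s ∷ _) [] refl m = All.lookup s m
    after (_ ∷ ss) (x ∷ us) refl m = after ss us refl m

    before : ∀ {xs} → AllPairs _≺_ xs → ∀ us {p vs q} → xs ≡ us ++ p ∷ vs → q ∈ us → q ≺ p
    before (s ∷ _) (x ∷ us) refl (here refl) = All.lookup s (∈-++⁺ʳ us (here refl))
    before (_ ∷ ss) (x ∷ us) refl (there m) = before ss us refl m

    module _ {us p vs} (split : order ≡ us ++ p ∷ vs) where

      p≺ : ∀ {q} → q ∈ vs → p ≺ q
      p≺ = after sorted us split

      ≺p : ∀ {q} → q ∈ us → q ≺ p
      ≺p = before sorted us split

      locate : ∀ q → q ∈ us ⊎ q ≡ p ⊎ q ∈ vs
      locate q with ∈-++⁻ us (subst (q ∈_) split (complete q))
      ... | inj₁ m = inj₁ m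
      ... | inj₂ (here e) = inj₂ (inj₁ e)
      ... | inj₂ (there m) = inj₂ (inj₂ m)

      ∈before : ∀ {q} → q ≺ p → q ∈ us
      ∈before {q} l with locate q
      ... | inj₁ m = m
      ... | inj₂ (inj₁ refl) = ⊥-elim (≺-irrefl {p} l)
      ... | inj₂ (inj₂ m) = ⊥-elim (≺-irrefl {p} (≺-trans {p} {q} {p} (p≺ m) l))

      ∈after : ∀ {q} → p ≺ q → q ∈ vs
      ∈after {q} l with locate q
      ... | inj₁ m = ⊥-elim (≺-irrefl {p} (≺-trans {p} {q} {p} l (≺p m)))
      ... | inj₂ (inj₁ refl) = ⊥-elim (≺-irrefl {p} l)
      ... | inj₂ (inj₂ m) = m

      read-update : ∀ F S′ → read (F [ p ]≔ S′) ≡ map (cell F) us ++ (p , S′) ∷ map (cell F) vs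
      read-update F S′ = trans (cong (map (cell (F [ p ]≔ S′))) split) (trans (ListP.map-++ _ us (p ∷ vs))
        (cong₂ _++_ (same us (λ m → λ { refl → ≺-irrefl {p} (≺p m) }))
          (cong₂ _∷_ (cong (p ,_) (VecP.lookup∘update p F S′)) (same vs (λ m → λ { refl → ≺-irrefl {p} (p≺ m) })))))
        where
        same : ∀ xs → (∀ {q} → q ∈ xs → q ≢ p) → map (cell (F [ p ]≔ S′)) xs ≡ map (cell F) xs
        same xs ne = ListP.map-cong-local (All.tabulate (λ {q} m → cong (q ,_) (VecP.lookup∘update′ (ne m) F S′)))

    module _ {F : Fill} (svt : SVT F) (i : Fin k) where

      open LetterOrder i

      module _ {us p vs} (split : order ≡ us ++ p ∷ vs) where

        private
          S = lookup F p
          U = map (cell F) us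
          V = map (cell F) vs

        module _ (S∋lo : S ∋ lo i) (S∌hi : lookup S (hi i) ≡ false) (φV : φW i V ≤ εL i S)
          (εU : ∀ u₁ m R u₂ → U ≡ u₁ ++ (m , R) ∷ u₂ → εL i R < φW i (u₂ ++ (p , S) ∷ V)) where

          φV≡0 : φW i V ≡ 0
          φV≡0 = ℕP.n≤0⇒n≡0 (ℕP.≤-trans φV (ℕP.≤-reflexive (εL-∌ i S S∌hi)))

          -- The box directly below p would immediately precede p in the reading word.
          f-below : ∀ {q} → col q ≡ col p → row p < row q → ¬ lookup F q ∋ hi i
          f-below {q} ec l q∋hi with below-closed q (suc (row p)) (col p) l (ℕP.≤-reflexive (sym ec))
          ... | q₁ , er , ec₁ with ∈-∃++ (∈before split {q₁} (inj₂ (ec₁ , ℕP.≤-reflexive (sym er))))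
          ...   | u₁ , y ∷ u₂ , refl = no-between {q₁} {y} {p} (after sorted u₁ (regroup split) (here refl))
                    (≺p split (∈-++⁺ʳ u₁ (there (here refl)))) ec₁ er
          -- The box below contains `hi i` but not `lo i`, so its ε is 2. The word from `p` onwards
          -- has φ equal to 2 as well, against the strict inequality in `εU`.
          ...   | u₁ , [] , refl = ℕP.<-irrefl refl (subst₂ _<_ (εL-pure i (lookup F q₁) q₁∌lo q₁∋hi) two
                    (εU (map (cell F) u₁) q₁ (lookup F q₁) [] (ListP.map-++ _ u₁ (q₁ ∷ []))))
            where
            q₁∌lo : lookup (lookup F q₁) (lo i) ≡ false
            q₁∌lo = ¬∋⇒false {S = lookup F q₁} λ m → ℕP.<-irrefl refl
              (columns svt (sym ec₁) (ℕP.≤-reflexive (sym er)) S∋lo m)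
            q₁∋hi : lookup F q₁ ∋ hi i
            q₁∋hi with ℕP.<-cmp (row q₁) (row q)
            ... | tri≈ _ e _ = subst (λ r → lookup F r ∋ hi i) (sym (box-injective e (trans ec₁ (sym ec)))) q∋hi
            ... | tri> _ _ g = ⊥-elim (ℕP.<⇒≱ g (ℕP.≤-trans (ℕP.≤-reflexive er) l))
            ... | tri< g _ _ with occupied svt q₁
            ...   | b , m = ⊥-elim (between-lo-hi (columns svt (sym ec₁) (ℕP.≤-reflexive (sym er)) S∋lo m)
                                                  (columns svt (trans ec₁ (sym ec)) g m q∋hi))
            two : φW i ((p , S) ∷ V) ≡ 2
            two = trans (cong₂ (λ a b → a ℕ.+ (b ∸ εL i S)) (φL-pure i S S∋lo S∌hi) φV≡0) (cong (2 ℕ.+_) (ℕP.0∸n≡0 (εL i S)))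

          -- Otherwise no letter read between p and q contains hi i, so q would make φW i V positive.
          f-right : ∀ {q} → row p ≡ row q → col p < col q → ¬ lookup F q ∋ lo i
          f-right {q} er l q∋lo with ∈-∃++ (∈after split {q} (inj₁ l))
          ... | v₁ , v₂ , refl = ℕP.<⇒≱ positive (ℕP.≤-reflexive φV≡0)
            where
            V₂ = map (cell F) v₂
            no-hi : ∀ {x} → x ∈ v₁ → ¬ lookup F x ∋ hi i
            no-hi {x} m x∋hi = go (p≺ split (∈-++⁺ˡ m)) (before sorted (us ++ p ∷ v₁) (regroup′ split) (∈-++⁺ʳ us (there m)))
              where
              -- If `x` is in the row of `p` it is compared with `q` directly. If `x` is above that
              -- row, the box under it in the row of `q` gives a contradiction; if below, the box
              -- under `p` in the row of `x` would contain `hi i`, against `f-below`.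
              go : p ≺ x → x ≺ q → ⊥
              go (inj₂ (e , g)) _ = ℕP.<-asym lo<hi (columns svt (sym e) g x∋hi S∋lo)
              go (inj₁ g) xq with ℕP.<-cmp (row x) (row p)
              go (inj₁ g) (inj₁ h) | tri≈ _ e _ = ℕP.<⇒≱ lo<hi (rows svt (trans e er) h x∋hi q∋lo)
              go (inj₁ g) (inj₂ (_ , h)) | tri≈ _ e _ = ℕP.<-irrefl (sym (trans e er)) h
              go (inj₁ g) (inj₂ (_ , h)) | tri< e _ _ = ℕP.<⇒≱ (ℕP.<-trans e (ℕP.≤-<-trans (ℕP.≤-reflexive er) h)) ℕP.≤-refl
              go (inj₁ g) (inj₁ h) | tri< e _ _ with below-closed q (row q) (col x) ℕP.≤-refl (ℕP.<⇒≤ h)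
              ... | y , ey , cy with occupied svt y
              ...   | b , n = ℕP.<⇒≱ lo<hi (ℕP.≤-trans (ℕP.<⇒≤ (columns svt (sym cy) (subst (row x <_) (trans er (sym ey)) e) x∋hi n))
                                (rows svt ey (subst (_< col q) (sym cy) h) n q∋lo))
              go (inj₁ g) xq | tri> _ _ e with below-closed x (row x) (col p) ℕP.≤-refl (ℕP.<⇒≤ g)
              ... | y , ey , cy with occupied svt y
              ...   | b , n = f-below cy (subst (row p <_) (sym ey) e) (subst (lookup F y ∋_)
                                (is-hi (columns svt (sym cy) (subst (row p <_) (sym ey) e) S∋lo n)
                                       (rows svt ey (subst (_< col x) (sym cy) g) n x∋hi)) n)
            zeros : ∀ {m R} → (m , R) ∈ map (cell F) v₁ → εL i R ≡ 0
            zeros m∈ with ∈-map⁻ (cell F) m∈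
            ... | x , m , refl = εL-∌ i (lookup F x) (¬∋⇒false {S = lookup F x} (no-hi m))
            positive : 0 < φW i V
            positive = ℕP.<-≤-trans (φL-∋ i (lookup F q) q∋lo) (ℕP.≤-trans (ℕP.m≤m+n _ _)
              (ℕP.≤-trans (φW-++-≥ i (map (cell F) v₁) ((q , lookup F q) ∷ V₂) zeros)
                (ℕP.≤-reflexive (cong (φW i) (sym (ListP.map-++ (cell F) v₁ (q ∷ v₂)))))))

          f-grow : ∀ {S′} → S′ ∋ hi i → (∀ {a} → S′ ∋ a → S ∋ a ⊎ a ≡ hi i) → SVT (F [ p ]≔ S′)
          f-grow {S′} S′∋ old = update-SVT svt p (hi i , S′∋) left right above below
            where
            left : ∀ {a} → S′ ∋ a → ∀ {q} → row q ≡ row p → col q < col p → ∀ {b} → lookup F q ∋ b → toℕ b ≤ toℕ a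
            left m e l n with old m
            ... | inj₁ m′ = rows svt e l n m′
            ... | inj₂ refl = ℕP.<⇒≤ (≤lo⇒<hi (rows svt e l n S∋lo))
            right : ∀ {a} → S′ ∋ a → ∀ {q} → row q ≡ row p → col p < col q → ∀ {b} → lookup F q ∋ b → toℕ a ≤ toℕ b
            right m {q} e l n with old m
            ... | inj₁ m′ = rows svt (sym e) l m′ n
            ... | inj₂ refl = lo<⇒hi≤ (ℕP.≤∧≢⇒< (rows svt (sym e) l S∋lo n)
                    (λ eq → f-right (sym e) l (subst (lookup F q ∋_) (FinP.toℕ-injective (sym eq)) n)))
            above : ∀ {a} → S′ ∋ a → ∀ {q} → col q ≡ col p → row q < row p → ∀ {b} → lookup F q ∋ b → toℕ b < toℕ a
            above m e l n with old m
            ... | inj₁ m′ = columns svt e l n m′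
            ... | inj₂ refl = ℕP.<-trans (columns svt e l n S∋lo) lo<hi
            below : ∀ {a} → S′ ∋ a → ∀ {q} → col q ≡ col p → row p < row q → ∀ {b} → lookup F q ∋ b → toℕ a < toℕ b
            below m {q} e l n with old m
            ... | inj₁ m′ = columns svt (sym e) l m′ n
            ... | inj₂ refl = ℕP.≤∧≢⇒< (lo<⇒hi≤ (columns svt (sym e) l S∋lo n))
                    (λ eq → f-below e l (subst (lookup F q ∋_) (FinP.toℕ-injective (sym eq)) n))

        module _ (S∋hi : S ∋ hi i) (S∌lo : lookup S (lo i) ≡ false) (φV : φW i V < εL i S)
          (εU : ∀ u₁ m R u₂ → U ≡ u₁ ++ (m , R) ∷ u₂ → εL i R ≤ φW i (u₂ ++ (p , S) ∷ V)) where

          φV<2 : φW i V < 2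
          φV<2 = subst (φW i V <_) (εL-pure i S S∌lo S∋hi) φV

          -- The box directly above p would immediately follow p in the reading word.
          e-above : ∀ {q} → col q ≡ col p → row q < row p → ¬ lookup F q ∋ lo i
          e-above {q} ec l q∋lo with row p in rp
          ... | suc r with below-closed p r (col p) (ℕP.≤-trans (ℕP.n≤1+n r) (ℕP.≤-reflexive (sym rp))) ℕP.≤-refl
          ...   | q₁ , er , ec₁ with ∈-∃++ (∈after split {q₁} (inj₂ (sym ec₁ , q₁<p)))
            where
            q₁<p : row q₁ < row p
            q₁<p = subst₂ _<_ (sym er) (sym rp) (ℕP.n<1+n r)
          ...     | y ∷ v₁ , v₂ , refl = no-between {p} {y} {q₁} (p≺ split (here refl))
                      (before sorted (us ++ p ∷ y ∷ v₁) (regroup′ split) (∈-++⁺ʳ us (there (here refl))))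
                      (sym ec₁) (trans rp (cong suc (sym er)))
          -- The box above contains `lo i` but not `hi i`, so it alone contributes 2 to φ of the
          -- word after `p`.
          ...     | [] , v₂ , refl = ℕP.<⇒≱ φV<2 (ℕP.≤-trans (ℕP.≤-reflexive (sym (φL-pure i (lookup F q₁) q₁∋lo q₁∌hi)))
                      (ℕP.m≤m+n _ _))
            where
            q₁<p : row q₁ < row p
            q₁<p = subst₂ _<_ (sym er) (sym rp) (ℕP.n<1+n r)
            q₁∌hi : lookup (lookup F q₁) (hi i) ≡ false
            q₁∌hi = ¬∋⇒false {S = lookup F q₁} λ m → ℕP.<-irrefl refl (columns svt ec₁ q₁<p m S∋hi)
            q₁∋lo : lookup F q₁ ∋ lo i
            q₁∋lo with ℕP.<-cmp (row q) (row q₁)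
            ... | tri≈ _ e _ = subst (λ x → lookup F x ∋ lo i) (box-injective e (trans ec (sym ec₁))) q∋lo
            ... | tri> _ _ g = ⊥-elim (ℕP.<⇒≱ g (ℕP.≤-trans (ℕP.≤-pred l) (ℕP.≤-reflexive (sym er))))
            ... | tri< g _ _ with occupied svt q₁
            ...   | b , m = ⊥-elim (between-lo-hi (columns svt (trans ec (sym ec₁)) g q∋lo m) (columns svt ec₁ q₁<p m S∋hi))

          -- Otherwise no letter read between q and p contains lo i, so the one at q is not bracketed.
          e-left : ∀ {q} → row q ≡ row p → col q < col p → ¬ lookup F q ∋ hi i
          e-left {q} er l q∋hi with ∈-∃++ (∈before split {q} (inj₁ l))
          ... | u₁ , u₂ , refl = ℕP.<⇒≱ (εL-∋ i (lookup F q) q∋hi) (ℕP.≤-trans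
              (εU (map (cell F) u₁) q (lookup F q) (map (cell F) u₂) (ListP.map-++ _ u₁ (q ∷ u₂)))
              (ℕP.≤-trans (φW-++-≤ i (map (cell F) u₂) ((p , S) ∷ V) zeros) (ℕP.≤-reflexive none)))
            where
            none : φW i ((p , S) ∷ V) ≡ 0
            none = cong₂ ℕ._+_ (φL-∌ i S S∌lo) (ℕP.m≤n⇒m∸n≡0 (ℕP.<⇒≤ φV))
            no-lo : ∀ {x} → x ∈ u₂ → ¬ lookup F x ∋ lo i
            no-lo {x} m x∋lo = go (after sorted u₁ (regroup split) (∈-++⁺ˡ m)) (≺p split (∈-++⁺ʳ u₁ (there m)))
              where
              -- Dual to the case of `f`: below the row of `p` the comparison passes through the box
              -- over `x` in that row, and above it through the box over `p` in the row of `x`,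
              -- which would contain `lo i` against `e-above`.
              go : q ≺ x → x ≺ p → ⊥
              go _ (inj₂ (e , g)) = ℕP.<-asym lo<hi (columns svt (sym e) g S∋hi x∋lo)
              go qx (inj₁ g) with ℕP.<-cmp (row x) (row p)
              go (inj₁ h) (inj₁ g) | tri≈ _ e _ = ℕP.<⇒≱ lo<hi (rows svt (trans er (sym e)) h q∋hi x∋lo)
              go (inj₂ (_ , h)) (inj₁ g) | tri≈ _ e _ = ℕP.<-irrefl (trans e (sym er)) h
              go (inj₂ (_ , h)) (inj₁ g) | tri> _ _ e = ℕP.<-asym e (ℕP.<-≤-trans h (ℕP.≤-reflexive er))
              go (inj₁ h) (inj₁ g) | tri> _ _ e with below-closed x (row p) (col x) (ℕP.<⇒≤ e) ℕP.≤-refl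
              ... | y , ey , cy with occupied svt y
              ...   | b , n = ℕP.<⇒≱ lo<hi (ℕP.≤-trans (rows svt (trans er (sym ey)) (subst (col q <_) (sym cy) h) q∋hi n)
                                (ℕP.<⇒≤ (columns svt cy (subst (_< row x) (sym ey) e) n x∋lo)))
              go qx (inj₁ g) | tri< e _ _ with below-closed p (row x) (col p) (ℕP.<⇒≤ e) ℕP.≤-refl
              ... | y , ey , cy with occupied svt y
              ...   | b , n = e-above cy (subst (_< row p) (sym ey) e) (subst (lookup F y ∋_)
                                (is-lo (rows svt (sym ey) (subst (col x <_) (sym cy) g) x∋lo n)
                                       (columns svt cy (subst (_< row p) (sym ey) e) n S∋hi)) n)
            zeros : ∀ {m R} → (m , R) ∈ map (cell F) u₂ → φL i R ≡ 0
            zeros m∈ with ∈-map⁻ (cell F) m∈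
            ... | x , m , refl = φL-∌ i (lookup F x) (¬∋⇒false {S = lookup F x} (no-lo m))

          e-grow : ∀ {S′} → S′ ∋ lo i → (∀ {a} → S′ ∋ a → S ∋ a ⊎ a ≡ lo i) → SVT (F [ p ]≔ S′)
          e-grow {S′} S′∋ old = update-SVT svt p (lo i , S′∋) left right above below
            where
            left : ∀ {a} → S′ ∋ a → ∀ {q} → row q ≡ row p → col q < col p → ∀ {b} → lookup F q ∋ b → toℕ b ≤ toℕ a
            left m {q} e l n with old m
            ... | inj₁ m′ = rows svt e l n m′
            ... | inj₂ refl = <hi⇒≤lo (ℕP.≤∧≢⇒< (rows svt e l n S∋hi)
                    (λ eq → e-left e l (subst (lookup F q ∋_) (FinP.toℕ-injective eq) n)))
            right : ∀ {a} → S′ ∋ a → ∀ {q} → row q ≡ row p → col p < col q → ∀ {b} → lookup F q ∋ b → toℕ a ≤ toℕ b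
            right m e l n with old m
            ... | inj₁ m′ = rows svt (sym e) l m′ n
            ... | inj₂ refl = ℕP.≤-trans (ℕP.<⇒≤ lo<hi) (rows svt (sym e) l S∋hi n)
            above : ∀ {a} → S′ ∋ a → ∀ {q} → col q ≡ col p → row q < row p → ∀ {b} → lookup F q ∋ b → toℕ b < toℕ a
            above m {q} e l n with old m
            ... | inj₁ m′ = columns svt e l n m′
            ... | inj₂ refl = ℕP.≤∧≢⇒< (<hi⇒≤lo (columns svt e l n S∋hi))
                    (λ eq → e-above e l (subst (lookup F q ∋_) (FinP.toℕ-injective eq) n))
            below : ∀ {a} → S′ ∋ a → ∀ {q} → col q ≡ col p → row p < row q → ∀ {b} → lookup F q ∋ b → toℕ a < toℕ b
            below m e l n with old m
            ... | inj₁ m′ = columns svt (sym e) l m′ n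
            ... | inj₂ refl = ℕP.<-trans lo<hi (columns svt (sym e) l S∋hi n)

      f-closed : ∀ {w} → fW i (read F) ≡ just w → ∃ λ F′ → SVT F′ × w ≡ read F′
      f-closed eq with fW-position i (read F) eq
      ... | u , l , S , S′ , v , eq₁ , refl , fS , φV , εU with map-++⁻ order u eq₁
      ... | us , p , vs , split , refl , refl , refl = F [ p ]≔ S′ , result (fL-change i S fS) , sym (read-update split F S′)
        where
        result : S′ ∋ hi i × Change i S S′ (lo i) (hi i) → SVT (F [ p ]≔ S′)
        result (m , shrink sub) = shrink-SVT svt p (hi i , m) sub
        result (m , grow l h n old) = f-grow split l h φV εU n old

      -- The changed box is kept in the conclusion because `entry≡row⇒highest` needs to know that a
      -- smaller letter has entered a box that held `hi i`.
      e-closed : ∀ {w} → eW i (read F) ≡ just w →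
                 ∃ λ p → ∃ λ S′ → lookup F p ∋ hi i × S′ ∋ lo i × SVT (F [ p ]≔ S′) × w ≡ read (F [ p ]≔ S′)
      e-closed eq with eW-position i (read F) eq
      ... | u , l , S , S′ , v , eq₁ , refl , eS , φV , εU with map-++⁻ order u eq₁
      ... | us , p , vs , split , refl , refl , refl =
        p , S′ , eL-∋hi , proj₁ (eL-change i S eS) , result (eL-change i S eS) , sym (read-update split F S′)
        where
        eL-∋hi : S ∋ hi i
        eL-∋hi with lookup S (hi i) in h
        ... | true = refl
        ... | false with subst (φW i (map (cell F) vs) <_) (εL-∌ i S h) φV
        ...   | ()
        result : S′ ∋ lo i × Change i S S′ (hi i) (lo i) → SVT (F [ p ]≔ S′)
        result (m , shrink sub) = shrink-SVT svt p (lo i , m) sub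
        result (m , grow h l n old) = e-grow split h l φV εU n old

    -- Highest weight tableaux

    module _ {F : Fill} (svt : SVT F) (hw : ∀ i → eW i (read F) ≡ nothing) where

      -- When `e` is sent to the head, the head has positive ε and the result is nonzero. So a
      -- vanishing `e` was sent to the tail and vanishes there.
      suffix-hw : ∀ i (u v : Word {k} {Fin N}) → eW i (u ++ v) ≡ nothing → eW i v ≡ nothing
      suffix-hw i [] v eq = eq
      suffix-hw i ((l , S) ∷ u) v eq = suffix-hw i u v (tail-hw i l S (u ++ v) eq)
        where
        tail-hw : ∀ i l S w → eW i ((l , S) ∷ w) ≡ nothing → eW i w ≡ nothing
        tail-hw i l S w eq with εL i S ℕP.≤? φW i w
        ... | yes le = map-nothing _ (trans (sym (eW-tail i {l} {S} {w} le)) eq)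
        ... | no ¬le with subst (φW i w <_) (eL-nothing i S (map-nothing _ (trans (sym (eW-head i {l} {S} {w} (ℕP.≰⇒> ¬le))) eq))) (ℕP.≰⇒> ¬le)
        ...   | ()

      -- Induction from the end of the reading word. If box `p` holds the letter i + 1, highest
      -- weight forces φ of the rest to be positive, so some later box `x` holds i, and i is at most
      -- the row of `x`. If `x` lies in a higher row this suffices; otherwise the box in the row of
      -- `p` and the column of `x` is read later and bounds the entries of `p`.
      entry≤row : ∀ us vs → order ≡ us ++ vs → ∀ {p} → p ∈ vs → ∀ {a} → lookup F p ∋ a → toℕ a ≤ row p
      entry≤row us (p ∷ vs) split (there m) = entry≤row (us ++ p ∷ []) vs (trans split (sym (ListP.++-assoc us (p ∷ []) vs))) m
      entry≤row us (p ∷ vs) split (here refl) {zero} a∈ = ℕ.z≤n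
      entry≤row us (p ∷ vs) split (here refl) {suc i} a∈ with φW-positive i (map (cell F) vs) pos
        where
        V = map (cell F) vs
        head-hw : eW i ((p , lookup F p) ∷ V) ≡ nothing
        head-hw = suffix-hw i (map (cell F) us) _ (trans (cong (eW i) (trans (sym (ListP.map-++ _ us (p ∷ vs))) (cong (map (cell F)) (sym split)))) (hw i))
        pos : 0 < φW i V
        pos with εL i (lookup F p) ℕP.≤? φW i V
        ... | yes le = ℕP.<-≤-trans (εL-∋ i (lookup F p) a∈) le
        ... | no ¬le with subst (φW i V <_) (eL-nothing i (lookup F p) (map-nothing _ (trans (sym (eW-head i {p} {lookup F p} {V} (ℕP.≰⇒> ¬le))) head-hw))) (ℕP.≰⇒> ¬le)
        ...   | ()
      ... | _ , _ , m , R∋ with ∈-map⁻ (cell F) m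
      ...   | x , x∈ , refl = go (p≺ split x∈)
        where
        later : ∀ {y} → y ∈ vs → ∀ {a} → lookup F y ∋ a → toℕ a ≤ row y
        later = entry≤row (us ++ p ∷ []) vs (trans split (sym (ListP.++-assoc us (p ∷ []) vs)))
        lo≤ : toℕ i ≤ row x
        lo≤ = subst (_≤ row x) (FinP.toℕ-inject₁ i) (later x∈ R∋)
        go : p ≺ x → suc (toℕ i) ≤ row p
        go (inj₂ (_ , g)) = ℕP.≤-trans (ℕ.s≤s lo≤) g
        go (inj₁ g) with row x ℕP.<? row p
        ... | yes h = ℕP.≤-trans (ℕ.s≤s lo≤) h
        ... | no ¬h with below-closed x (row p) (col x) (ℕP.≮⇒≥ ¬h) ℕP.≤-refl
        ...   | y , ey , cy with occupied svt y
        ...     | b , n = ℕP.≤-trans (rows svt (sym ey) (subst (col p <_) (sym cy) g) a∈ n)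
                    (ℕP.≤-trans (later (∈after split (inj₁ (subst (col p <_) (sym cy) g))) n) (ℕP.≤-reflexive ey))

      highest⇒entry≡row : ∀ p {a} → lookup F p ∋ a → toℕ a ≡ row p
      highest⇒entry≡row p m = ℕP.≤-antisym (entry≤row [] order refl (complete p) m) (row≤entry svt p m)

    -- A nonzero `e` would put `lo i` into a box of the row numbered `hi i`, below the bound of
    -- `row≤entry`.
    entry≡row⇒highest : ∀ {F} → SVT F → (∀ p {a} → lookup F p ∋ a → toℕ a ≡ row p) → ∀ i → eW i (read F) ≡ nothing
    entry≡row⇒highest {F} svt top i with eW i (read F) in eq
    ... | nothing = refl
    ... | just w with e-closed svt i eq
    ...   | p , S′ , F∋ , S′∋ , svt′ , _ = ⊥-elim (ℕP.<⇒≱ (LetterOrder.lo<hi i)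
              (subst (_≤ toℕ (lo i)) (sym (top p F∋)) (row≤entry svt′ p (subst (_∋ lo i) (sym (VecP.lookup∘update p F S′)) S′∋))))

-- The pairings of G

lookup-unique : ∀ {A : Set} {xs : List A} → Unique xs → ∀ {p q} → List.lookup xs p ≡ List.lookup xs q → p ≡ q
lookup-unique {xs = x ∷ xs} (_ ∷ u) {zero} {zero} eq = refl
lookup-unique {xs = x ∷ xs} (f ∷ u) {zero} {suc q} eq = ⊥-elim (All.lookup f (∈-lookup {xs = xs} q) eq)
lookup-unique {xs = x ∷ xs} (f ∷ u) {suc p} {zero} eq = ⊥-elim (All.lookup f (∈-lookup {xs = xs} p) (sym eq))
lookup-unique {xs = x ∷ xs} (_ ∷ u) {suc p} {suc q} eq = cong suc (lookup-unique u eq)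

antitone : ∀ {k} (v : Vec ℕ (suc k)) → (∀ (i : Fin k) → lookup v (hi i) ≤ lookup v (lo i)) →
           ∀ a b → toℕ a ≤ toℕ b → lookup v b ≤ lookup v a
antitone v h zero zero l = ℕP.≤-refl
antitone (x ∷ v@(_ ∷ _)) h zero (suc b) l = ℕP.≤-trans (antitone v (λ i → h (suc i)) zero b ℕ.z≤n) (h zero)
antitone (x ∷ v@(_ ∷ _)) h (suc a) (suc b) (ℕ.s≤s l) = antitone v (λ i → h (suc i)) a b l

concatMap-∷-unique : ∀ {A : Set} {n} {xs : List A} {vs : List (Vec A n)} → Unique xs → Unique vs →
                     Unique (concatMap (λ x → map (x ∷_) vs) xs)
concatMap-∷-unique {xs = xs} {vs} ux uv = UniqueP.concat⁺
  (AllP.map⁺ (All.tabulate (λ _ → UniqueP.map⁺ VecP.∷-injectiveʳ uv)))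
  (AllPairsP.map⁺ (AllPairs.map disjoint ux))
  where
  disjoint : ∀ {x y} → x ≢ y → ∀ {v} → v ∈ map (x ∷_) vs × v ∈ map (y ∷_) vs → ⊥
  disjoint ne (m , m′) with ∈-map⁻ _ m | ∈-map⁻ _ m′
  ... | _ , _ , refl | _ , _ , eq = ne (VecP.∷-injectiveˡ eq)

allVecs-unique : ∀ {A : Set} {xs : List A} → Unique xs → ∀ n → Unique (allVecs xs n)
allVecs-unique u zero = [] ∷ []
allVecs-unique u (suc n) = concatMap-∷-unique u (allVecs-unique u n)

allVecs-complete : ∀ {A : Set} {xs : List A} → (∀ x → x ∈ xs) → ∀ {n} (v : Vec A n) → v ∈ allVecs xs n
allVecs-complete c [] = here refl
allVecs-complete {xs = xs} c (x ∷ v) =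
  ∈-concatMap⁺ (λ x → map (x ∷_) (allVecs xs _)) (lose (c x) (∈-map⁺ (x ∷_) (allVecs-complete c v)))

bools-unique : Unique (true ∷ false ∷ [])
bools-unique = ((λ ()) ∷ []) ∷ [] ∷ []

bools-complete : ∀ b → b ∈ (true ∷ false ∷ [])
bools-complete true = here refl
bools-complete false = there (here refl)

nonempty⇒∋ : ∀ {n} (S : Subset n) → T (nonemptyᵇ S) → ∃ λ a → S ∋ a
nonempty⇒∋ (true ∷ S) t = zero , refl
nonempty⇒∋ (false ∷ S) t with nonempty⇒∋ S t
... | a , m = suc a , m

∋⇒nonempty : ∀ {n} (S : Subset n) {a} → S ∋ a → T (nonemptyᵇ S)
∋⇒nonempty (true ∷ S) m = tt
∋⇒nonempty (false ∷ S) {suc a} m = ∋⇒nonempty S m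

wtW-↭ : ∀ {k} {L : Set} {w w′ : Word {k} {L}} → w ↭ w′ → wtW w ≡ wtW w′
wtW-↭ Perm.refl = refl
wtW-↭ (Perm.prep (l , S) p) = cong (indicator S ⊕_) (wtW-↭ p)
wtW-↭ (Perm.swap {xs} {ys} (l , S) (m , R) p) = trans (cong (λ v → indicator S ⊕ (indicator R ⊕ v)) (wtW-↭ p))
  (trans (sym (⊕-assoc (indicator S) (indicator R) (wtW ys)))
    (trans (cong (_⊕ wtW ys) (⊕-comm (indicator S) (indicator R))) (⊕-assoc (indicator R) (indicator S) (wtW ys))))
wtW-↭ (Perm.trans p q) = trans (wtW-↭ p) (wtW-↭ q)

wtW-tabulate : ∀ {k} {L : Set} {N} (F : Vec (Subset (suc k)) N) (l : Fin N → L) →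
               wtW (List.tabulate (λ p → l p , lookup F p)) ≡ wtFilling F
wtW-tabulate [] l = refl
wtW-tabulate (S ∷ F) l = cong (indicator S ⊕_) (wtW-tabulate F (λ p → l (suc p)))

lookup-⊕ : ∀ {k} (u v : Wt k) j → lookup (u ⊕ v) j ≡ lookup u j ℤ.+ lookup v j
lookup-⊕ u v j = VecP.lookup-zipWith ℤ._+_ j u v

lookup-zeroWt : ∀ {k} (j : Fin (suc k)) → lookup (zeroWt {k}) j ≡ 0ℤ
lookup-zeroWt j = VecP.lookup-replicate j 0ℤ

indicator-nonneg : ∀ {k} (S : Subset (suc k)) → NonNeg (indicator S)
indicator-nonneg S j rewrite VecP.lookup-map j (λ b → if b then + 1 else + 0) S with lookup S j
... | true = ℤ.+≤+ ℕ.z≤n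
... | false = ℤ.+≤+ ℕ.z≤n

⊕-nonneg : ∀ {k} (u v : Wt k) → NonNeg u → NonNeg v → NonNeg (u ⊕ v)
⊕-nonneg u v p q j = subst (0ℤ ℤ.≤_) (sym (lookup-⊕ u v j)) (ℤP.+-mono-≤ (p j) (q j))

zeroWt-nonneg : ∀ {k} → NonNeg (zeroWt {k})
zeroWt-nonneg j = ℤP.≤-reflexive (sym (lookup-zeroWt j))

wtFilling-nonneg : ∀ {k L} (F : Vec (Subset (suc k)) L) → NonNeg (wtFilling F)
wtFilling-nonneg [] = zeroWt-nonneg
wtFilling-nonneg (S ∷ F) = ⊕-nonneg (indicator S) (wtFilling F) (indicator-nonneg S) (wtFilling-nonneg F)

∑-const : ∀ {A : Set} z (xs : List A) → ∑ (λ _ → z) xs ≡ + length xs ℤ.* z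
∑-const z [] = sym (ℤP.*-zeroˡ z)
∑-const z (x ∷ xs) = trans (cong (ℤ._+_ z) (∑-const z xs)) (sym (ℤP.suc-* (+ length xs) z))

∑-0 : ∀ {A : Set} (h : A → ℤ) xs → (∀ {x} → x ∈ xs → h x ≡ 0ℤ) → ∑ h xs ≡ 0ℤ
∑-0 h [] z = refl
∑-0 h (x ∷ xs) z = cong₂ ℤ._+_ (z (here refl)) (∑-0 h xs (λ m → z (there m)))

∑-only : ∀ {A : Set} (h : A → ℤ) {xs j} → Unique xs → j ∈ xs → (∀ {x} → x ≢ j → h x ≡ 0ℤ) → ∑ h xs ≡ h j
∑-only h (f ∷ u) (here refl) z =
  trans (cong (ℤ._+_ (h _)) (∑-0 h _ (λ m → z (λ eq → All.lookup f m (sym eq))))) (ℤP.+-identityʳ _)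
∑-only h (f ∷ u) (there m) z =
  trans (cong₂ ℤ._+_ (z (All.lookup f m)) (∑-only h u m z)) (ℤP.+-identityˡ _)

singleton : ∀ {n} → ℕ → Subset n
singleton r = Vec.tabulate (λ a → toℕ a ≡ᵇ r)

singleton-∋ : ∀ {n} r {a : Fin n} → toℕ a ≡ r → singleton r ∋ a
singleton-∋ r {a} refl = trans (VecP.lookup∘tabulate (λ a → toℕ a ≡ᵇ r) a) (Equivalence.to BoolP.T-≡ (ℕP.≡⇒≡ᵇ (toℕ a) r refl))

∋-singleton : ∀ {n} r {a : Fin n} → singleton r ∋ a → toℕ a ≡ r
∋-singleton r {a} m = ℕP.≡ᵇ⇒≡ (toℕ a) r (subst T (sym (trans (sym (VecP.lookup∘tabulate (λ a → toℕ a ≡ᵇ r) a)) m)) tt)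

≡-singleton : ∀ {n} r (S : Subset n) → (∃ λ a → S ∋ a) → (∀ {a} → S ∋ a → toℕ a ≡ r) → S ≡ singleton r
≡-singleton r S (b , b∈) h = trans (sym (VecP.tabulate∘lookup S)) (VecP.tabulate-cong same)
  where
  same : ∀ a → lookup S a ≡ (toℕ a ≡ᵇ r)
  same a with toℕ a ≡ᵇ r in eq
  ... | true = subst (S ∋_) (FinP.toℕ-injective (trans (h b∈) (sym (ℕP.≡ᵇ⇒≡ (toℕ a) r (subst T (sym eq) tt))))) b∈
  ... | false = ¬∋⇒false {S = S} λ m → subst T eq (ℕP.≡⇒≡ᵇ (toℕ a) r (h m))

module Shape {k : ℕ} (λ′ : Vec ℕ (suc k)) (mono : ∀ (i : Fin k) → lookup λ′ (hi i) ≤ lookup λ′ (lo i)) where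

  N : ℕ
  N = length (boxes λ′)

  row col : Fin N → ℕ
  row p = proj₁ (List.lookup (boxes λ′) p)
  col p = proj₂ (List.lookup (boxes λ′) p)

  rowBoxes : Fin (suc k) → List (ℕ × ℕ)
  rowBoxes r = map (λ c → (toℕ r , c)) (upTo (lookup λ′ r))

  boxes-unique : Unique (boxes λ′)
  boxes-unique = UniqueP.concat⁺
    (AllP.map⁺ (All.tabulate (λ {r} _ → UniqueP.map⁺ (λ eq → cong proj₂ eq) (UniqueP.upTo⁺ (lookup λ′ r)))))
    (AllPairsP.map⁺ (AllPairs.map disjoint (UniqueP.allFin⁺ (suc k))))
    where
    disjoint : ∀ {r s} → r ≢ s → ∀ {b} → b ∈ rowBoxes r × b ∈ rowBoxes s → ⊥
    disjoint ne (m , m′) with ∈-map⁻ _ m | ∈-map⁻ _ m′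
    ... | _ , _ , refl | _ , _ , eq = ne (FinP.toℕ-injective (cong proj₁ eq))

  box-injective : ∀ {p q} → row p ≡ row q → col p ≡ col q → p ≡ q
  box-injective e e′ = lookup-unique boxes-unique (cong₂ _,_ e e′)

  box-of : ∀ p → ∃ λ (r : Fin (suc k)) → row p ≡ toℕ r × col p < lookup λ′ r
  box-of p with find (∈-concatMap⁻ rowBoxes {xs = allFin (suc k)} (∈-lookup {xs = boxes λ′} p))
  ... | r , _ , m with ∈-map⁻ _ m
  ... | c , c∈ , eq = r , cong proj₁ eq , subst (_< lookup λ′ r) (sym (cong proj₂ eq)) (∈-upTo⁻ c∈)

  box-at : ∀ r {c} → c < lookup λ′ r → ∃ λ p → row p ≡ toℕ r × col p ≡ c
  box-at r {c} l = Any.index m , cong proj₁ (sym eq) , cong proj₂ (sym eq)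
    where
    m : (toℕ r , c) ∈ boxes λ′
    m = ∈-concatMap⁺ rowBoxes {xs = allFin (suc k)} (lose (∈-allFin r) (∈-map⁺ _ (∈-upTo⁺ l)))
    eq : (toℕ r , c) ≡ List.lookup (boxes λ′) (Any.index m)
    eq = AnyP.lookup-index m

  below-closed : ∀ p r c → r ≤ row p → c ≤ col p → ∃ λ q → row q ≡ r × col q ≡ c
  below-closed p r c r≤ c≤ with box-of p
  ... | s , es , l with box-at r′ {c} (ℕP.≤-<-trans c≤ (ℕP.<-≤-trans l (antitone λ′ mono r′ s
                          (ℕP.≤-trans (ℕP.≤-reflexive (FinP.toℕ-fromℕ< r<)) (ℕP.≤-trans r≤ (ℕP.≤-reflexive es))))))
    where
    r< : r < suc k
    r< = ℕP.≤-<-trans (ℕP.≤-trans r≤ (ℕP.≤-reflexive es)) (FinP.toℕ<n s)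
    r′ = fromℕ< r<
  ... | q , eq , ec = q , trans eq (FinP.toℕ-fromℕ< _) , ec

  open Tableaux {k} {N} row col box-injective below-closed

  -- Lexicographic with the rows reversed. It is reflexive, so the strict `_≺_` between successive
  -- boxes also relies on the boxes being distinct.
  readingOrder : DecTotalOrder _ _ _
  readingOrder = On.decTotalOrder (×-decTotalOrder ℕP.≤-decTotalOrder (Flip.decTotalOrder ℕP.≤-decTotalOrder))
                                  (λ (p : Fin N) → col p , row p)

  open Data.List.Sort readingOrder using (sort-↭; sort-↗) renaming (sort to arrange)

  order : List (Fin N)
  order = arrange (allFin N)

  complete : ∀ p → p ∈ order
  complete p = ∈-resp-↭ (↭-sym (sort-↭ (allFin N))) (∈-allFin p)

  order-unique : Unique order
  order-unique = PermS.Unique-resp-↭ (setoid (Fin N)) (↭⇒↭ₛ (↭-sym (sort-↭ (allFin N)))) (UniqueP.allFin⁺ N)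

  sorted : AllPairs _≺_ order
  sorted = AllPairs.zipWith strict (order-unique , Linked⇒AllPairs (DecTotalOrder.trans readingOrder) (sort-↗ (allFin N)))
    where
    strict : ∀ {p q} → p ≢ q × DecTotalOrder._≤_ readingOrder p q → p ≺ q
    strict (ne , inj₁ (l , c≢)) = inj₁ (ℕP.≤∧≢⇒< l c≢)
    strict {p} {q} (ne , inj₂ (e , l)) = inj₂ (e , ℕP.≤∧≢⇒< l (λ er → ne (box-injective (sym er) e)))

  open Reading order complete sorted

  fromIsSVT : ∀ {F} → IsSVT λ′ F → SVT F
  fromIsSVT {F} (ne , rw , cl) = record
    { occupied = λ p → nonempty⇒∋ (lookup F p) (ne p)
    ; rows = λ {p} {q} e l m m′ → rw p q e l _ _ (VecP.lookup⇒[]= _ _ m) (VecP.lookup⇒[]= _ _ m′)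
    ; columns = λ {p} {q} e l m m′ → cl p q e l _ _ (VecP.lookup⇒[]= _ _ m) (VecP.lookup⇒[]= _ _ m′)
    }

  toIsSVT : ∀ {F} → SVT F → IsSVT λ′ F
  toIsSVT {F} svt = (λ p → ∋⇒nonempty (lookup F p) (proj₂ (SVT.occupied svt p)))
    , (λ p q e l a b m m′ → SVT.rows svt e l (VecP.[]=⇒lookup m) (VecP.[]=⇒lookup m′))
    , (λ p q e l a b m m′ → SVT.columns svt e l (VecP.[]=⇒lookup m) (VecP.[]=⇒lookup m′))

  ∈SVTs⁺ : ∀ {F} → SVT F → F ∈ SVTs λ′
  ∈SVTs⁺ {F} svt = ∈-filter⁺ (IsSVT? λ′) (allVecs-complete (allVecs-complete bools-complete) F) (toIsSVT svt)

  ∈SVTs⁻ : ∀ {F} → F ∈ SVTs λ′ → SVT F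
  ∈SVTs⁻ m = fromIsSVT (proj₂ (∈-filter⁻ (IsSVT? λ′) {xs = allVecs (allSubsets (suc k)) N} m))

  tableaux : List (Word {k} {Fin N})
  tableaux = map read (SVTs λ′)

  read-injective : ∀ {F F′} → read F ≡ read F′ → F ≡ F′
  read-injective {F} {F′} eq = trans (sym (VecP.tabulate∘lookup F))
    (trans (VecP.tabulate-cong same) (VecP.tabulate∘lookup F′))
    where
    agree : ∀ {xs} → map (cell F) xs ≡ map (cell F′) xs → ∀ {p} → p ∈ xs → lookup F p ≡ lookup F′ p
    agree e (here refl) = cong proj₂ (ListP.∷-injectiveˡ e)
    agree e (there m) = agree (ListP.∷-injectiveʳ e) m
    same : ∀ p → lookup F p ≡ lookup F′ p
    same p = agree eq (complete p)

  tableaux-unique : Unique tableaux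
  tableaux-unique = UniqueP.map⁺ read-injective (UniqueP.filter⁺ (IsSVT? λ′)
    (allVecs-unique (allVecs-unique bools-unique (suc k)) N))

  ∈tableaux⁺ : ∀ {F w} → SVT F → w ≡ read F → w ∈ tableaux
  ∈tableaux⁺ svt e = subst (_∈ tableaux) (sym e) (∈-map⁺ read (∈SVTs⁺ svt))

  ∈tableaux⁻ : ∀ {w} → w ∈ tableaux → ∃ λ F → SVT F × w ≡ read F
  ∈tableaux⁻ m = from (∈-map⁻ read m)
    where
    from : ∀ {w} → (∃ λ F → F ∈ SVTs λ′ × w ≡ read F) → ∃ λ F → SVT F × w ≡ read F
    from (F , F∈ , e) = F , ∈SVTs⁻ F∈ , e

  tableaux-f : ∀ i {w w′} → w ∈ tableaux → fW i w ≡ just w′ → w′ ∈ tableaux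
  tableaux-f i {w′ = w′} m eq = start (∈tableaux⁻ m) eq
    where
    finish : (∃ λ F′ → SVT F′ × w′ ≡ read F′) → w′ ∈ tableaux
    finish (F′ , svt , e) = ∈tableaux⁺ svt e
    start : ∀ {w} → (∃ λ F → SVT F × w ≡ read F) → fW i w ≡ just w′ → w′ ∈ tableaux
    start (F , svt , e) eq = finish (f-closed svt i (trans (cong (fW i) (sym e)) eq))

  tableaux-e : ∀ i {w w′} → w ∈ tableaux → eW i w ≡ just w′ → w′ ∈ tableaux
  tableaux-e i {w′ = w′} m eq = start (∈tableaux⁻ m) eq
    where
    start : ∀ {w} → (∃ λ F → SVT F × w ≡ read F) → eW i w ≡ just w′ → w′ ∈ tableaux
    start (F , svt , e) eq = finish (e-closed svt i (trans (cong (eW i) (sym e)) eq))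
      where
      finish : (∃ λ p → ∃ λ S′ → lookup F p ∋ hi i × S′ ∋ lo i × SVT (F [ p ]≔ S′) × w′ ≡ read (F [ p ]≔ S′)) → w′ ∈ tableaux
      finish (_ , _ , _ , _ , svt′ , e′) = ∈tableaux⁺ svt′ e′

  wt-read : ∀ F → wtW (read F) ≡ wtFilling F
  wt-read F = trans (wtW-↭ (map⁺ (cell F) (sort-↭ (allFin N))))
    (trans (cong wtW (ListP.map-tabulate (λ p → p) (cell F))) (wtW-tabulate F (λ p → p)))

  weights : map wtW tableaux ≡ G λ′
  weights = trans (sym (ListP.map-∘ (SVTs λ′))) (ListP.map-cong wt-read (SVTs λ′))

  superstandard : Filling λ′
  superstandard = Vec.tabulate (λ p → singleton (row p))

  superstandard-entry : ∀ p {a} → lookup superstandard p ∋ a → toℕ a ≡ row p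
  superstandard-entry p m = ∋-singleton (row p) (subst (_∋ _) (VecP.lookup∘tabulate _ p) m)

  superstandard-SVT : SVT superstandard
  superstandard-SVT = record
    { occupied = λ p → proj₁ (box-of p) , subst (_∋ proj₁ (box-of p)) (sym (VecP.lookup∘tabulate _ p))
        (singleton-∋ (row p) (sym (proj₁ (proj₂ (box-of p)))))
    ; rows = λ {p} {q} e l m m′ → ℕP.≤-reflexive (trans (superstandard-entry p m) (trans e (sym (superstandard-entry q m′))))
    ; columns = λ {p} {q} e l m m′ → subst₂ _<_ (sym (superstandard-entry p m)) (sym (superstandard-entry q m′)) l
    }

  HW? : ∀ (w : Word {k} {Fin N}) → Dec (IsHW (Words k (Fin N)) w)
  HW? = IsHW? (Words k (Fin N))

  only-superstandard : filter HW? tableaux ↭ read superstandard ∷ []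
  only-superstandard = unique-↭ (UniqueP.filter⁺ HW? tableaux-unique) ([] ∷ []) to from
    where
    to : ∀ {w} → w ∈ filter HW? tableaux → w ∈ read superstandard ∷ []
    to m = unpack (∈tableaux⁻ (proj₁ (∈-filter⁻ HW? {xs = tableaux} m))) (proj₂ (∈-filter⁻ HW? {xs = tableaux} m))
      where
      unpack : ∀ {w} → (∃ λ F → SVT F × w ≡ read F) → IsHW (Words k (Fin N)) w → w ∈ read superstandard ∷ []
      unpack (F , svt , e) hw = here (trans e (cong read (trans (sym (VecP.tabulate∘lookup F)) (VecP.tabulate-cong λ p →
        ≡-singleton (row p) (lookup F p) (SVT.occupied svt p)
          (highest⇒entry≡row svt (λ i → trans (cong (eW i) (sym e)) (hw i)) p)))))
    from : ∀ {w} → w ∈ read superstandard ∷ [] → w ∈ filter HW? tableaux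
    from (here refl) = ∈-filter⁺ HW? (∈-map⁺ read (∈SVTs⁺ superstandard-SVT))
      (entry≡row⇒highest superstandard-SVT superstandard-entry)

  wtFilling-tabulate : ∀ (h : ℕ × ℕ → Subset (suc k)) bs j →
    lookup (wtFilling (Vec.tabulate (λ p → h (List.lookup bs p)))) j ≡ ∑ (λ b → lookup (indicator (h b)) j) bs
  wtFilling-tabulate h [] j = lookup-zeroWt j
  wtFilling-tabulate h (b ∷ bs) j = trans (lookup-⊕ (indicator (h b)) _ j) (cong (ℤ._+_ (lookup (indicator (h b)) j)) (wtFilling-tabulate h bs j))

  wt-superstandard : wtFilling superstandard ≡ Vec.map +_ λ′
  wt-superstandard = trans (sym (VecP.tabulate∘lookup _)) (trans (VecP.tabulate-cong coordinate) (VecP.tabulate∘lookup _))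
    where
    entry : Fin (suc k) → ℕ → ℤ
    entry j r = lookup (indicator (singleton {suc k} r)) j
    entry-same : ∀ j → entry j (toℕ j) ≡ 1ℤ
    entry-same j = trans (VecP.lookup-map j _ (singleton (toℕ j))) (cong (if_then + 1 else + 0) (singleton-∋ (toℕ j) {j} refl))
    entry-other : ∀ j {r : Fin (suc k)} → r ≢ j → entry j (toℕ r) ≡ 0ℤ
    entry-other j {r} ne = trans (VecP.lookup-map j _ (singleton (toℕ r)))
      (cong (if_then + 1 else + 0) (¬∋⇒false {S = singleton (toℕ r)} {j} (λ m → ne (sym (FinP.toℕ-injective (∋-singleton (toℕ r) {j} m))))))
    rowSum : ∀ j r → ∑ (λ b → entry j (proj₁ b)) (rowBoxes r) ≡ + lookup λ′ r ℤ.* entry j (toℕ r)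
    rowSum j r = trans (∑-map (λ b → entry j (proj₁ b)) (λ c → toℕ r , c) (upTo (lookup λ′ r)))
      (trans (∑-const (entry j (toℕ r)) (upTo (lookup λ′ r))) (cong (λ n → + n ℤ.* entry j (toℕ r)) (ListP.length-upTo (lookup λ′ r))))
    coordinate : ∀ j → lookup (wtFilling superstandard) j ≡ lookup (Vec.map +_ λ′) j
    coordinate j = trans (wtFilling-tabulate (λ b → singleton (proj₁ b)) (boxes λ′) j)
      (trans (∑-concatMap (λ b → entry j (proj₁ b)) rowBoxes (allFin (suc k)))
      (trans (∑-cong (allFin (suc k)) (λ {r} _ → rowSum j r))
      (trans (∑-only (λ r → + lookup λ′ r ℤ.* entry j (toℕ r)) (UniqueP.allFin⁺ (suc k)) (∈-allFin j)
                 (λ {r} ne → trans (cong (ℤ._*_ (+ lookup λ′ r)) (entry-other j ne)) (ℤP.*-zeroʳ (+ lookup λ′ r))))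
      (trans (cong (ℤ._*_ (+ lookup λ′ j)) (entry-same j)) (trans (ℤP.*-identityʳ _) (sym (VecP.lookup-map j +_ λ′)))))))

  G-symmetric : ∀ i → map (swapAt i) (G λ′) ↭ G λ′
  G-symmetric i = subst (λ M → map (swapAt i) M ↭ M) weights
    (character-symmetric words-crystal tableaux-unique tableaux-e tableaux-f i)

  G-sum : ∀ g → Antisym g → ∑ (λ α → K 0 α g) (G λ′) ≡ K 0 (Vec.map +_ λ′) g
  G-sum g anti = trans (cong (∑ (λ α → K 0 α g)) (sym weights)) (trans (∑-map (λ α → K 0 α g) wtW tableaux)
    (trans (highest-weight-sum words-crystal tableaux-unique tableaux-e tableaux-f
               sel (λ {w} → sel-nothing w) (λ {w} → sel-just w) (λ {w} → sel-f w) (λ {w} → sel-e w) {g} anti)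
    (trans (∑-↭ (λ w → K 0 (wtW w) g) only-superstandard)
    (trans (ℤP.+-identityʳ _) (cong (λ v → K 0 v g) (trans (wt-read superstandard) wt-superstandard))))))

  G-nonneg : ∀ {α} → α ∈ G λ′ → NonNeg α
  G-nonneg {α} m = from (∈-map⁻ wtFilling m)
    where
    from : (∃ λ F → F ∈ SVTs λ′ × α ≡ wtFilling F) → NonNeg α
    from (F , _ , e) = subst NonNeg (sym e) (wtFilling-nonneg F)

-- Normal crystals

-- An element of `S` makes the check in `mkSS` succeed. Comparing after `proj₁` keeps nonemptiness
-- proofs out of all later equations.
mkSS-∋ : ∀ {n} (S : Subset n) {a} → S ∋ a → mapMaybe proj₁ (mkSS S) ≡ just S
mkSS-∋ S {a} m with T? (nonemptyᵇ S)
... | yes _ = refl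
... | no empty = ⊥-elim (empty (∋⇒nonempty S {a} m))

update-lo : ∀ {k} (i : Fin k) S {a b} → getAt i S ≡ (a , b) → ∀ c → S [ lo i ]≔ c ≡ setAt i (c , b) S
update-lo zero (_ ∷ _ ∷ S) refl c = refl
update-lo (suc i) (a ∷ S) g c = cong (a ∷_) (update-lo i S g c)

update-hi : ∀ {k} (i : Fin k) S {a b} → getAt i S ≡ (a , b) → ∀ c → S [ hi i ]≔ c ≡ setAt i (a , c) S
update-hi zero (_ ∷ _ ∷ S) refl c = refl
update-hi (suc i) (a ∷ S) g c = cong (a ∷_) (update-hi i S g c)

lo≢hi : ∀ {k} (i : Fin k) → lo i ≢ hi i
lo≢hi (suc i) eq = lo≢hi i (FinP.suc-injective eq)

module _ {k : ℕ} (i : Fin k) where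

  mkSS-lo : ∀ S {a b} c → getAt i S ≡ (a , b) → b ≡ true ⊎ c ≡ true → mapMaybe proj₁ (mkSS (S [ lo i ]≔ c)) ≡ just (setAt i (c , b) S)
  mkSS-lo S c g ne = trans (occupied ne) (cong just (update-lo i S g c))
    where
    occupied : _ → mapMaybe proj₁ (mkSS (S [ lo i ]≔ c)) ≡ just (S [ lo i ]≔ c)
    occupied (inj₁ b) = mkSS-∋ (S [ lo i ]≔ c) {hi i} (trans (VecP.lookup∘update′ (λ eq → lo≢hi i (sym eq)) S c)
      (trans (cong proj₂ (trans (sym (getAt-lookup i S)) g)) b))
    occupied (inj₂ refl) = mkSS-∋ (S [ lo i ]≔ c) {lo i} (VecP.lookup∘update (lo i) S c)

  mkSS-hi : ∀ S {a b} c → getAt i S ≡ (a , b) → a ≡ true ⊎ c ≡ true → mapMaybe proj₁ (mkSS (S [ hi i ]≔ c)) ≡ just (setAt i (a , c) S)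
  mkSS-hi S c g ne = trans (occupied ne) (cong just (update-hi i S g c))
    where
    occupied : _ → mapMaybe proj₁ (mkSS (S [ hi i ]≔ c)) ≡ just (S [ hi i ]≔ c)
    occupied (inj₁ a) = mkSS-∋ (S [ hi i ]≔ c) {lo i} (trans (VecP.lookup∘update′ (lo≢hi i) S c)
      (trans (cong proj₁ (trans (sym (getAt-lookup i S)) g)) a))
    occupied (inj₂ refl) = mkSS-∋ (S [ hi i ]≔ c) {hi i} (VecP.lookup∘update (hi i) S c)

  eSS-eL : ∀ S → mapMaybe proj₁ (eSS i S) ≡ eL i (proj₁ S)
  eSS-eL (S , _) with lookup S (lo i) | lookup S (hi i) | getAt-lookup i S
  ... | false | true | g = trans (mkSS-lo S true g (inj₂ refl)) (sym (cong (λ p → mapMaybe (λ q → setAt i q S) (e₂ p)) g))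
  ... | true | true | g = trans (mkSS-hi S false g (inj₁ refl)) (sym (cong (λ p → mapMaybe (λ q → setAt i q S) (e₂ p)) g))
  ... | true | false | g = sym (cong (λ p → mapMaybe (λ q → setAt i q S) (e₂ p)) g)
  ... | false | false | g = sym (cong (λ p → mapMaybe (λ q → setAt i q S) (e₂ p)) g)

  fSS-fL : ∀ S → mapMaybe proj₁ (fSS i S) ≡ fL i (proj₁ S)
  fSS-fL (S , _) with lookup S (lo i) | lookup S (hi i) | getAt-lookup i S
  ... | true | false | g = trans (mkSS-hi S true g (inj₂ refl)) (sym (cong (λ p → mapMaybe (λ q → setAt i q S) (f₂ p)) g))
  ... | true | true | g = trans (mkSS-lo S false g (inj₁ refl)) (sym (cong (λ p → mapMaybe (λ q → setAt i q S) (f₂ p)) g))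
  ... | false | true | g = sym (cong (λ p → mapMaybe (λ q → setAt i q S) (f₂ p)) g)
  ... | false | false | g = sym (cong (λ p → mapMaybe (λ q → setAt i q S) (f₂ p)) g)

  εL≤2 : ∀ S → εL i S ≤ 2
  εL≤2 S with getAt i S
  ... | true , true = ℕ.s≤s ℕ.z≤n
  ... | true , false = ℕ.z≤n
  ... | false , true = ℕP.≤-refl
  ... | false , false = ℕ.z≤n

  φL≤2 : ∀ S → φL i S ≤ 2
  φL≤2 S with getAt i S
  ... | true , true = ℕ.s≤s ℕ.z≤n
  ... | true , false = ℕP.≤-refl
  ... | false , true = ℕ.z≤n
  ... | false , false = ℕ.z≤n

m+m≤4^m : ∀ m → m ℕ.+ m ≤ 4 ^ m
m+m≤4^m zero = ℕ.z≤n
m+m≤4^m (suc m) = subst (_≤ 4 ^ suc m) (cong suc (sym (ℕP.+-suc m m)))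
  (ℕP.+-mono-≤ (ℕP.m^n>0 4 m) (ℕP.+-mono-≤ (ℕP.m^n>0 4 m) (ℕP.≤-trans (m+m≤4^m m) (ℕP.m≤m+n (4 ^ m) _))))

-- Each of the m letters adds at most 2 to `φ`. The existence of `i` means at least two coordinates,
-- so the base of the fuel is at least 4.
m+m≤fuel : ∀ {k} (i : Fin k) m → m ℕ.+ m ≤ fuel k m
m+m≤fuel {suc k} i m = ℕP.≤-trans (m+m≤4^m m) (ℕP.^-monoˡ-≤ m (ℕP.^-monoʳ-≤ 2 (ℕ.s≤s (ℕ.s≤s (ℕ.z≤n {k})))))

map-map : ∀ {A B C : Set} (g : B → C) (h : A → B) m → mapMaybe g (mapMaybe h m) ≡ mapMaybe (λ x → g (h x)) m
map-map g h (just x) = refl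
map-map g h nothing = refl

module _ {k : ℕ} where

  word : ∀ {m} → Vec (SSel (suc k)) m → Word {k} {⊤}
  word [] = []
  word (S ∷ w) = (tt , proj₁ S) ∷ word w

  wt-word : ∀ m (w : Vec (SSel (suc k)) m) → wtW (word w) ≡ wtT m w
  wt-word zero [] = refl
  wt-word (suc m) (S ∷ w) = cong (wtSS S ⊕_) (wt-word m w)

  module _ (i : Fin k) where

    φW-word≤ : ∀ {m} (w : Vec (SSel (suc k)) m) → φW i (word w) ≤ m ℕ.+ m
    φW-word≤ [] = ℕ.z≤n
    φW-word≤ {suc m} (S ∷ w) = subst (φW i (word (S ∷ w)) ≤_) (cong suc (sym (ℕP.+-suc m m)))
      (ℕP.+-mono-≤ (φL≤2 i (proj₁ S)) (ℕP.≤-trans (ℕP.m∸n≤m _ (εL i (proj₁ S))) (φW-word≤ w)))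

    εSS≡ : ∀ S → εSS i S ≡ εL i (proj₁ S)
    εSS≡ S = count-measure (λ S → εL i (proj₁ S))
      (λ S eq → eL-nothing i (proj₁ S) (trans (sym (eSS-eL i S)) (cong (mapMaybe proj₁) eq)))
      (λ S {S′} eq → proj₂ (proj₂ (fL-just i (proj₁ S′) (eL-just i (proj₁ S) (trans (sym (eSS-eL i S)) (cong (mapMaybe proj₁) eq))))))
      (fuel k 1) S (ℕP.≤-trans (εL≤2 i (proj₁ S)) (m+m≤fuel i 1))

    if-map : ∀ {A : Set} (b : Bool) (T₁ T₂ : Maybe A) {C : Set} (h : A → C) →
             mapMaybe h (if b then T₁ else T₂) ≡ (if b then mapMaybe h T₁ else mapMaybe h T₂)
    if-map true _ _ _ = refl
    if-map false _ _ _ = refl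

    mutual
      -- Proved together with `φT-word`: at length m + 1 the rule consults `φT` at length m, which
      -- in turn counts steps of `fT` at that length.
      fT-word : ∀ m w → mapMaybe word (fT m i w) ≡ fW i (word w)
      fT-word zero [] = refl
      fT-word (suc m) (S ∷ w) = trans
        (cong₂ (λ a b → mapMaybe word (if a <ᵇ b then mapMaybe (S ∷_) (fT m i w) else mapMaybe (_∷ w) (fSS i S))) (εSS≡ S) (φT-word m w))
        (trans (if-map (εL i (proj₁ S) <ᵇ φW i (word w)) _ _ word)
          (cong₂ (λ x y → if εL i (proj₁ S) <ᵇ φW i (word w) then x else y)
            (trans (map-map word (S ∷_) (fT m i w)) (trans (sym (map-map ((tt , proj₁ S) ∷_) word (fT m i w))) (cong (mapMaybe _) (fT-word m w))))
            (trans (map-map word (_∷ w) (fSS i S)) (trans (sym (map-map (λ S′ → (tt , S′) ∷ word w) proj₁ (fSS i S))) (cong (mapMaybe _) (fSS-fL i S))))))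

      φT-word : ∀ m w → φT m i w ≡ φW i (word w)
      φT-word m w = count-measure (λ w → φW i (word w))
        (λ w eq → fW-nothing i (word w) (trans (sym (fT-word m w)) (cong (mapMaybe word) eq)))
        (λ w eq → proj₁ (proj₂ (fW-just i (word w) (trans (sym (fT-word m w)) (cong (mapMaybe word) eq)))))
        (fuel k m) w (ℕP.≤-trans (φW-word≤ w) (m+m≤fuel i m))

    eT-word : ∀ m w → mapMaybe word (eT m i w) ≡ eW i (word w)
    eT-word zero [] = refl
    eT-word (suc m) (S ∷ w) = trans
      (cong₂ (λ a b → mapMaybe word (if a ≤ᵇ b then mapMaybe (S ∷_) (eT m i w) else mapMaybe (_∷ w) (eSS i S))) (εSS≡ S) (φT-word m w))
      (trans (if-map (εL i (proj₁ S) ≤ᵇ φW i (word w)) _ _ word)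
        (cong₂ (λ x y → if εL i (proj₁ S) ≤ᵇ φW i (word w) then x else y)
          (trans (map-map word (S ∷_) (eT m i w)) (trans (sym (map-map ((tt , proj₁ S) ∷_) word (eT m i w))) (cong (mapMaybe _) (eT-word m w))))
          (trans (map-map word (_∷ w) (eSS i S)) (trans (sym (map-map (λ S′ → (tt , S′) ∷ word w) proj₁ (eSS i S))) (cong (mapMaybe _) (eSS-eL i S))))))

-- Representatives of connected components

module _ {A : Set} (_≟_ : (x y : A) → Dec (x ≡ y)) where

  merge : A → A → A → A
  merge b c x with x ≟ b
  ... | yes _ = c
  ... | no _ = x

  -- Components are merged edge by edge: each new edge gives the whole class of `b` the colour of
  -- `c`. The colour is itself a member of the class, so a representative is computed without
  -- deciding connectedness.
  colour : List (A × A) → A → A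
  colour [] x = x
  colour ((b , c) ∷ E) x = merge (colour E b) (colour E c) (colour E x)

  colour-edge : ∀ E {b c} → (b , c) ∈ E → colour E b ≡ colour E c
  colour-edge ((b , c) ∷ E) (there m) = cong (merge (colour E b) (colour E c)) (colour-edge E m)
  colour-edge ((b , c) ∷ E) (here refl) = trans (merged (colour E b)) (sym (fixed (colour E b) (colour E c)))
    where
    merged : ∀ x {y} → merge x y x ≡ y
    merged x with x ≟ x
    ... | yes _ = refl
    ... | no ne = ⊥-elim (ne refl)
    fixed : ∀ x y → merge x y y ≡ y
    fixed x y with y ≟ x
    ... | yes _ = refl
    ... | no _ = refl

  colour-related : ∀ {R : A → A → Set} E → (∀ {b c} → (b , c) ∈ E → R b c) → ∀ x → EqC.EqClosure R (colour E x) x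
  colour-related [] r x = done
  colour-related {R} ((b , c) ∷ E) r x with colour E x ≟ colour E b
  ... | no _ = colour-related E (λ m → r (there m)) x
  ... | yes eq = related c ◅◅ (bwd (r (here refl)) ◅ EqC.symmetric R (related b)) ◅◅ subst (λ y → EqC.EqClosure R y x) eq (related x)
    where
    related = colour-related {R} E (λ m → r (there m))

-- The character of a finite normal crystal

module _ {k : ℕ} (B : RawCrystal k) (fin : Finite (Carrier B)) (isC : IsCrystal B) (normal : IsNormal B) where

  open Inverse (proj₂ fin) using (inverseˡ; inverseʳ) renaming (to to point; from to label)

  xs : List (Carrier B)
  xs = elements fin

  label-injective : ∀ {x y} → label x ≡ label y → x ≡ y
  label-injective eq = trans (sym (inverseˡ refl)) (trans (cong point eq) (inverseˡ refl))

  xs-unique : Unique xs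
  xs-unique = UniqueP.map⁺ (λ eq → trans (sym (inverseʳ refl)) (trans (cong label eq) (inverseʳ refl))) (UniqueP.allFin⁺ (proj₁ fin))

  ∈xs : ∀ b → b ∈ xs
  ∈xs b = subst (_∈ xs) (inverseˡ refl) (∈-map⁺ point (∈-allFin (label b)))

  _≟ᵇ_ : (x y : Carrier B) → Dec (x ≡ y)
  x ≟ᵇ y = map′ label-injective (cong label) (label x FinP.≟ label y)

  target : Carrier B → Maybe (Carrier B) → List (Carrier B × Carrier B)
  target b nothing = []
  target b (just c) = (b , c) ∷ []

  out : Carrier B → List (Carrier B × Carrier B)
  out b = concatMap (λ i → target b (f B i b)) (allFin k)

  edges : List (Carrier B × Carrier B)
  edges = concatMap out xs

  ∈edges⁺ : ∀ i {b c} → f B i b ≡ just c → (b , c) ∈ edges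
  ∈edges⁺ i {b} {c} eq = ∈-concatMap⁺ out {xs = xs} (lose (∈xs b)
    (∈-concatMap⁺ (λ i → target b (f B i b)) {xs = allFin k} (lose (∈-allFin i) (subst (λ m → (b , c) ∈ target b m) (sym eq) (here refl)))))

  ∈edges⁻ : ∀ {b c} → (b , c) ∈ edges → Edge B b c
  ∈edges⁻ m with find (∈-concatMap⁻ out {xs = xs} m)
  ... | b′ , _ , m′ with find (∈-concatMap⁻ (λ i → target b′ (f B i b′)) {xs = allFin k} m′)
  ... | i , _ , m″ with f B i b′ in eq
  ∈edges⁻ m | b′ , _ , m′ | i , _ , here refl | just c = i , eq

  -- A fixed representative of the component of each element, so that the
  -- embeddings into tensor powers can be chosen uniformly on each component.
  rep : Carrier B → Carrier B
  rep = colour _≟ᵇ_ edges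

  rep-conn : ∀ b → Conn B (rep b) b
  rep-conn = colour-related _≟ᵇ_ edges ∈edges⁻

  iso : ∀ b → ComponentIso B (rep b) (SSpow k (proj₁ (normal (rep b)))) (proj₁ (proj₂ (normal (rep b))))
  iso b = proj₂ (proj₂ (normal (rep b)))

  image : ∀ b → Vec (SSel (suc k)) (proj₁ (normal (rep b)))
  image b = ComponentIso.to (iso b) b

  -- The representative is a separate argument so that an element and its neighbours can be sent
  -- through literally the same map; `same-rep` then returns to `ω`.
  embed : Carrier B → Carrier B → Word {k} {⊤}
  embed r b = word (ComponentIso.to (proj₂ (proj₂ (normal r))) b)

  -- Different components may have the same image. The map serves to pull back the choice `sel` and
  -- the non-negativity of weights, for which compatibility with weights and operators is enough.
  ω : Carrier B → Word {k} {⊤}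
  ω b = embed (rep b) b

  ω-wt : ∀ b → wtW (ω b) ≡ wt B b
  ω-wt b = trans (wt-word _ (image b)) (ComponentIso.to-wt (iso b) b (rep-conn b))

  same-rep : ∀ {b} (m : Maybe (Carrier B)) → (∀ {c} → m ≡ just c → rep c ≡ rep b) →
             mapMaybe (embed (rep b)) m ≡ mapMaybe ω m
  same-rep nothing h = refl
  same-rep (just c) h = cong (λ r → just (embed r c)) (sym (h refl))

  ω-e : ∀ i b → eW i (ω b) ≡ mapMaybe ω (e B i b)
  ω-e i b = trans (sym (eT-word i _ (image b))) (trans (cong (mapMaybe word) (ComponentIso.to-e (iso b) i b (rep-conn b)))
    (trans (map-map word _ (e B i b)) (same-rep (e B i b)
      (λ eq → colour-edge _≟ᵇ_ edges (∈edges⁺ i (IsCrystal.axiom-b-to isC i b _ eq))))))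

  ω-f : ∀ i b → fW i (ω b) ≡ mapMaybe ω (f B i b)
  ω-f i b = trans (sym (fT-word i _ (image b))) (trans (cong (mapMaybe word) (ComponentIso.to-f (iso b) i b (rep-conn b)))
    (trans (map-map word _ (f B i b)) (same-rep (f B i b)
      (λ eq → sym (colour-edge _≟ᵇ_ edges (∈edges⁺ i eq))))))

  selB : Carrier B → Maybe (Fin k)
  selB b = sel (ω b)

  e-transfer : ∀ {i b} → e B i b ≢ nothing → eW i (ω b) ≢ nothing
  e-transfer {i} {b} ne z = ne (map-nothing (e B i b) (trans (sym (ω-e i b)) z))

  selB-nothing : ∀ {b} → selB b ≡ nothing → IsHW B b
  selB-nothing {b} s i = map-nothing (e B i b) (trans (sym (ω-e i b)) (sel-nothing (ω b) s i))

  selB-just : ∀ {b i} → selB b ≡ just i → e B i b ≢ nothing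
  selB-just {b} {i} s z = sel-just (ω b) s (trans (ω-e i b) (cong (mapMaybe ω) z))

  selB-f : ∀ {b i c} → selB b ≡ just i → f B i b ≡ just c → selB c ≡ just i
  selB-f {b} {i} s eq = sel-f (ω b) s (trans (ω-f i b) (cong (mapMaybe ω) eq))

  selB-e : ∀ {b i c} → selB b ≡ just i → e B i b ≡ just c → e B i c ≢ nothing → selB c ≡ just i
  selB-e {b} {i} s eq ne = sel-e (ω b) s (trans (ω-e i b) (cong (mapMaybe ω) eq)) (e-transfer ne)

  wt-nonneg : ∀ b → NonNeg (wt B b)
  wt-nonneg b = subst NonNeg (ω-wt b) (word-nonneg (ω b))
    where
    word-nonneg : ∀ (w : Word {k} {⊤}) → NonNeg (wtW w)
    word-nonneg [] = zeroWt-nonneg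
    word-nonneg ((_ , S) ∷ w) = ⊕-nonneg (indicator S) (wtW w) (indicator-nonneg S) (word-nonneg w)

  -- At a highest weight element ε is zero, so twice each gap is a string length φ and hence
  -- non-negative. Non-negative coordinates come from the word `ω b`.
  hw-partition : ∀ b → IsHW B b → IsPartition (wt B b)
  hw-partition b hw = wt-nonneg b , λ i → ℤP.0≤i-j⇒j≤i (nonneg (gap i (wt B b)) (eq i))
    where
    eq : ∀ i → + φ isC i b ≡ + 2 ℤ.* gap i (wt B b)
    eq i = trans (sym (ℤP.+-identityʳ _)) (trans (cong (λ z → + φ isC i b ℤ.- + z) (sym (e-nothing isC (hw i)))) (φ-ε isC i b))
    nonneg : ∀ d {p} → + p ≡ + 2 ℤ.* d → 0ℤ ℤ.≤ d
    nonneg (+ d) _ = ℤ.+≤+ ℕ.z≤n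
    nonneg -[1+ d ] ()

  shape-weight : ∀ (α : Wt k) → NonNeg α → Vec.map +_ (shapeOf α) ≡ α
  shape-weight = go
    where
    go : ∀ {n} (α : Vec ℤ n) → NonNeg α → Vec.map +_ (Vec.map ∣_∣ α) ≡ α
    go [] nn = refl
    go (x ∷ α) nn = cong₂ _∷_ (ℤP.0≤i⇒+∣i∣≡i (nn zero)) (go α (λ j → nn (suc j)))

  shape-antitone : ∀ (α : Wt k) → IsPartition α → ∀ i → lookup (shapeOf α) (hi i) ≤ lookup (shapeOf α) (lo i)
  shape-antitone α (nn , anti) i = ℤ.drop‿+≤+ (subst₂ ℤ._≤_ (at (hi i)) (at (lo i)) (anti i))
    where
    at : ∀ j → lookup α j ≡ + lookup (shapeOf α) j
    at j = trans (sym (ℤP.0≤i⇒+∣i∣≡i (nn j))) (cong +_ (sym (VecP.lookup-map j ∣_∣ α)))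

  Gs : Carrier B → List (Wt k)
  Gs b = G (shapeOf (wt B b))

  hws : List (Carrier B)
  hws = HWlist B fin

  ∈hws⁻ : ∀ {b} → b ∈ hws → IsPartition (wt B b)
  ∈hws⁻ m = hw-partition _ (proj₂ (∈-filter⁻ (IsHW? B) {xs = xs} m))

  concatMap-symmetric : ∀ {s : Wt k → Wt k} bs → (∀ {b} → b ∈ bs → map s (Gs b) ↭ Gs b) →
                        map s (concatMap Gs bs) ↭ concatMap Gs bs
  concatMap-symmetric [] h = ↭-refl
  concatMap-symmetric {s} (b ∷ bs) h = ↭-trans (↭-reflexive (ListP.map-++ s (Gs b) (concatMap Gs bs)))
    (++⁺ (h (here refl)) (concatMap-symmetric bs (λ m → h (there m))))

  Gs-sum : ∀ g → Antisym g → ∀ {b} → IsPartition (wt B b) → ∑ (λ α → K 0 α g) (Gs b) ≡ K 0 (wt B b) g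
  Gs-sum g anti {b} p = trans (Shape.G-sum (shapeOf (wt B b)) (shape-antitone (wt B b) p) g anti) (cong (λ v → K 0 v g) (shape-weight (wt B b) (proj₁ p)))

  pairing : ∀ g → Antisym g → ∑ (λ α → K 0 α g) (ch B fin) ≡ ∑ (λ α → K 0 α g) (concatMap Gs hws)
  pairing g anti = begin
    ∑ κ_g (ch B fin)                    ≡⟨ ∑-map κ_g (wt B) xs ⟩
    ∑ (λ b → κ_g (wt B b)) xs           ≡⟨ highest-weight-sum isC xs-unique (λ i _ _ → ∈xs _) (λ i _ _ → ∈xs _)
                                             selB selB-nothing selB-just selB-f selB-e {g} anti ⟩
    ∑ (λ b → κ_g (wt B b)) hws          ≡⟨ ∑-cong {h = λ b → κ_g (wt B b)} {λ b → ∑ κ_g (Gs b)} hws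
                                             (λ m → sym (Gs-sum g anti (∈hws⁻ m))) ⟩
    ∑ (λ b → ∑ κ_g (Gs b)) hws          ≡⟨ sym (∑-concatMap κ_g Gs hws) ⟩
    ∑ κ_g (concatMap Gs hws) ∎
    where
    open ≡-Reasoning
    κ_g : Wt k → ℤ
    κ_g α = K 0 α g

  ch-nonneg : ∀ {α} → α ∈ ch B fin → NonNeg α
  ch-nonneg m with ∈-map⁻ (wt B) m
  ... | b , _ , refl = wt-nonneg b

  Gs-nonneg : ∀ {α} → α ∈ concatMap Gs hws → NonNeg α
  Gs-nonneg {α} m = from (find (∈-concatMap⁻ Gs {xs = hws} m))
    where
    from : (∃ λ b → b ∈ hws × α ∈ Gs b) → NonNeg α
    from (b , m , m′) = Shape.G-nonneg (shapeOf (wt B b)) (shape-antitone (wt B b) (∈hws⁻ m)) m′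

  character-expansion : ch B fin ↭ concatMap Gs hws
  character-expansion = alternants-separate (ch B fin) (concatMap Gs hws) ch-nonneg Gs-nonneg
    (character-symmetric isC xs-unique (λ i _ _ → ∈xs _) (λ i _ _ → ∈xs _))
    (λ i → concatMap-symmetric hws (λ {b} m → Shape.G-symmetric (shapeOf (wt B b)) (shape-antitone (wt B b) (∈hws⁻ m)) i))
    pairing

theorem1p1 : (k : ℕ) (B : RawCrystal k) (fin : Finite (Carrier B)) →
    IsCrystal B → IsNormal B →
    (∀ b → IsHW B b → IsPartition (wt B b)) ×
    (ch B fin ↭ concatMap (λ b → G (shapeOf (wt B b))) (HWlist B fin))
theorem1p1 k B fin isC normal = hw-partition B fin isC normal , character-expansion B fin isC normal
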